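{- Let $\mathbf{N}^+$ denote the set of positive integers, and fix a function $f:\mathbf{N}^+\to\mathbf{N}^+$ with $\lim_{n\to\infty}f(n)=\infty$. Then there exists a sequence $(x_n)_{n\ge1}$ in $[0,1)$ with Poissonian pair correlations such that $g(n)\le f(n)$ for all sufficiently large $n$, where $g(n)$ denotes the number of different gap lengths between neighboring elements of $x_1,\ldots,x_n$ on the torus.
   Context: The torus is identified with $[0,1)$, and $|\cdot|$ applied to a difference of two points denotes the distance from the nearest integer (so $|z|=\min(z,1-z)$ for $z\in[0,1)$). A sequence $x=(x_n)_{n\ge1}$ in $[0,1)$ has Poissonian pair correlations if for every real $s>0$, $$\lim_{N\to\infty} F_{x,N}(s)=2s,\qquad\text{where } F_{x,N}(s):=\frac1N\#\left\{1\le i\neq j\le N: |x_i-x_j|<\frac sN\right\},$$ the count being over ordered pairs $(i,j)$ with $i\ne j$. Gap lengths: for an integer $N\ge2$, let $\sigma$ be a permutation of $\{1,\ldots,N\}$ with $x_{\sigma(1)}\le\cdots\le x_{\sigma(N)}$, and set $\sigma(N+1):=\sigma(1)$. The set of different gap lengths is $$G(N):=\{r\in[0,1): r=|x_{\sigma(k+1)}-x_{\sigma(k)}|\text{ for some }k=1,\ldots,N\},$$ and $g(N):=\#G(N)$. -}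

module Defs where

open import Data.Empty using (⊥-elim)
open import Data.Fin using (Fin; toℕ)
import Data.Fin as Fin
open import Data.Fin.Permutation using (Permutation′; _⟨$⟩ʳ_)
open import Data.Integer using (+_; +≤+)
open import Data.Irrelevant using ([_])
open import Data.List using (List; []; _∷_; length; allFin; cartesianProduct)
open import Data.List.Membership.Propositional using (_∈_)
open import Data.List.Membership.Propositional.Properties using (∈-allFin; ∈-cartesianProduct⁺)
import Data.List.Membership.Setoid as SetoidMembership
import Data.List.Relation.Unary.All as All
open import Data.List.Relation.Unary.AllPairs using ([]; _∷_)
open import Data.List.Relation.Unary.Any using (here; there)
open import Data.List.Relation.Unary.Unique.Propositional using (Unique)
open import Data.List.Relation.Unary.Unique.Propositional.Properties using (allFin⁺; cartesianProduct⁺)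
import Data.List.Relation.Unary.Unique.Setoid as SetoidUnique
open import Data.Nat using (ℕ; suc; NonZero; ≢-nonZero; ≢-nonZero⁻¹)
import Data.Nat as ℕ
open import Data.Nat.Coprimality using (1-coprimeTo)
open import Data.Nat.DivMod using (_mod_)
import Data.Nat.Properties as ℕₚ
open import Data.Product using (_×_; ∃; _,_; proj₁; proj₂)
open import Data.Rational using (ℚ; 0ℚ; 1ℚ; ½; _/_; _+_; _-_; -_; _*_; _⊓_; ∣_∣; _≤_; _<_; Positive; nonNegative; positive; *≤*)
open import Data.Rational.Properties
open import Data.Rational.Solver using (module +-*-Solver)
open import Data.Refinement using (Refinement-syntax; value; _,_)
open import Data.Sum using (inj₁; inj₂)
open import Function.Bundles using (_⇔_; mk⇔; Equivalence)
open import Level using (0ℓ)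
open import Relation.Binary.Bundles using (Setoid)
open import Relation.Binary.PropositionalEquality using (_≡_; _≢_; refl; sym; trans; cong; subst; subst₂)
import Relation.Binary.PropositionalEquality as ≡
open import Relation.Nullary using (¬_)

ℕ⁺ : Set
ℕ⁺ = [ n ∈ ℕ ∣ NonZero n ]

nonZero⁺ : (n : ℕ⁺) → NonZero (value n)
nonZero⁺ (n , [ n≢0 ]) = ≢-nonZero (≢-nonZero⁻¹ n {{n≢0}})

-- The positive integers 1, …, N, indexed by Fin N.
index : ∀ {N} → Fin N → ℕ⁺
index i = suc (toℕ i) , [ _ ]

TendsToInfinity : (ℕ⁺ → ℕ⁺) → Set
TendsToInfinity f =
  (M : ℕ) → ∃ λ (n₀ : ℕ) → (n : ℕ⁺) → n₀ ℕ.≤ value n → M ℕ.≤ value (f n)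

module ℚ-Estimates where

  ∣p∣<ε : ∀ {p ε} → p < ε → - p < ε → ∣ p ∣ < ε
  ∣p∣<ε {p} p<ε -p<ε with ∣p∣≡p∨∣p∣≡-p p
  ... | inj₁ eq = subst (_< _) (sym eq) p<ε
  ... | inj₂ eq = subst (_< _) (sym eq) -p<ε

  p≤∣p∣ : ∀ p → p ≤ ∣ p ∣
  p≤∣p∣ p with ≤-total 0ℚ p
  ... | inj₁ 0≤p = ≤-reflexive (sym (0≤p⇒∣p∣≡p 0≤p))
  ... | inj₂ p≤0 = ≤-trans p≤0 (0≤∣p∣ p)

  -p≤∣p∣ : ∀ p → - p ≤ ∣ p ∣
  -p≤∣p∣ p = subst (- p ≤_) (∣-p∣≡∣p∣ p) (p≤∣p∣ (- p))

  neg-sub : ∀ p q → - (p - q) ≡ q - p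
  neg-sub = solve 2 (λ p q → :- (p :- q) := q :- p) refl
    where open +-*-Solver

  ∣p-q∣≡∣q-p∣ : ∀ p q → ∣ p - q ∣ ≡ ∣ q - p ∣
  ∣p-q∣≡∣q-p∣ p q = trans (sym (∣-p∣≡∣p∣ (p - q))) (cong ∣_∣ (neg-sub p q))

  q+[p-q]≡p : ∀ p q → q + (p - q) ≡ p
  q+[p-q]≡p = solve 2 (λ p q → q :+ (p :- q) := p) refl
    where open +-*-Solver

  [q+p]-q≡p : ∀ p q → (q + p) - q ≡ p
  [q+p]-q≡p = solve 2 (λ p q → (q :+ p) :- q := p) refl
    where open +-*-Solver

  ∣p-q∣<ε⇒p<q+ε : ∀ p q {ε} → ∣ p - q ∣ < ε → p < q + ε
  ∣p-q∣<ε⇒p<q+ε p q h =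
    subst (_< _) (q+[p-q]≡p p q) (+-monoʳ-< q (≤-<-trans (p≤∣p∣ (p - q)) h))

  p<q+ε⇒p-q<ε : ∀ p q {ε} → p < q + ε → p - q < ε
  p<q+ε⇒p-q<ε p q {ε} h = subst (p - q <_) ([q+p]-q≡p ε q) (+-monoˡ-< (- q) h)

  ∣-∣-close : ∀ p q {ε} → p < q + ε → q < p + ε → ∣ p - q ∣ < ε
  ∣-∣-close p q h k =
    ∣p∣<ε (p<q+ε⇒p-q<ε p q h)
          (subst (_< _) (sym (neg-sub p q)) (p<q+ε⇒p-q<ε q p k))

  swap-close : ∀ p q {ε} → ∣ p - q ∣ < ε → ∣ q - p ∣ < ε
  swap-close p q = subst (_< _) (∣p-q∣≡∣q-p∣ p q)

  half+half : ∀ ε → ε * ½ + ε * ½ ≡ ε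
  half+half ε = trans (sym (*-distribˡ-+ ε ½ ½)) (*-identityʳ ε)

  half-pos : ∀ {ε} → 0ℚ < ε → 0ℚ < ε * ½
  half-pos {ε} 0<ε = positive⁻¹ (ε * ½) {{pos*pos⇒pos ε {{positive 0<ε}} ½}}

  triangle : ∀ p q r {ε} → ∣ p - q ∣ < ε * ½ → ∣ q - r ∣ < ε * ½ → ∣ p - r ∣ < ε
  triangle p q r {ε} h k =
    subst₂ _<_ refl (half+half ε)
      (≤-<-trans
        (subst (λ t → ∣ t ∣ ≤ ∣ p - q ∣ + ∣ q - r ∣) (eq p q r) (∣p+q∣≤∣p∣+∣q∣ (p - q) (q - r)))
        (+-mono-< h k))
    where
    eq : ∀ p q r → (p - q) + (q - r) ≡ p - r
    eq = solve 3 (λ p q r → (p :- q) :+ (q :- r) := p :- r) refl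
      where open +-*-Solver

  +-close : ∀ p q r s {ε} → ∣ p - q ∣ < ε * ½ → ∣ r - s ∣ < ε * ½ → ∣ (p + r) - (q + s) ∣ < ε
  +-close p q r s {ε} h k =
    subst₂ _<_ refl (half+half ε)
      (≤-<-trans
        (subst (λ t → ∣ t ∣ ≤ ∣ p - q ∣ + ∣ r - s ∣) (eq p q r s) (∣p+q∣≤∣p∣+∣q∣ (p - q) (r - s)))
        (+-mono-< h k))
    where
    eq : ∀ p q r s → (p - q) + (r - s) ≡ (p + r) - (q + s)
    eq = solve 4 (λ p q r s → (p :- q) :+ (r :- s) := (p :+ r) :- (q :+ s)) refl
      where open +-*-Solver

  neg-close : ∀ p q {ε} → ∣ p - q ∣ < ε → ∣ (- p) - (- q) ∣ < ε
  neg-close p q h = subst (λ t → ∣ t ∣ < _) (eq p q) (swap-close p q h)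
    where
    eq : ∀ p q → q - p ≡ (- p) - (- q)
    eq = solve 2 (λ p q → q :- p := (:- p) :- (:- q)) refl
      where open +-*-Solver

  ∣∣-< : ∀ p q {ε} → ∣ p - q ∣ < ε → ∣ p ∣ < ∣ q ∣ + ε
  ∣∣-< p q h =
    ≤-<-trans
      (subst (λ t → ∣ t ∣ ≤ ∣ q ∣ + ∣ p - q ∣) (q+[p-q]≡p p q) (∣p+q∣≤∣p∣+∣q∣ q (p - q)))
      (+-monoʳ-< ∣ q ∣ h)

  ∣∣-close : ∀ p q {ε} → ∣ p - q ∣ < ε → ∣ ∣ p ∣ - ∣ q ∣ ∣ < ε
  ∣∣-close p q h = ∣-∣-close ∣ p ∣ ∣ q ∣ (∣∣-< p q h) (∣∣-< q p (swap-close p q h))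

  ⊓-< : ∀ p q r s {ε} → p < q + ε → r < s + ε → p ⊓ r < (q ⊓ s) + ε
  ⊓-< p q r s h k with ⊓-sel q s
  ... | inj₁ eq = subst (λ t → p ⊓ r < t + _) (sym eq) (≤-<-trans (p⊓q≤p p r) h)
  ... | inj₂ eq = subst (λ t → p ⊓ r < t + _) (sym eq) (≤-<-trans (p⊓q≤q p r) k)

  ⊓-close : ∀ p q r s {ε} → ∣ p - q ∣ < ε → ∣ r - s ∣ < ε → ∣ (p ⊓ r) - (q ⊓ s) ∣ < ε
  ⊓-close p q r s h k =
    ∣-∣-close (p ⊓ r) (q ⊓ s)
      (⊓-< p q r s (∣p-q∣<ε⇒p<q+ε p q h) (∣p-q∣<ε⇒p<q+ε r s k))
      (⊓-< q p s r (∣p-q∣<ε⇒p<q+ε q p (swap-close p q h)) (∣p-q∣<ε⇒p<q+ε s r (swap-close r s k)))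

  1/n-pos : ∀ n .{{_ : NonZero n}} → Positive (+ 1 / n)
  1/n-pos n = normalize-pos 1 n

  1/n≤1 : ∀ n .{{_ : NonZero n}} → + 1 / n ≤ 1ℚ
  1/n≤1 (suc n) =
    subst (_≤ 1ℚ) (sym (normalize-coprime {1} {n} (1-coprimeTo (suc n))))
      (*≤* (+≤+ (ℕ.s≤s ℕ.z≤n)))

  *-close : ∀ p q n .{{_ : NonZero n}} {ε} → ∣ p - q ∣ < ε → ∣ p * (+ 1 / n) - q * (+ 1 / n) ∣ < ε
  *-close p q n {ε} h = ≤-<-trans bound h
    where
    c = + 1 / n

    0≤c : 0ℚ ≤ c
    0≤c = <⇒≤ (positive⁻¹ c {{1/n-pos n}})

    factor : ∀ p q c → p * c - q * c ≡ (p - q) * c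
    factor = solve 3 (λ p q c → p :* c :- q :* c := (p :- q) :* c) refl
      where open +-*-Solver

    eq : ∣ p * c - q * c ∣ ≡ ∣ p - q ∣ * c
    eq = trans (cong ∣_∣ (factor p q c))
           (trans (∣p*q∣≡∣p∣*∣q∣ (p - q) c) (cong (∣ p - q ∣ *_) (0≤p⇒∣p∣≡p 0≤c)))

    bound : ∣ p * c - q * c ∣ ≤ ∣ p - q ∣
    bound = subst₂ _≤_ (sym eq) (*-identityʳ ∣ p - q ∣)
      (*-monoˡ-≤-nonNeg ∣ p - q ∣ {{nonNegative (0≤∣p∣ (p - q))}} (1/n≤1 n))

open ℚ-Estimates

-- Real numbers as Cauchy sequences of rationals; equality is _≈ℝ_, not _≡_.
record ℝ : Set where
  constructor mkℝ
  field
    seq    : ℕ → ℚ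
    cauchy : ∀ {ε} → 0ℚ < ε → ∃ λ K → ∀ m n → K ℕ.≤ m → K ℕ.≤ n → ∣ seq m - seq n ∣ < ε

open ℝ public

infixl 6 _+ℝ_ _-ℝ_
infixl 7 _÷ℝ_ _⊓ℝ_
infix  8 -ℝ_
infix  4 _<ℝ_ _≤ℝ_ _≈ℝ_ _∈[0,1⟩

_<ℝ_ : ℝ → ℝ → Set
x <ℝ y = ∃ λ δ → 0ℚ < δ × ∃ λ K → ∀ n → K ℕ.≤ n → seq x n + δ ≤ seq y n

_≤ℝ_ : ℝ → ℝ → Set
x ≤ℝ y = ¬ (y <ℝ x)

_≈ℝ_ : ℝ → ℝ → Set
x ≈ℝ y = ∀ {ε} → 0ℚ < ε → ∃ λ K → ∀ n → K ℕ.≤ n → ∣ seq x n - seq y n ∣ < ε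

≈ℝ-setoid : Setoid 0ℓ 0ℓ
≈ℝ-setoid = record
  { Carrier       = ℝ
  ; _≈_           = _≈ℝ_
  ; isEquivalence = record
    { refl  = λ {x} 0<ε →
        0 , λ n _ → subst (_< _) (sym (cong ∣_∣ (+-inverseʳ (seq x n)))) 0<ε
    ; sym   = λ {x} {y} x≈y 0<ε → let (K , h) = x≈y 0<ε in
        K , λ n K≤n → swap-close (seq x n) (seq y n) (h n K≤n)
    ; trans = λ {x} {y} {z} x≈y y≈z 0<ε →
        let (K , h) = x≈y (half-pos 0<ε) ; (L , k) = y≈z (half-pos 0<ε) in
        K ℕ.⊔ L , λ n K⊔L≤n → triangle (seq x n) (seq y n) (seq z n)
          (h n (ℕₚ.m⊔n≤o⇒m≤o K L K⊔L≤n)) (k n (ℕₚ.m⊔n≤o⇒n≤o K L K⊔L≤n))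
    }
  }

fromℚ : ℚ → ℝ
fromℚ q = mkℝ (λ _ → q)
  λ 0<ε → 0 , λ _ _ _ _ → subst (_< _) (sym (cong ∣_∣ (+-inverseʳ q))) 0<ε

0ℝ 1ℝ : ℝ
0ℝ = fromℚ 0ℚ
1ℝ = fromℚ 1ℚ

_+ℝ_ : ℝ → ℝ → ℝ
mkℝ x cx +ℝ mkℝ y cy = mkℝ (λ n → x n + y n) λ 0<ε →
  let (K , h) = cx (half-pos 0<ε) ; (L , k) = cy (half-pos 0<ε) in
  K ℕ.⊔ L , λ m n K⊔L≤m K⊔L≤n → +-close (x m) (x n) (y m) (y n)
    (h m n (ℕₚ.m⊔n≤o⇒m≤o K L K⊔L≤m) (ℕₚ.m⊔n≤o⇒m≤o K L K⊔L≤n))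
    (k m n (ℕₚ.m⊔n≤o⇒n≤o K L K⊔L≤m) (ℕₚ.m⊔n≤o⇒n≤o K L K⊔L≤n))

-ℝ_ : ℝ → ℝ
-ℝ mkℝ x cx = mkℝ (λ n → - x n) λ 0<ε → let (K , h) = cx 0<ε in
  K , λ m n K≤m K≤n → neg-close (x m) (x n) (h m n K≤m K≤n)

_-ℝ_ : ℝ → ℝ → ℝ
x -ℝ y = x +ℝ (-ℝ y)

∣_∣ℝ : ℝ → ℝ
∣ mkℝ x cx ∣ℝ = mkℝ (λ n → ∣ x n ∣) λ 0<ε → let (K , h) = cx 0<ε in
  K , λ m n K≤m K≤n → ∣∣-close (x m) (x n) (h m n K≤m K≤n)

_⊓ℝ_ : ℝ → ℝ → ℝ
mkℝ x cx ⊓ℝ mkℝ y cy = mkℝ (λ n → x n ⊓ y n) λ 0<ε →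
  let (K , h) = cx 0<ε ; (L , k) = cy 0<ε in
  K ℕ.⊔ L , λ m n K⊔L≤m K⊔L≤n → ⊓-close (x m) (x n) (y m) (y n)
    (h m n (ℕₚ.m⊔n≤o⇒m≤o K L K⊔L≤m) (ℕₚ.m⊔n≤o⇒m≤o K L K⊔L≤n))
    (k m n (ℕₚ.m⊔n≤o⇒n≤o K L K⊔L≤m) (ℕₚ.m⊔n≤o⇒n≤o K L K⊔L≤n))

_÷ℝ_ : ℝ → (n : ℕ) .{{_ : NonZero n}} → ℝ
mkℝ x cx ÷ℝ d = mkℝ (λ n → x n * (+ 1 / d)) λ 0<ε → let (K , h) = cx 0<ε in
  K , λ m n K≤m K≤n → *-close (x m) (x n) d (h m n K≤m K≤n)

_∈[0,1⟩ : ℝ → Set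
x ∈[0,1⟩ = 0ℝ ≤ℝ x × x <ℝ 1ℝ

-- The distance of x - y from the nearest integer, for x and y in [0,1). There
-- x - y lies in (-1,1), and as the distance is even in x - y it is min(z, 1 - z)
-- with z = |x - y| in [0,1).
dist : ℝ → ℝ → ℝ
dist x y = ∣ x -ℝ y ∣ℝ ⊓ℝ (1ℝ -ℝ ∣ x -ℝ y ∣ℝ)

-- #{ a ∣ P a } = k, elements being identified along the setoid equality.
-- Cardinality is a relation and not a function because order and equality on ℝ
-- are not decidable.
HasCard : (S : Setoid 0ℓ 0ℓ) → (Setoid.Carrier S → Set) → ℕ → Set
HasCard S P k = ∃ λ as → length as ≡ k × SetoidUnique.Unique S as × (∀ a → (a ∈ₛ as) ⇔ P a)
  where open SetoidMembership S renaming (_∈_ to _∈ₛ_)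

ClosePair : (x : ℕ⁺ → ℝ) (N : ℕ) .{{_ : NonZero N}} (s : ℝ) → Fin N × Fin N → Set
ClosePair x N s (i , j) = i ≢ j × dist (x (index i)) (x (index j)) <ℝ s ÷ℝ N

PairCount : (x : ℕ⁺ → ℝ) (N : ℕ) .{{_ : NonZero N}} (s : ℝ) → ℕ → Set
PairCount x N s = HasCard (≡.setoid (Fin N × Fin N)) (ClosePair x N s)

-- The value of F_{x,N}(s) is k / N for the k with PairCount x N s k, and the
-- condition below is imposed on every such k. By pairCount-exists such a k cannot
-- fail to exist, so quantifying universally over it is not vacuous.
PoissonianPairCorrelations : (ℕ⁺ → ℝ) → Set
PoissonianPairCorrelations x =
  (s : ℝ) → 0ℝ <ℝ s → (ε : ℝ) → 0ℝ <ℝ ε →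
  ∃ λ (N₀ : ℕ) → (N : ℕ) .{{_ : NonZero N}} → N₀ ℕ.≤ N →
  (k : ℕ) → PairCount x N s k → ∣ fromℚ (+ k / N) -ℝ (s +ℝ s) ∣ℝ <ℝ ε

Sorts : ∀ {N} → (ℕ⁺ → ℝ) → Permutation′ N → Set
Sorts {N} x σ = (i j : Fin N) → i Fin.≤ j → x (index (σ ⟨$⟩ʳ i)) ≤ℝ x (index (σ ⟨$⟩ʳ j))

-- k ↦ k + 1 cyclically, so that the last index is followed by the first.
next : ∀ {N} .{{_ : NonZero N}} → Fin N → Fin N
next {N} k = suc (toℕ k) mod N

IsGap : ∀ {N} .{{_ : NonZero N}} → (ℕ⁺ → ℝ) → Permutation′ N → ℝ → Set
IsGap {N} x σ r =
  r ∈[0,1⟩ × ∃ λ (k : Fin N) → r ≈ℝ dist (x (index (σ ⟨$⟩ʳ next k))) (x (index (σ ⟨$⟩ʳ k)))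

-- g(N) = m. Two permutations sorting x₁, …, x_N list the same points in the same
-- order, hence have the same gaps, so it does not matter which σ is taken.
GapCount : (x : ℕ⁺ → ℝ) (N : ℕ) .{{_ : NonZero N}} → ℕ → Set
GapCount x N m = ∃ λ (σ : Permutation′ N) → Sorts x σ × HasCard ≈ℝ-setoid (IsGap x σ) m

private

  select : {A : Set} (P : A → Set) (as : List A) → Unique as →
           ¬ ¬ (∃ λ bs → Unique bs × (∀ a → (a ∈ bs) ⇔ (a ∈ as × P a)))
  select P [] _ ¬∃ = ¬∃ ([] , [] , λ a → mk⇔ (λ ()) (λ ()))
  select {A} P (a ∷ as) (a∉as ∷ as!) ¬∃ = select P as as! step
    where
    step : ¬ (∃ λ bs → Unique bs × (∀ c → (c ∈ bs) ⇔ (c ∈ as × P c)))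
    step (bs , bs! , bs⇔) = ¬¬Pa ¬Pa
      where
      open Equivalence

      ¬Pa : ¬ P a
      ¬Pa Pa = ¬∃ (a ∷ bs , All.tabulate a≢ ∷ bs! , λ c → mk⇔ (fwd c) (bwd c))
        where
        a≢ : ∀ {c} → c ∈ bs → a ≢ c
        a≢ c∈bs = All.lookup a∉as (proj₁ (to (bs⇔ _) c∈bs))
        fwd : ∀ c → c ∈ a ∷ bs → c ∈ a ∷ as × P c
        fwd c (here refl)  = here refl , Pa
        fwd c (there c∈bs) = let (c∈as , Pc) = to (bs⇔ c) c∈bs in there c∈as , Pc
        bwd : ∀ c → c ∈ a ∷ as × P c → c ∈ a ∷ bs
        bwd c (here refl , _)   = here refl
        bwd c (there c∈as , Pc) = there (from (bs⇔ c) (c∈as , Pc))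

      ¬¬Pa : ¬ ¬ P a
      ¬¬Pa ¬pa = ¬∃ (bs , bs! , λ c → mk⇔ (fwd c) (bwd c))
        where
        fwd : ∀ c → c ∈ bs → c ∈ a ∷ as × P c
        fwd c c∈bs = let (c∈as , Pc) = to (bs⇔ c) c∈bs in there c∈as , Pc
        bwd : ∀ c → c ∈ a ∷ as × P c → c ∈ bs
        bwd c (here refl , Pc)  = ⊥-elim (¬pa Pc)
        bwd c (there c∈as , Pc) = from (bs⇔ c) (c∈as , Pc)

pairCount-exists : ∀ x N .{{_ : NonZero N}} s → ¬ ¬ (∃ λ k → PairCount x N s k)
pairCount-exists x N s ¬∃ =
  select (ClosePair x N s) pairs (cartesianProduct⁺ (allFin⁺ N) (allFin⁺ N))
    λ (as , as! , as⇔) → ¬∃ (length as , as , refl , as! , λ a →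
      mk⇔ (λ a∈ → proj₂ (Equivalence.to (as⇔ a) a∈))
          (λ Pa → Equivalence.from (as⇔ a) (∈-cartesianProduct⁺ (∈-allFin _) (∈-allFin _) , Pa)))
  where pairs = cartesianProduct (allFin N) (allFin N)

{-# OPTIONS --safe #-}
-- The sequence runs through layers {u / n_k : u < n_k}. For two layers with g = gcd(n, m) the differences
-- u / n - v / m run g times through all residues c / lcm(n, m) modulo 1, so 2τnm pairs, up to an
-- error of g, lie within distance τ. Hence the pair correlations are Poissonian as soon as n_k = o(N_k) and
-- Σ_{j<k} gcd(n_j, n_k) = o(n_k), where N_k = Σ_{j<k} n_j. On the other hand, if all n_j with j ≤ k divide
-- L ≤ B n_{k-1}, then all gaps are multiples of 1 / L and at most B / L, so there are at most B + 1 gap lengths.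
-- Both are achieved with n = 2^(d - 2^I) F_I, where F_I = 2^(2^I) + 1 are the pairwise coprime Fermat numbers:
-- an epoch of level t lets I run through an interval of length r(t), the next epoch has d larger by t + 4, and
-- the level is raised so slowly that B, which depends on t only, stays below f.
module Submission where

open import Defs
open import Data.Nat using (ℕ; _≤_)
open import Data.Product using (_×_; ∃)
open import Data.Refinement using (value)

open import Data.Fin using (Fin; zero; suc; toℕ; fromℕ<; punchIn)
open import Data.Fin.Permutation using (Permutation′; permutation; _⟨$⟩ʳ_; _⟨$⟩ˡ_; inverseʳ)
import Data.Fin.Permutation as Permutation
open import Data.Fin.Properties using (toℕ<n; toℕ-fromℕ<; toℕ-injective; injective⇒≤)
open import Data.List using (List; []; _∷_; _++_; length; map; filter; tabulate; lookup; allFin; cartesianProduct; deduplicate)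
open import Data.List.Membership.Propositional using (_∈_; find; lose)
open import Data.List.Membership.Propositional.Properties
open import Data.List.Properties using (map-tabulate; filter-++; length-++; length-map; length-upTo)
import Data.List.Relation.Unary.All as All
open import Data.List.Relation.Unary.AllPairs using ([]; _∷_)
import Data.List.Relation.Unary.Any as Any
import Data.List.Relation.Unary.Any.Properties as Anyₚ
open import Data.List.Relation.Unary.Unique.Propositional using (Unique)
open import Data.List.Relation.Unary.Unique.Propositional.Properties using (allFin⁺; cartesianProduct⁺; filter⁺)
import Data.List.Relation.Unary.Unique.Setoid.Properties as UniqueSetoid
open import Data.Nat
open import Data.Nat.Coprimality using (Coprime; coprime-Bézout; coprime-divisor; coprime-/gcd)
import Data.Nat.Coprimality as Coprimality
open import Data.Nat.Divisibility
open import Data.Nat.DivMod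
open import Data.Nat.GCD
open import Data.Nat.Properties
open import Algebra.Properties.CommutativeMonoid.Sum +-0-commutativeMonoid using (sum; sum-cong-≗; sum-permute)
open import Data.List.Relation.Unary.Unique.DecPropositional.Properties _≟_ using (deduplicate-!)
open import Data.Nat.Tactic.RingSolver using (solve-∀)
open import Data.Product using (_,_; proj₁; proj₂)
open import Data.Rational using (ℚ; 0ℚ; 1ℚ; ½; mkℚ; toℚᵘ)
import Data.Rational as ℚ
import Data.Rational.Properties as ℚₚ
open import Data.Rational.Solver using (module +-*-Solver)
open import Data.Rational.Unnormalised using (mkℚᵘ; *≡*; *<*; *≤*)
import Data.Rational.Unnormalised as ℚᵘ
import Data.Rational.Unnormalised.Properties as ℚᵘₚ
open import Data.Sum using (_⊎_; inj₁; inj₂; [_,_]′)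
open import Function.Bundles using (_⇔_; mk⇔; Equivalence)
open import Relation.Binary.Bundles using (Setoid)
open import Relation.Binary.Definitions using (tri<; tri≈; tri>)
open import Relation.Binary.PropositionalEquality
open import Relation.Nullary
open import Relation.Nullary.Decidable using (_×-dec_; ¬?)
open import Relation.Unary using (Decidable)

-- Finite sums over residues

-- The two requirements pull against each other: Poissonian pair correlations call for many nearly
-- coprime layers, whereas a common multiple of all layer sizes that is at most B times a recent one
-- has room for few odd factors. The way out is to reuse the same Fermat numbers in all epochs of a
-- level and to let only the power of 2 grow. Two layers of one epoch have between 2^d and 2^(d + 1)
-- points each, but their gcd is at most 2^(d - 2^I). A layer may share its Fermat number with a
-- layer of an earlier epoch, whose size then divides its own; this is harmless because the sizes
-- grow geometrically from epoch to epoch. The constants follow. With the growth factor 2^(t + 4),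
-- the gcds with layers of earlier epochs add up to at most 2^d / (t + 1). With r(t) = (t + 1) 2^(t
-- + 4) layers, an epoch has at least t + 1 times 2^(d + t + 4) points, so the next layers are small
-- against it. With indices from (t + 1) r(t) on, the gcds inside an epoch add up to at most 2^d /
-- (t + 1). These proportions vanish because t tends to infinity.

∑ : ℕ → (ℕ → ℕ) → ℕ
∑ zero    f = 0
∑ (suc n) f = f 0 + ∑ n (λ i → f (suc i))

∑-cong : ∀ n {f g} → (∀ i → i < n → f i ≡ g i) → ∑ n f ≡ ∑ n g
∑-cong zero    f≡g = refl
∑-cong (suc n) f≡g = cong₂ _+_ (f≡g 0 z<s) (∑-cong n (λ i i<n → f≡g (suc i) (s<s i<n)))

∑-mono-≤ : ∀ n {f g} → (∀ i → i < n → f i ≤ g i) → ∑ n f ≤ ∑ n g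
∑-mono-≤ zero    f≤g = z≤n
∑-mono-≤ (suc n) f≤g = +-mono-≤ (f≤g 0 z<s) (∑-mono-≤ n (λ i i<n → f≤g (suc i) (s<s i<n)))

∑-+ : ∀ n f g → ∑ n (λ i → f i + g i) ≡ ∑ n f + ∑ n g
∑-+ zero    f g = refl
∑-+ (suc n) f g = trans (cong (f 0 + g 0 +_) (∑-+ n (λ i → f (suc i)) (λ i → g (suc i))))
  (interchange (f 0) (g 0) (∑ n (λ i → f (suc i))) (∑ n (λ i → g (suc i))))
  where
  interchange : ∀ a b c d → a + b + (c + d) ≡ a + c + (b + d)
  interchange = solve-∀

∑-0 : ∀ n → ∑ n (λ _ → 0) ≡ 0
∑-0 zero    = refl
∑-0 (suc n) = ∑-0 n

∑-swap : ∀ m n (f : ℕ → ℕ → ℕ) → ∑ m (λ i → ∑ n (f i)) ≡ ∑ n (λ j → ∑ m (λ i → f i j))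
∑-swap zero    n f = sym (∑-0 n)
∑-swap (suc m) n f = trans (cong (∑ n (f 0) +_) (∑-swap m n (λ i → f (suc i))))
  (sym (∑-+ n (f 0) (λ j → ∑ m (λ i → f (suc i) j))))

∑-* : ∀ n c f → ∑ n (λ i → c * f i) ≡ c * ∑ n f
∑-* zero    c f = sym (*-zeroʳ c)
∑-* (suc n) c f = trans (cong (c * f 0 +_) (∑-* n c (λ i → f (suc i)))) (sym (*-distribˡ-+ c (f 0) _))

∑-const : ∀ n c → ∑ n (λ _ → c) ≡ n * c
∑-const zero    c = refl
∑-const (suc n) c = cong (c +_) (∑-const n c)

∑-split : ∀ m n f → ∑ (m + n) f ≡ ∑ m f + ∑ n (λ i → f (m + i))
∑-split zero    n f = refl
∑-split (suc m) n f = trans (cong (f 0 +_) (∑-split m n (λ i → f (suc i)))) (sym (+-assoc (f 0) _ _))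

∑-suc : ∀ n f → ∑ (suc n) f ≡ ∑ n f + f n
∑-suc zero    f = +-comm (f 0) 0
∑-suc (suc n) f = trans (cong (f 0 +_) (∑-suc n (λ i → f (suc i)))) (sym (+-assoc (f 0) _ _))

∑-monoˡ-≤ : ∀ {m n} f → m ≤ n → ∑ m f ≤ ∑ n f
∑-monoˡ-≤ {m} {n} f m≤n = subst (λ k → ∑ m f ≤ ∑ k f) (m+[n∸m]≡n m≤n)
  (subst (∑ m f ≤_) (sym (∑-split m (n ∸ m) f)) (m≤m+n _ _))

∑-blocks : ∀ K n h → ∑ (∑ K n) h ≡ ∑ K (λ a → ∑ (n a) (λ u → h (∑ a n + u)))
∑-blocks zero    n h = refl
∑-blocks (suc K) n h = begin
  ∑ (∑ (suc K) n) h                                      ≡⟨ cong (λ t → ∑ t h) (∑-suc K n) ⟩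
  ∑ (∑ K n + n K) h                                      ≡⟨ ∑-split (∑ K n) (n K) h ⟩
  ∑ (∑ K n) h + block K                                  ≡⟨ cong (_+ block K) (∑-blocks K n h) ⟩
  ∑ K block + block K                                    ≡⟨ ∑-suc K block ⟨
  ∑ (suc K) block                                        ∎
  where
  open ≡-Reasoning
  block = λ a → ∑ (n a) (λ u → h (∑ a n + u))

-- The reflection sends 0, ..., n - 1 to n, ..., 1, hence the `suc`. For a summand of period n,
-- `∑-shift` removes it again.
∑-reverse : ∀ n (f : ℕ → ℕ) → ∑ n (λ i → f (n ∸ i)) ≡ ∑ n (λ i → f (suc i))
∑-reverse zero    f = refl
∑-reverse (suc n) f = begin
  f (suc n) + ∑ n (λ i → f (n ∸ i))     ≡⟨ cong (f (suc n) +_) (∑-reverse n f) ⟩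
  f (suc n) + ∑ n (λ i → f (suc i))     ≡⟨ +-comm (f (suc n)) _ ⟩
  ∑ n (λ i → f (suc i)) + f (suc n)     ≡⟨ ∑-suc n (λ i → f (suc i)) ⟨
  ∑ (suc n) (λ i → f (suc i))           ∎
  where open ≡-Reasoning

-- The induction adds a last row and a last column at each step. It serves to collect errors of
-- pairs of layers into one sum over j < k.
∑-square : ∀ K (f : ℕ → ℕ → ℕ) →
  ∑ K (λ a → ∑ K (f a)) ≡ ∑ K (λ a → f a a + ∑ a (λ b → f a b + f b a))
∑-square zero    f = refl
∑-square (suc K) f = begin
  ∑ (suc K) (λ a → ∑ (suc K) (f a))
    ≡⟨ ∑-suc K (λ a → ∑ (suc K) (f a)) ⟩
  ∑ K (λ a → ∑ (suc K) (f a)) + ∑ (suc K) (f K)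
    ≡⟨ cong₂ _+_ (∑-cong K (λ a _ → ∑-suc K (f a))) (∑-suc K (f K)) ⟩
  ∑ K (λ a → ∑ K (f a) + f a K) + (∑ K (f K) + f K K)
    ≡⟨ cong (_+ (∑ K (f K) + f K K)) (∑-+ K (λ a → ∑ K (f a)) (λ a → f a K)) ⟩
  ∑ K (λ a → ∑ K (f a)) + ∑ K (λ a → f a K) + (∑ K (f K) + f K K)
    ≡⟨ rearrange (∑ K (λ a → ∑ K (f a))) (∑ K (λ a → f a K)) (∑ K (f K)) (f K K) ⟩
  ∑ K (λ a → ∑ K (f a)) + (f K K + (∑ K (f K) + ∑ K (λ a → f a K)))
    ≡⟨ cong₂ _+_ (∑-square K f) (cong (f K K +_) (sym (∑-+ K (f K) (λ a → f a K)))) ⟩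
  ∑ K term + term K
    ≡⟨ ∑-suc K term ⟨
  ∑ (suc K) term
    ∎
  where
  open ≡-Reasoning
  term = λ a → f a a + ∑ a (λ b → f a b + f b a)
  rearrange : ∀ w x y z → w + x + (y + z) ≡ w + (z + (y + x))
  rearrange = solve-∀

∑≡sum : ∀ n f → ∑ n f ≡ sum {n} (λ i → f (toℕ i))
∑≡sum zero    f = refl
∑≡sum (suc n) f = cong (f 0 +_) (∑≡sum n (λ i → f (suc i)))

Periodic : ℕ → (ℕ → ℕ) → Set
Periodic p f = ∀ x → f (x + p) ≡ f x

periodic-* : ∀ {p f} → Periodic p f → ∀ k x → f (x + k * p) ≡ f x
periodic-* {p} {f} per zero    x = cong f (+-identityʳ x)
periodic-* {p} {f} per (suc k) x = begin
  f (x + (p + k * p))   ≡⟨ cong f (+-assoc x p (k * p)) ⟨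
  f (x + p + k * p)     ≡⟨ periodic-* per k (x + p) ⟩
  f (x + p)             ≡⟨ per x ⟩
  f x                   ∎
  where open ≡-Reasoning

periodic-% : ∀ {p f} .{{_ : NonZero p}} → Periodic p f → ∀ x → f (x % p) ≡ f x
periodic-% {p} {f} per x = trans (sym (periodic-* {f = f} per (x / p) (x % p))) (cong f (sym (m≡m%n+[m/n]*n x p)))

∑-shift : ∀ {p f} → Periodic p f → ∑ p (λ x → f (suc x)) ≡ ∑ p f
∑-shift {p} {f} per = +-cancelˡ-≡ (f 0) _ _ (begin
  f 0 + ∑ p (λ i → f (suc i))   ≡⟨ ∑-suc p f ⟩
  ∑ p f + f p           ≡⟨ cong (∑ p f +_) (per 0) ⟩
  ∑ p f + f 0           ≡⟨ +-comm _ (f 0) ⟩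
  f 0 + ∑ p f           ∎)
  where open ≡-Reasoning

∑-product : ∀ k p f → ∑ (k * p) f ≡ ∑ k (λ j → ∑ p (λ x → f (x + j * p)))
∑-product k p f = begin
  ∑ (k * p) f                               ≡⟨ cong (λ t → ∑ t f) (∑-const k p) ⟨
  ∑ (∑ k (λ _ → p)) f                       ≡⟨ ∑-blocks k (λ _ → p) f ⟩
  ∑ k (λ j → ∑ p (λ x → f (∑ j (λ _ → p) + x)))
    ≡⟨ ∑-cong k (λ j _ → ∑-cong p (λ x _ → cong f (trans (cong (_+ x) (∑-const j p)) (+-comm (j * p) x)))) ⟩
  ∑ k (λ j → ∑ p (λ x → f (x + j * p)))     ∎
  where open ≡-Reasoning

∑-periods : ∀ {p f} → Periodic p f → ∀ k → ∑ (k * p) f ≡ k * ∑ p f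
∑-periods {p} {f} per k = begin
  ∑ (k * p) f                             ≡⟨ ∑-product k p f ⟩
  ∑ k (λ j → ∑ p (λ x → f (x + j * p)))   ≡⟨ ∑-cong k (λ j _ → ∑-cong p (λ x _ → periodic-* {f = f} per j x)) ⟩
  ∑ k (λ _ → ∑ p f)                       ≡⟨ ∑-const k (∑ p f) ⟩
  k * ∑ p f                               ∎
  where open ≡-Reasoning

-- An inverse of m modulo p, with both sides moved so that no subtraction occurs.
modular-inverse : ∀ {m p} → Coprime m p → ∃ λ w → ∃ λ a → ∃ λ b → m * w + a * p ≡ 1 + b * p
modular-inverse {m} {p} c with coprime-Bézout c
... | Bézout.+- x y eq = x , 0 , y , trans (+-identityʳ (m * x)) (trans (*-comm m x) (sym eq))
-- Here x m ≡ -1 modulo p, hence (x m)² ≡ 1: the inverse is x (x m), a natural number congruent to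
-- -x.
... | Bézout.-+ x y eq = x * (x * m) , 2 * y , y * (y * p) , (begin
  m * (x * (x * m)) + 2 * y * p                    ≡⟨ l₁ m x (y * p) y p ⟩
  (x * m) * (x * m) + 2 * (y * p)                  ≡⟨ cong (λ t → (x * m) * (x * m) + 2 * t) (sym eq) ⟩
  (x * m) * (x * m) + 2 * (1 + x * m)              ≡⟨ l₂ (x * m) ⟩
  1 + (1 + x * m) * (1 + x * m)                    ≡⟨ cong (λ t → 1 + t * t) eq ⟩
  1 + (y * p) * (y * p)                            ≡⟨ l₃ y p ⟩
  1 + y * (y * p) * p                              ∎)
  where
  open ≡-Reasoning
  l₁ : ∀ m x t y p → m * (x * (x * m)) + 2 * y * p ≡ (x * m) * (x * m) + 2 * (y * p)
  l₁ = solve-∀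
  l₂ : ∀ z → z * z + 2 * (1 + z) ≡ 1 + (1 + z) * (1 + z)
  l₂ = solve-∀
  l₃ : ∀ y p → 1 + (y * p) * (y * p) ≡ 1 + y * (y * p) * p
  l₃ = solve-∀

module _ (p : ℕ) .{{_ : NonZero p}} where

  [x%p]*y%p : ∀ x y → (x % p * y) % p ≡ (x * y) % p
  [x%p]*y%p x y = begin
    (x % p * y) % p                ≡⟨ %-distribˡ-* (x % p) y p ⟩
    (x % p % p * (y % p)) % p      ≡⟨ cong (λ t → (t * (y % p)) % p) (m%n%n≡m%n x p) ⟩
    (x % p * (y % p)) % p          ≡⟨ %-distribˡ-* x y p ⟨
    (x * y) % p                    ∎
    where open ≡-Reasoning

  toℕ-mod : ∀ x → toℕ (x mod p) ≡ x % p
  toℕ-mod x = toℕ-fromℕ< _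

  multiplication : ℕ → Fin p → Fin p
  multiplication m i = (toℕ i * m) mod p

  multiplication-inverse : ∀ m w a b → m * w + a * p ≡ 1 + b * p →
                           ∀ i → multiplication w (multiplication m i) ≡ i
  multiplication-inverse m w a b eq i = toℕ-injective (begin
    toℕ (multiplication w (multiplication m i))  ≡⟨ toℕ-mod (toℕ (multiplication m i) * w) ⟩
    (toℕ (multiplication m i) * w) % p           ≡⟨ cong (λ t → (t * w) % p) (toℕ-mod (u * m)) ⟩
    ((u * m) % p * w) % p                        ≡⟨ [x%p]*y%p (u * m) w ⟩
    (u * m * w) % p                              ≡⟨ [m+kn]%n≡m%n (u * m * w) (u * a) p ⟨
    (u * m * w + u * a * p) % p                  ≡⟨ cong (_% p) (l₁ u m w a p) ⟩
    (u * (m * w + a * p)) % p                    ≡⟨ cong (λ t → (u * t) % p) eq ⟩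
    (u * (1 + b * p)) % p                        ≡⟨ cong (_% p) (l₂ u b p) ⟩
    (u + u * b * p) % p                          ≡⟨ [m+kn]%n≡m%n u (u * b) p ⟩
    u % p                                        ≡⟨ m<n⇒m%n≡m (toℕ<n i) ⟩
    u                                            ∎)
    where
    open ≡-Reasoning
    u = toℕ i
    l₁ : ∀ u m w a p → u * m * w + u * a * p ≡ u * (m * w + a * p)
    l₁ = solve-∀
    l₂ : ∀ u b p → u * (1 + b * p) ≡ u + u * b * p
    l₂ = solve-∀

  -- Multiplication by a unit permutes the residues modulo p, and a periodic summand sees the
  -- residue only.
  ∑-multiplication : ∀ {m f} → Coprime m p → Periodic p f → ∑ p (λ u → f (u * m)) ≡ ∑ p f
  ∑-multiplication {m} {f} c per = begin
    ∑ p (λ u → f (u * m))         ≡⟨ ∑-cong p (λ u _ → sym (periodic-% {f = f} per (u * m))) ⟩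
    ∑ p (λ u → f ((u * m) % p))   ≡⟨ ∑≡sum p (λ u → f ((u * m) % p)) ⟩
    sum {p} (λ i → f ((toℕ i * m) % p))
      ≡⟨ sum-cong-≗ {p} (λ i → cong f (sym (toℕ-mod (toℕ i * m)))) ⟩
    sum {p} (λ i → f (toℕ (multiplication m i))) ≡⟨ sum-permute {p} (λ i → f (toℕ i)) π ⟨
    sum {p} (λ i → f (toℕ i))     ≡⟨ ∑≡sum p f ⟨
    ∑ p f                         ∎
    where
    open ≡-Reasoning
    π : Permutation′ p
    π with w , a , b , eq ← modular-inverse c =
      permutation (multiplication m) (multiplication w)
        (multiplication-inverse w m a b (trans (cong (_+ a * p) (*-comm w m)) eq))
        (multiplication-inverse m w a b eq)

-- The sum over all (u , v) runs g times through every residue modulo g n m.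
∑-equidistribution : ∀ g n m .{{_ : NonZero n}} → Coprime m n → ∀ {ψ} → Periodic (g * m * n) ψ →
  ∑ (g * n) (λ u → ∑ (g * m) (λ v → ψ (u * m + v * n))) ≡ g * ∑ (g * m * n) ψ
∑-equidistribution g n m c {ψ} per = begin
  ∑ (g * n) (λ u → Θ (u * m))                              ≡⟨ ∑-periods {f = λ u → Θ (u * m)} Θ∘*m-periodic g ⟩
  -- Since u ↦ u m permutes the residues modulo n, u m may be replaced by x. Then x + v n with x < n
  -- and v < g m runs once through the numbers below g m n.
  g * ∑ n (λ u → Θ (u * m))                                ≡⟨ cong (g *_) (∑-multiplication n {f = Θ} c Θ-periodic) ⟩
  g * ∑ n (λ x → ∑ (g * m) (λ v → ψ (x + v * n)))          ≡⟨ cong (g *_) (∑-swap n (g * m) (λ x v → ψ (x + v * n))) ⟩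
  g * ∑ (g * m) (λ v → ∑ n (λ x → ψ (x + v * n)))          ≡⟨ cong (g *_) (∑-product (g * m) n ψ) ⟨
  g * ∑ (g * m * n) ψ                                      ∎
  where
  open ≡-Reasoning
  Θ : ℕ → ℕ
  Θ x = ∑ (g * m) (λ v → ψ (x + v * n))
  ψ-periodic : ∀ x → Periodic (g * m) (λ v → ψ (x + v * n))
  ψ-periodic x v = trans (cong ψ (l x v (g * m) n)) (per (x + v * n))
    where
    l : ∀ x v q n → x + (v + q) * n ≡ x + v * n + q * n
    l = solve-∀
  -- Adding n to x amounts to v ↦ v + 1, a cyclic shift of the full period g m of v.
  Θ-periodic : Periodic n Θ
  Θ-periodic x = trans (∑-cong (g * m) (λ v _ → cong ψ (+-assoc x n (v * n)))) (∑-shift {g * m} {λ v → ψ (x + v * n)} (ψ-periodic x))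
  Θ∘*m-periodic : Periodic n (λ u → Θ (u * m))
  Θ∘*m-periodic u = trans (cong Θ (l u n m)) (periodic-* {f = Θ} Θ-periodic m (u * m))
    where
    l : ∀ u n m → (u + n) * m ≡ u * m + m * n
    l = solve-∀

-- Close pairs between two layers

𝟙 : {P : Set} → Dec P → ℕ
𝟙 (yes _) = 1
𝟙 (no  _) = 0

𝟙-mono : {P Q : Set} (p? : Dec P) (q? : Dec Q) → (P → Q) → 𝟙 p? ≤ 𝟙 q?
𝟙-mono (no _)  q?      P⇒Q = z≤n
𝟙-mono (yes p) (yes _) P⇒Q = s≤s z≤n
𝟙-mono (yes p) (no ¬q) P⇒Q = contradiction (P⇒Q p) ¬q

𝟙-cong : {P Q : Set} (p? : Dec P) (q? : Dec Q) → (P → Q) → (Q → P) → 𝟙 p? ≡ 𝟙 q?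
𝟙-cong p? q? P⇒Q Q⇒P = ≤-antisym (𝟙-mono p? q? P⇒Q) (𝟙-mono q? p? Q⇒P)

𝟙-yes : {P : Set} (p? : Dec P) → P → 𝟙 p? ≡ 1
𝟙-yes (yes _) p = refl
𝟙-yes (no ¬p) p = contradiction p ¬p

𝟙-no : {P : Set} (p? : Dec P) → ¬ P → 𝟙 p? ≡ 0
𝟙-no (yes p) ¬p = contradiction p ¬p
𝟙-no (no _)  ¬p = refl

𝟙≤1 : {P : Set} (p? : Dec P) → 𝟙 p? ≤ 1
𝟙≤1 (yes _) = ≤-refl
𝟙≤1 (no  _) = z≤n

module _ (M Q : ℕ) where

  -- Only the last counted c matters: at most c + 1 values are counted by then, and (δ + c) Q < M
  -- bounds this number. The offset δ is 0 for the side of the circle that includes the residue 0,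
  -- and 1 for the other side.
  ∑-threshold-≤ : ∀ δ L → δ ≤ 1 → Q * ∑ L (λ c → 𝟙 ((δ + c) * Q <? M)) + δ * Q ≤ M + Q
  ∑-threshold-≤ δ zero    δ≤1 rewrite *-zeroʳ Q = ≤-trans (*-monoˡ-≤ Q δ≤1)
    (≤-trans (≤-reflexive (+-identityʳ Q)) (m≤n+m Q M))
  ∑-threshold-≤ δ (suc L) δ≤1 rewrite ∑-suc L (λ c → 𝟙 ((δ + c) * Q <? M)) with (δ + L) * Q <? M
  ... | no  _ rewrite +-identityʳ (∑ L (λ c → 𝟙 ((δ + c) * Q <? M))) = ∑-threshold-≤ δ L δ≤1
  ... | yes h = begin
    Q * (∑ L _ + 1) + δ * Q   ≤⟨ +-monoˡ-≤ (δ * Q) (*-monoʳ-≤ Q (+-monoˡ-≤ 1 (count≤ L))) ⟩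
    Q * (L + 1) + δ * Q       ≡⟨ l Q L δ ⟩
    (δ + L) * Q + Q           ≤⟨ +-monoˡ-≤ Q (<⇒≤ h) ⟩
    M + Q                     ∎
    where
    open ≤-Reasoning
    l : ∀ Q L δ → Q * (L + 1) + δ * Q ≡ (δ + L) * Q + Q
    l = solve-∀
    count≤ : ∀ L → ∑ L (λ c → 𝟙 ((δ + c) * Q <? M)) ≤ L
    count≤ L = ≤-trans (∑-mono-≤ L {g = λ _ → 1} (λ c _ → 𝟙≤1 ((δ + c) * Q <? M)))
      (≤-reflexive (trans (∑-const L 1) (*-identityʳ L)))

  ∑-threshold-≥ : ∀ δ L → M ≤ Q * L → M ≤ Q * (∑ L (λ c → 𝟙 ((δ + c) * Q <? M)) + δ)
  ∑-threshold-≥ δ L M≤QL = [ (λ h → h) , (λ h → ≤-trans M≤QL (*-monoʳ-≤ Q (≤-trans (≤-reflexive (sym h)) (m≤m+n _ δ)))) ]′ (saturated L)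
    where
    count : ℕ → ℕ
    count L = ∑ L (λ c → 𝟙 ((δ + c) * Q <? M))
    -- Either some c has failed the test, and this failure bounds M, or every c so far is counted.
    -- In the latter case the hypothesis M ≤ Q L gives the bound.
    saturated : ∀ L → M ≤ Q * (count L + δ) ⊎ count L ≡ L
    saturated zero = inj₂ refl
    saturated (suc L) rewrite ∑-suc L (λ c → 𝟙 ((δ + c) * Q <? M)) with saturated L
    ... | inj₁ h = inj₁ (≤-trans h (*-monoʳ-≤ Q (+-monoˡ-≤ δ (m≤m+n _ _))))
    ... | inj₂ h with (δ + L) * Q <? M
    ...   | yes _ = inj₂ (trans (cong (_+ 1) h) (+-comm L 1))
    ...   | no ¬h = inj₁ (begin
      M                         ≤⟨ ≮⇒≥ ¬h ⟩
      (δ + L) * Q               ≡⟨ trans (*-comm _ Q) (cong (Q *_) (+-comm δ L)) ⟩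
      Q * (L + δ)               ≡⟨ cong (λ t → Q * (t + δ)) (trans (sym h) (sym (+-identityʳ _))) ⟩
      Q * (count L + 0 + δ)     ∎)
      where open ≤-Reasoning

-- ℓ times the distance of z / ℓ from the nearest integer, for z ≤ ℓ.
circ : ℕ → ℕ → ℕ
circ ℓ z = z ⊓ (ℓ ∸ z)

circ-scale : ∀ g ℓ z → circ (g * ℓ) (g * z) ≡ g * circ ℓ z
circ-scale g ℓ z = trans (cong (g * z ⊓_) (sym (*-distribˡ-∸ g ℓ z))) (sym (*-distribˡ-⊓ g z (ℓ ∸ z)))

circ-reflect : ∀ {ℓ z} → z ≤ ℓ → circ ℓ (ℓ ∸ z) ≡ circ ℓ z
circ-reflect {ℓ} {z} z≤ℓ = trans (cong ((ℓ ∸ z) ⊓_) (m∸[m∸n]≡n z≤ℓ)) (⊓-comm (ℓ ∸ z) z)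

-- Modulo ℓ the argument on the left is a - b, hence |a - b| or ℓ - |a - b|, and `circ` agrees at
-- these two.
circ-% : ∀ {ℓ a b} .{{_ : NonZero ℓ}} → a < ℓ → b ≤ ℓ → circ ℓ ((a + (ℓ ∸ b)) % ℓ) ≡ circ ℓ ∣ a - b ∣
circ-% {ℓ} {a} {b} a<ℓ b≤ℓ with ≤-<-connex b a
... | inj₁ b≤a = cong (circ ℓ) (begin
  (a + (ℓ ∸ b)) % ℓ     ≡⟨ cong (_% ℓ) (+-∸-assoc a b≤ℓ) ⟨
  (a + ℓ ∸ b) % ℓ       ≡⟨ cong (_% ℓ) (+-∸-comm ℓ b≤a) ⟩
  (a ∸ b + ℓ) % ℓ       ≡⟨ [m+n]%n≡m%n (a ∸ b) ℓ ⟩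
  (a ∸ b) % ℓ           ≡⟨ m<n⇒m%n≡m (≤-<-trans (m∸n≤m a b) a<ℓ) ⟩
  a ∸ b                 ≡⟨ trans (sym (m≤n⇒∣m-n∣≡n∸m b≤a)) (∣-∣-comm b a) ⟩
  ∣ a - b ∣             ∎)
  where open ≡-Reasoning
... | inj₂ a<b = begin
  circ ℓ ((a + (ℓ ∸ b)) % ℓ)   ≡⟨ cong (λ t → circ ℓ (t % ℓ)) eq ⟩
  circ ℓ ((ℓ ∸ (b ∸ a)) % ℓ)   ≡⟨ cong (circ ℓ) (m<n⇒m%n≡m (∸-monoʳ-< {ℓ} (m<n⇒0<n∸m a<b) (≤-trans (m∸n≤m b a) b≤ℓ))) ⟩
  circ ℓ (ℓ ∸ (b ∸ a))         ≡⟨ circ-reflect (≤-trans (m∸n≤m b a) b≤ℓ) ⟩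
  circ ℓ (b ∸ a)               ≡⟨ cong (circ ℓ) (m≤n⇒∣m-n∣≡n∸m (<⇒≤ a<b)) ⟨
  circ ℓ ∣ a - b ∣             ∎
  where
  open ≡-Reasoning
  eq : a + (ℓ ∸ b) ≡ ℓ ∸ (b ∸ a)
  eq = +-cancelʳ-≡ (b ∸ a) _ _ (begin
    a + (ℓ ∸ b) + (b ∸ a)      ≡⟨ +-comm _ (b ∸ a) ⟩
    b ∸ a + (a + (ℓ ∸ b))      ≡⟨ +-assoc (b ∸ a) a _ ⟨
    b ∸ a + a + (ℓ ∸ b)        ≡⟨ cong (_+ (ℓ ∸ b)) (m∸n+n≡m (<⇒≤ a<b)) ⟩
    b + (ℓ ∸ b)                ≡⟨ m+[n∸m]≡n b≤ℓ ⟩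
    ℓ                          ≡⟨ m∸n+n≡m (≤-trans (m∸n≤m b a) b≤ℓ) ⟨
    ℓ ∸ (b ∸ a) + (b ∸ a)      ∎)

module _ (P Q : ℕ) where

  -- The distance of u / n and v / m on the torus is less than P / Q.
  Near : (n u m v : ℕ) → Set
  Near n u m v = circ (n * m) ∣ u * m - v * n ∣ * Q < P * (n * m)

  near? : ∀ n u m v → Dec (Near n u m v)
  near? n u m v = circ (n * m) ∣ u * m - v * n ∣ * Q <? P * (n * m)

  nearCount : ℕ → ℕ → ℕ
  nearCount n m = ∑ n (λ u → ∑ m (λ v → 𝟙 (near? n u m v)))

  residueCount : ℕ → ℕ
  residueCount ℓ = ∑ ℓ (λ c → 𝟙 (circ ℓ c * Q <? P * ℓ))

  module _ (ℓ : ℕ) (2P≤Q : 2 * P ≤ Q) where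
    private
      M = P * ℓ
      near = λ c → 𝟙 (circ ℓ c * Q <? M)
      left = λ c → 𝟙 (c * Q <? M)
      right = λ c → 𝟙 ((ℓ ∸ c) * Q <? M)

      M≤Qℓ : M ≤ Q * ℓ
      M≤Qℓ = *-monoˡ-≤ ℓ (≤-trans (m≤m+n P (P + 0)) 2P≤Q)

      ∑right : ∑ ℓ right ≡ ∑ ℓ (λ c → 𝟙 ((1 + c) * Q <? M))
      ∑right = ∑-reverse ℓ (λ c → 𝟙 (c * Q <? M))

      -- As P / Q is at most 1/2, the arcs on the two sides of 0 are disjoint: membership in both
      -- would give ℓ Q < 2 P ℓ.
      near≡left+right : ∀ c → c < ℓ → near c ≡ left c + right c
      near≡left+right c c<ℓ with c * Q <? M | (ℓ ∸ c) * Q <? M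
      ... | yes h | yes k = contradiction (+-mono-< h k) (≤⇒≯ (begin
        P * ℓ + P * ℓ            ≡⟨ l P ℓ ⟩
        2 * P * ℓ                ≤⟨ *-monoˡ-≤ ℓ 2P≤Q ⟩
        Q * ℓ                    ≡⟨ cong (Q *_) (m+[n∸m]≡n (<⇒≤ c<ℓ)) ⟨
        Q * (c + (ℓ ∸ c))        ≡⟨ trans (*-comm Q _) (*-distribʳ-+ Q c (ℓ ∸ c)) ⟩
        c * Q + (ℓ ∸ c) * Q      ∎))
        where
        open ≤-Reasoning
        l : ∀ P ℓ → P * ℓ + P * ℓ ≡ 2 * P * ℓ
        l = solve-∀
      ... | yes h | no _  = 𝟙-cong (circ ℓ c * Q <? M) (yes h) (λ _ → h) (≤-<-trans (*-monoˡ-≤ Q (m⊓n≤m c (ℓ ∸ c))))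
      ... | no _  | yes k = 𝟙-cong (circ ℓ c * Q <? M) (yes k) (λ _ → k) (≤-<-trans (*-monoˡ-≤ Q (m⊓n≤n c (ℓ ∸ c))))
      ... | no ¬h | no ¬k = 𝟙-cong (circ ℓ c * Q <? M) (no ¬h) sel (λ h → contradiction h ¬h)
        where
        sel : circ ℓ c * Q < M → c * Q < M
        sel h with ⊓-sel c (ℓ ∸ c)
        ... | inj₁ eq = subst (λ t → t * Q < M) eq h
        ... | inj₂ eq = contradiction (subst (λ t → t * Q < M) eq h) ¬k

      A = ∑ ℓ left
      B = ∑ ℓ (λ c → 𝟙 ((1 + c) * Q <? M))

      residueCount≡A+B : residueCount ℓ ≡ A + B
      residueCount≡A+B = trans (∑-cong ℓ near≡left+right) (trans (∑-+ ℓ left right) (cong (A +_) ∑right))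

    -- The side with 0 exceeds P ℓ / Q by at most 1, the other side falls short of it by at most 1.
    -- So the two errors do not add up, and the total is off by at most 1.
    residueCount-≤ : Q * residueCount ℓ ≤ 2 * (P * ℓ) + Q
    residueCount-≤ = +-cancelʳ-≤ Q _ _ (begin
      Q * residueCount ℓ + Q                ≡⟨ cong (λ t → Q * t + Q) residueCount≡A+B ⟩
      Q * (A + B) + Q                       ≡⟨ l Q A B ⟩
      (Q * A + 0 * Q) + (Q * B + 1 * Q)     ≤⟨ +-mono-≤ (∑-threshold-≤ M Q 0 ℓ z≤n) (∑-threshold-≤ M Q 1 ℓ ≤-refl) ⟩
      (M + Q) + (M + Q)                     ≡⟨ l′ M Q ⟩
      2 * M + Q + Q                         ∎)
      where
      open ≤-Reasoning
      l : ∀ Q A B → Q * (A + B) + Q ≡ (Q * A + 0 * Q) + (Q * B + 1 * Q)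
      l = solve-∀
      l′ : ∀ M Q → (M + Q) + (M + Q) ≡ 2 * M + Q + Q
      l′ = solve-∀

    residueCount-≥ : 2 * (P * ℓ) ≤ Q * residueCount ℓ + Q
    residueCount-≥ = begin
      2 * M                                 ≡⟨ cong (M +_) (+-identityʳ M) ⟩
      M + M                                 ≤⟨ +-mono-≤ (∑-threshold-≥ M Q 0 ℓ M≤Qℓ) (∑-threshold-≥ M Q 1 ℓ M≤Qℓ) ⟩
      Q * (A + 0) + Q * (B + 1)             ≡⟨ l Q A B ⟩
      Q * (A + B) + Q                       ≡⟨ cong (λ t → Q * t + Q) residueCount≡A+B ⟨
      Q * residueCount ℓ + Q                ∎
      where
      open ≤-Reasoning
      l : ∀ Q A B → Q * (A + 0) + Q * (B + 1) ≡ Q * (A + B) + Q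
      l = solve-∀

  -- Over the denominator g m n the difference of two points is u m - v n. To stay in ℕ, -v is
  -- represented by g m - v; reversing and shifting the sum over the full period of v turns this
  -- into u m + v n, to which `∑-equidistribution` applies.
  nearCount≡ : ∀ g n m .{{_ : NonZero g}} .{{_ : NonZero n}} .{{_ : NonZero m}} → Coprime m n →
               nearCount (g * n) (g * m) ≡ g * residueCount (g * m * n)
  nearCount≡ g n m c = begin
    ∑ (g * n) (λ u → ∑ (g * m) (λ v → 𝟙 (near? (g * n) u (g * m) v)))
      ≡⟨ ∑-cong (g * n) (λ u u<gn → ∑-cong (g * m) (λ v v<gm → near≡ψ u v u<gn v<gm)) ⟩
    ∑ (g * n) (λ u → ∑ (g * m) (λ v → ψ (u * m + (g * m ∸ v) * n)))
      ≡⟨ ∑-cong (g * n) (λ u _ → ∑-reverse (g * m) (λ v → ψ (u * m + v * n))) ⟩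
    ∑ (g * n) (λ u → ∑ (g * m) (λ v → ψ (u * m + suc v * n)))
      ≡⟨ ∑-cong (g * n) (λ u _ → ∑-shift {f = λ v → ψ (u * m + v * n)} (row-periodic u)) ⟩
    ∑ (g * n) (λ u → ∑ (g * m) (λ v → ψ (u * m + v * n)))
      ≡⟨ ∑-equidistribution g n m c {ψ} ψ-periodic ⟩
    g * ∑ ℓ ψ
      ≡⟨ cong (g *_) (∑-cong ℓ (λ c c<ℓ → cong χ (m<n⇒m%n≡m c<ℓ))) ⟩
    g * residueCount ℓ
      ∎
    where
    open ≡-Reasoning
    ℓ = g * m * n
    instance
      ℓ≢0 : NonZero ℓ
      ℓ≢0 = m*n≢0 (g * m) n {{m*n≢0 g m}}
    χ : ℕ → ℕ
    χ z = 𝟙 (circ ℓ z * Q <? P * ℓ)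
    ψ : ℕ → ℕ
    ψ y = χ (y % ℓ)
    ψ-periodic : Periodic ℓ ψ
    ψ-periodic y = cong χ ([m+n]%n≡m%n y ℓ)
    row-periodic : ∀ u → Periodic (g * m) (λ v → ψ (u * m + v * n))
    row-periodic u v = trans (cong ψ (l u v m n (g * m))) (ψ-periodic (u * m + v * n))
      where
      l : ∀ u v m n q → u * m + (v + q) * n ≡ u * m + v * n + q * n
      l = solve-∀
    near≡ψ : ∀ u v → u < g * n → v < g * m → 𝟙 (near? (g * n) u (g * m) v) ≡ ψ (u * m + (g * m ∸ v) * n)
    near≡ψ u v u<gn v<gm = 𝟙-cong (near? (g * n) u (g * m) v) (circ ℓ ((u * m + (g * m ∸ v) * n) % ℓ) * Q <? P * ℓ)
      (λ h → *-cancelˡ-< g _ _ (subst₂ _<_ eq₁ eq₂ h)) (λ h → subst₂ _<_ (sym eq₁) (sym eq₂) (*-monoʳ-< g h))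
      where
      eq₀ : circ ℓ ∣ u * m - v * n ∣ ≡ circ ℓ ((u * m + (g * m ∸ v) * n) % ℓ)
      eq₀ = sym (trans (cong (λ t → circ ℓ ((u * m + t) % ℓ)) (*-distribʳ-∸ n (g * m) v))
        (circ-% (subst (u * m <_) (l g n m) (*-monoˡ-< m u<gn)) (*-monoˡ-≤ n (<⇒≤ v<gm))))
        where
        l : ∀ g n m → g * n * m ≡ g * m * n
        l = solve-∀
      gn*gm : g * n * (g * m) ≡ g * ℓ
      gn*gm = l g n m
        where
        l : ∀ g n m → g * n * (g * m) ≡ g * (g * m * n)
        l = solve-∀
      cross : ∣ u * (g * m) - v * (g * n) ∣ ≡ g * ∣ u * m - v * n ∣
      cross = trans (cong₂ ∣_-_∣ (l u g m) (l v g n)) (sym (*-distribˡ-∣-∣ g (u * m) (v * n)))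
        where
        l : ∀ u g m → u * (g * m) ≡ g * (u * m)
        l = solve-∀
      eq₁ : circ (g * n * (g * m)) ∣ u * (g * m) - v * (g * n) ∣ * Q ≡ g * (circ ℓ ((u * m + (g * m ∸ v) * n) % ℓ) * Q)
      eq₁ = trans (cong (_* Q) (trans (cong₂ circ gn*gm cross) (trans (circ-scale g ℓ _) (cong (g *_) eq₀)))) (*-assoc g _ Q)
      eq₂ : P * (g * n * (g * m)) ≡ g * (P * ℓ)
      eq₂ = trans (cong (P *_) gn*gm) (l P g ℓ)
        where
        l : ∀ P g ℓ → P * (g * ℓ) ≡ g * (P * ℓ)
        l = solve-∀

  module _ (n m : ℕ) .{{_ : NonZero n}} .{{_ : NonZero m}} (2P≤Q : 2 * P ≤ Q) where
    private
      g = gcd n m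
      instance
        g≢0 : NonZero g
        g≢0 = ≢-nonZero (gcd[m,n]≢0 n m (inj₁ (≢-nonZero⁻¹ n)))
        n/g≢0 : NonZero (n / g)
        n/g≢0 = ≢-nonZero (m/gcd[m,n]≢0 n m)
        m/g≢0 : NonZero (m / g)
        m/g≢0 = ≢-nonZero (n/gcd[m,n]≢0 n m)
      g*[n/g] : g * (n / g) ≡ n
      g*[n/g] = m*[n/m]≡n (gcd[m,n]∣m n m)
      g*[m/g] : g * (m / g) ≡ m
      g*[m/g] = m*[n/m]≡n (gcd[m,n]∣n n m)
      ℓ = m * (n / g)
      count≡ : nearCount n m ≡ g * residueCount ℓ
      count≡ = begin
        nearCount n m                           ≡⟨ cong₂ nearCount g*[n/g] g*[m/g] ⟨
        nearCount (g * (n / g)) (g * (m / g))   ≡⟨ nearCount≡ g (n / g) (m / g) (Coprimality.sym (coprime-/gcd n m)) ⟩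
        g * residueCount (g * (m / g) * (n / g)) ≡⟨ cong (λ t → g * residueCount (t * (n / g))) g*[m/g] ⟩
        g * residueCount ℓ                      ∎
        where open ≡-Reasoning
      g*ℓ : g * ℓ ≡ n * m
      g*ℓ = trans (l g m (n / g)) (cong (_* m) g*[n/g])
        where
        l : ∀ g m k → g * (m * k) ≡ g * k * m
        l = solve-∀
      l₁ : ∀ g P ℓ Q → g * (2 * (P * ℓ) + Q) ≡ 2 * (P * (g * ℓ)) + Q * g
      l₁ = solve-∀
      l₂ : ∀ g Q c → Q * (g * c) ≡ g * (Q * c)
      l₂ = solve-∀

    nearCount-≤ : Q * nearCount n m ≤ 2 * (P * (n * m)) + Q * gcd n m
    nearCount-≤ = begin
      Q * nearCount n m            ≡⟨ trans (cong (Q *_) count≡) (l₂ g Q (residueCount ℓ)) ⟩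
      g * (Q * residueCount ℓ)     ≤⟨ *-monoʳ-≤ g (residueCount-≤ ℓ 2P≤Q) ⟩
      g * (2 * (P * ℓ) + Q)        ≡⟨ trans (l₁ g P ℓ Q) (cong (λ t → 2 * (P * t) + Q * g) g*ℓ) ⟩
      2 * (P * (n * m)) + Q * g    ∎
      where open ≤-Reasoning

    nearCount-≥ : 2 * (P * (n * m)) ≤ Q * nearCount n m + Q * gcd n m
    nearCount-≥ = begin
      2 * (P * (n * m))                     ≡⟨ cong (λ t → 2 * (P * t)) g*ℓ ⟨
      2 * (P * (g * ℓ))                     ≡⟨ l₃ g P ℓ ⟩
      g * (2 * (P * ℓ))                     ≤⟨ *-monoʳ-≤ g (residueCount-≥ ℓ 2P≤Q) ⟩
      g * (Q * residueCount ℓ + Q)          ≡⟨ l₄ g Q (residueCount ℓ) ⟩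
      Q * (g * residueCount ℓ) + Q * g      ≡⟨ cong (λ t → Q * t + Q * g) count≡ ⟨
      Q * nearCount n m + Q * g             ∎
      where
      open ≤-Reasoning
      l₃ : ∀ g P ℓ → 2 * (P * (g * ℓ)) ≡ g * (2 * (P * ℓ))
      l₃ = solve-∀
      l₄ : ∀ g Q c → g * (Q * c + Q) ≡ Q * (g * c) + Q * g
      l₄ = solve-∀

-- Pair correlations of a layered sequence

∑-*-∑ : ∀ K (f : ℕ → ℕ) → ∑ K (λ a → ∑ K (λ b → f a * f b)) ≡ ∑ K f * ∑ K f
∑-*-∑ K f = begin
  ∑ K (λ a → ∑ K (λ b → f a * f b))   ≡⟨ ∑-cong K (λ a _ → trans (∑-* K (f a) f) (*-comm (f a) (∑ K f))) ⟩
  ∑ K (λ a → ∑ K f * f a)             ≡⟨ ∑-* K (∑ K f) f ⟩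
  ∑ K f * ∑ K f                       ∎
  where open ≡-Reasoning

Eventually : (ℕ → Set) → Set
Eventually P = ∃ λ k₀ → ∀ k → k₀ ≤ k → P k

module Layers (n : ℕ → ℕ) (n≢0 : ∀ k → NonZero (n k)) where

  private instance
    n-nonZero : ∀ {k} → NonZero (n k)
    n-nonZero {k} = n≢0 k

  size : ℕ → ℕ
  size k = ∑ k n

  size-suc : ∀ k → size (suc k) ≡ size k + n k
  size-suc k = ∑-suc k n

  size-mono-≤ : ∀ {j k} → j ≤ k → size j ≤ size k
  size-mono-≤ = ∑-monoˡ-≤ n

  k≤size : ∀ k → k ≤ size k
  k≤size k = subst (_≤ size k) (trans (∑-const k 1) (*-identityʳ k)) (∑-mono-≤ k (λ i _ → >-nonZero⁻¹ (n i)))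

  advance : ℕ × ℕ → ℕ × ℕ
  advance (a , u) with suc u <? n a
  ... | yes _ = a , suc u
  ... | no  _ = suc a , 0

  -- i = size (layer i) + offset i, that is, the i-th point is offset i / n (layer i).
  decode : ℕ → ℕ × ℕ
  decode zero    = 0 , 0
  decode (suc i) = advance (decode i)

  layer offset : ℕ → ℕ
  layer i = proj₁ (decode i)
  offset i = proj₂ (decode i)

  decode-correct : ∀ i → size (layer i) + offset i ≡ i × offset i < n (layer i)
  decode-correct zero = refl , >-nonZero⁻¹ (n 0)
  decode-correct (suc i) with decode i | decode-correct i
  ... | a , u | eq , u<n with suc u <? n a
  ...   | yes 1+u<n = trans (+-suc (size a) u) (cong suc eq) , 1+u<n
  ...   | no  1+u≮n = (begin
    size (suc a) + 0      ≡⟨ trans (+-identityʳ _) (size-suc a) ⟩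
    size a + n a          ≡⟨ cong (size a +_) (≤-antisym (≮⇒≥ 1+u≮n) u<n) ⟩
    size a + suc u        ≡⟨ trans (+-suc (size a) u) (cong suc eq) ⟩
    suc i                  ∎) , >-nonZero⁻¹ (n (suc a))
    where open ≡-Reasoning

  private
    before : ∀ {a b u v} → a < b → u < n a → size a + u < size b + v
    before {a} {b} {u} {v} a<b u<n = begin-strict
      size a + u     <⟨ +-monoʳ-< (size a) u<n ⟩
      size a + n a   ≡⟨ size-suc a ⟨
      size (suc a)   ≤⟨ size-mono-≤ a<b ⟩
      size b         ≤⟨ m≤m+n _ v ⟩
      size b + v     ∎
      where open ≤-Reasoning

  position-injective : ∀ {a b u v} → u < n a → v < n b → size a + u ≡ size b + v → (a , u) ≡ (b , v)
  position-injective {a} {b} {u} {v} u<n v<n eq with <-cmp a b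
  ... | tri< a<b _ _ = contradiction eq (<⇒≢ (before a<b u<n))
  ... | tri> _ _ b<a = contradiction (sym eq) (<⇒≢ (before b<a v<n))
  ... | tri≈ _ refl _ = cong (a ,_) (+-cancelˡ-≡ (size a) u v eq)

  decode-position : ∀ {a u} → u < n a → decode (size a + u) ≡ (a , u)
  decode-position {a} {u} u<n =
    let eq , o<n = decode-correct (size a + u) in position-injective o<n u<n eq

  size[layer]≤ : ∀ i → size (layer i) ≤ i
  size[layer]≤ i = subst (size (layer i) ≤_) (proj₁ (decode-correct i)) (m≤m+n _ (offset i))

  <size[1+layer] : ∀ i → i < size (suc (layer i))
  <size[1+layer] i = subst₂ _<_ (proj₁ (decode-correct i)) (sym (size-suc (layer i)))
    (+-monoʳ-< (size (layer i)) (proj₂ (decode-correct i)))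

  layer-≥ : ∀ {k i} → size k ≤ i → k ≤ layer i
  layer-≥ {k} {i} size≤i = ≮⇒≥ λ layer<k →
    <-irrefl refl (<-≤-trans (<size[1+layer] i) (≤-trans (size-mono-≤ layer<k) size≤i))

  layer-< : ∀ {k i} → i < size k → layer i < k
  layer-< {k} {i} i<size = ≰⇒> λ k≤layer →
    <-irrefl refl (<-≤-trans i<size (≤-trans (size-mono-≤ k≤layer) (size[layer]≤ i)))

  G Γ squares : ℕ → ℕ
  G k = ∑ k (λ j → gcd (n j) (n k))
  Γ k = ∑ k G
  squares k = ∑ k (λ a → n a * n a)

  module _ (P Q : ℕ) where

    Close : ℕ → ℕ → Set
    Close i j = i ≢ j × Near P Q (n (layer i)) (offset i) (n (layer j)) (offset j)

    close? : ∀ i j → Dec (Close i j)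
    close? i j = ¬? (i ≟ j) ×-dec near? P Q (n (layer i)) (offset i) (n (layer j)) (offset j)

    pairCount : ℕ → ℕ
    pairCount N = ∑ N (λ i → ∑ N (λ j → 𝟙 (close? i j)))

    pairCount-mono-≤ : ∀ {M N} → M ≤ N → pairCount M ≤ pairCount N
    pairCount-mono-≤ {M} {N} M≤N = ≤-trans (∑-monoˡ-≤ (λ i → ∑ M (λ j → 𝟙 (close? i j))) M≤N)
      (∑-mono-≤ N (λ i _ → ∑-monoˡ-≤ (λ j → 𝟙 (close? i j)) M≤N))

    block : ℕ → ℕ → ℕ
    block a b = ∑ (n a) (λ u → ∑ (n b) (λ v → 𝟙 (close? (size a + u) (size b + v))))

    pairCount-blocks : ∀ K → pairCount (size K) ≡ ∑ K (λ a → ∑ K (block a))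
    pairCount-blocks K = begin
      ∑ (size K) (λ i → ∑ (size K) (λ j → 𝟙 (close? i j)))
        ≡⟨ ∑-blocks K n (λ i → ∑ (size K) (λ j → 𝟙 (close? i j))) ⟩
      ∑ K (λ a → ∑ (n a) (λ u → ∑ (size K) (λ j → 𝟙 (close? (size a + u) j))))
        ≡⟨ ∑-cong K (λ a _ → ∑-cong (n a) (λ u _ → ∑-blocks K n (λ j → 𝟙 (close? (size a + u) j)))) ⟩
      ∑ K (λ a → ∑ (n a) (λ u → ∑ K (λ b → ∑ (n b) (λ v → 𝟙 (close? (size a + u) (size b + v))))))
        ≡⟨ ∑-cong K (λ a _ → ∑-swap (n a) K (λ u b → ∑ (n b) (λ v → 𝟙 (close? (size a + u) (size b + v))))) ⟩
      ∑ K (λ a → ∑ K (block a))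
        ∎
      where open ≡-Reasoning

    close⇒near : ∀ {a b u v} → u < n a → v < n b → Close (size a + u) (size b + v) → Near P Q (n a) u (n b) v
    close⇒near {a} {b} {u} {v} u<n v<n (_ , near)
      rewrite decode-position u<n | decode-position v<n = near

    near⇒close : ∀ {a b u v} → u < n a → v < n b → size a + u ≢ size b + v →
                 Near P Q (n a) u (n b) v → Close (size a + u) (size b + v)
    near⇒close u<n v<n i≢j near
      rewrite decode-position u<n | decode-position v<n = i≢j , near

    block-≢ : ∀ {a b} → a ≢ b → block a b ≡ nearCount P Q (n a) (n b)
    block-≢ {a} {b} a≢b = ∑-cong (n a) λ u u<n → ∑-cong (n b) λ v v<n →
      𝟙-cong (close? (size a + u) (size b + v)) (near? P Q (n a) u (n b) v)
        (close⇒near u<n v<n)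
        (near⇒close u<n v<n (λ eq → a≢b (cong proj₁ (position-injective u<n v<n eq))))

    -- Two different points of the same layer are at least 1 / n a apart.
    block-≡ : ∀ a → P * n a ≤ Q → block a a ≡ 0
    block-≡ a Pn≤Q = trans (∑-cong (n a) λ u u<n → trans (∑-cong (n a) λ v v<n →
        𝟙-no (close? (size a + u) (size a + v)) (far u<n v<n)) (∑-0 (n a))) (∑-0 (n a))
      where
      far : ∀ {u v} → u < n a → v < n a → ¬ Close (size a + u) (size a + v)
      far {u} {v} u<n v<n close@(i≢j , _) = <⇒≱ (close⇒near u<n v<n close) (begin
        P * (n a * n a)                         ≡⟨ trans (sym (*-assoc P (n a) (n a))) (*-comm _ (n a)) ⟩
        n a * (P * n a)                         ≤⟨ *-monoʳ-≤ (n a) Pn≤Q ⟩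
        n a * Q                                 ≤⟨ *-monoˡ-≤ Q (≤-trans (≤-reflexive (sym (*-identityʳ (n a)))) (*-monoʳ-≤ (n a) 1≤circ)) ⟩
        n a * circ (n a) ∣ u - v ∣ * Q          ≡⟨ cong (_* Q) (circ-scale (n a) (n a) ∣ u - v ∣) ⟨
        circ (n a * n a) (n a * ∣ u - v ∣) * Q  ≡⟨ cong (λ t → circ (n a * n a) t * Q) (*-distribʳ-∣-∣′ u v) ⟩
        circ (n a * n a) ∣ u * n a - v * n a ∣ * Q ∎)
        where
        open ≤-Reasoning
        *-distribʳ-∣-∣′ : ∀ u v → n a * ∣ u - v ∣ ≡ ∣ u * n a - v * n a ∣
        *-distribʳ-∣-∣′ u v = trans (*-comm (n a) ∣ u - v ∣) (*-distribʳ-∣-∣ (n a) u v)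
        u≢v : u ≢ v
        u≢v refl = i≢j refl
        1≤circ : 1 ≤ circ (n a) ∣ u - v ∣
        1≤circ = ⊓-glb (n≢0⇒n>0 (λ eq → u≢v (∣m-n∣≡0⇒m≡n eq)))
          (m<n⇒0<n∸m (≤-<-trans (∣m-n∣≤m⊔n u v) (⊔-lub u<n v<n)))

    -- Where `block-≡` applies, a diagonal block has no close pair at all, so its whole main term
    -- counts as error.
    err : ℕ → ℕ → ℕ
    err a b with a ≟ b
    ... | yes _ = 2 * P * (n a * n a)
    ... | no  _ = Q * gcd (n a) (n b)

    module _ (K : ℕ) (2P≤Q : 2 * P ≤ Q) (Pn≤Q : ∀ a → a < K → P * n a ≤ Q) where

      block-≤ : ∀ a b → a < K → Q * block a b ≤ 2 * P * (n a * n b) + err a b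
      block-≤ a b a<K with a ≟ b
      ... | yes refl = ≤-trans (≤-reflexive (trans (cong (Q *_) (block-≡ a (Pn≤Q a a<K))) (*-zeroʳ Q))) z≤n
      ... | no  a≢b = subst₂ _≤_ (cong (Q *_) (sym (block-≢ a≢b)))
        (cong (_+ Q * gcd (n a) (n b)) (sym (*-assoc 2 P (n a * n b)))) (nearCount-≤ P Q (n a) (n b) 2P≤Q)

      block-≥ : ∀ a b → 2 * P * (n a * n b) ≤ Q * block a b + err a b
      block-≥ a b with a ≟ b
      ... | yes refl = m≤n+m _ _
      ... | no  a≢b = subst₂ _≤_ (sym (*-assoc 2 P (n a * n b)))
        (cong (λ t → Q * t + Q * gcd (n a) (n b)) (sym (block-≢ a≢b))) (nearCount-≥ P Q (n a) (n b) 2P≤Q)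

      private
        ∑∑-* : ∀ c (f : ℕ → ℕ → ℕ) → ∑ K (λ a → ∑ K (λ b → c * f a b)) ≡ c * ∑ K (λ a → ∑ K (f a))
        ∑∑-* c f = trans (∑-cong K (λ a _ → ∑-* K c (f a))) (∑-* K c (λ a → ∑ K (f a)))

        ∑∑-+ : ∀ (f g : ℕ → ℕ → ℕ) → ∑ K (λ a → ∑ K (λ b → f a b + g a b)) ≡ ∑ K (λ a → ∑ K (f a)) + ∑ K (λ a → ∑ K (g a))
        ∑∑-+ f g = trans (∑-cong K (λ a _ → ∑-+ K (f a) (g a))) (∑-+ K (λ a → ∑ K (f a)) (λ a → ∑ K (g a)))

        err-≡ : ∀ a → err a a ≡ 2 * P * (n a * n a)
        err-≡ a with a ≟ a
        ... | yes _ = refl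
        ... | no  a≢a = contradiction refl a≢a

        err-≢ : ∀ {a b} → a ≢ b → err a b ≡ Q * gcd (n a) (n b)
        err-≢ {a} {b} a≢b with a ≟ b
        ... | yes a≡b = contradiction a≡b a≢b
        ... | no  _ = refl

      ∑∑err : ∑ K (λ a → ∑ K (err a)) ≡ 2 * P * squares K + 2 * Q * Γ K
      ∑∑err = begin
        ∑ K (λ a → ∑ K (err a))
          ≡⟨ ∑-square K err ⟩
        ∑ K (λ a → err a a + ∑ a (λ b → err a b + err b a))
          ≡⟨ ∑-cong K (λ a _ → cong₂ _+_ (err-≡ a) (trans (∑-cong a (off a)) (∑-* a (2 * Q) _))) ⟩
        ∑ K (λ a → 2 * P * (n a * n a) + 2 * Q * G a)
          ≡⟨ ∑-+ K (λ a → 2 * P * (n a * n a)) (λ a → 2 * Q * G a) ⟩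
        ∑ K (λ a → 2 * P * (n a * n a)) + ∑ K (λ a → 2 * Q * G a)
          ≡⟨ cong₂ _+_ (∑-* K (2 * P) (λ a → n a * n a)) (∑-* K (2 * Q) G) ⟩
        2 * P * squares K + 2 * Q * Γ K
          ∎
        where
        open ≡-Reasoning
        l : ∀ Q x → Q * x + Q * x ≡ 2 * Q * x
        l = solve-∀
        off : ∀ a b → b < a → err a b + err b a ≡ 2 * Q * gcd (n b) (n a)
        off a b b<a = trans (cong₂ _+_ (trans (err-≢ (>⇒≢ b<a)) (cong (Q *_) (gcd-comm (n a) (n b)))) (err-≢ (<⇒≢ b<a)))
          (l Q (gcd (n b) (n a)))

      private
        ∑∑main : ∑ K (λ a → ∑ K (λ b → 2 * P * (n a * n b))) ≡ 2 * P * (size K * size K)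
        ∑∑main = trans (∑∑-* (2 * P) (λ a b → n a * n b)) (cong (2 * P *_) (∑-*-∑ K n))

        ∑∑block : ∑ K (λ a → ∑ K (λ b → Q * block a b)) ≡ Q * pairCount (size K)
        ∑∑block = trans (∑∑-* Q block) (cong (Q *_) (sym (pairCount-blocks K)))

      pairCount-≤ : Q * pairCount (size K) ≤ 2 * P * (size K * size K) + (2 * P * squares K + 2 * Q * Γ K)
      pairCount-≤ = subst₂ _≤_ ∑∑block (trans (∑∑-+ (λ a b → 2 * P * (n a * n b)) err) (cong₂ _+_ ∑∑main ∑∑err))
        (∑-mono-≤ K (λ a a<K → ∑-mono-≤ K (λ b _ → block-≤ a b a<K)))

      pairCount-≥ : 2 * P * (size K * size K) ≤ Q * pairCount (size K) + (2 * P * squares K + 2 * Q * Γ K)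
      pairCount-≥ = subst₂ _≤_ ∑∑main (trans (∑∑-+ (λ a b → Q * block a b) err) (cong₂ _+_ ∑∑block ∑∑err))
        (∑-mono-≤ K (λ a _ → ∑-mono-≤ K (λ b _ → block-≥ a b)))

  module Asymptotics
    (layers-small : ∀ R → Eventually (λ k → ∀ a → a ≤ k → R * n a ≤ size k))
    (gcds-small   : ∀ R → Eventually (λ k → R * G k ≤ n k))
    where

    -- Summation of `2 * R * G j ≤ n j` over j ≥ k₁ leaves the constant C from the first k₁ layers.
    -- The spare factor 2 absorbs it once k ≥ C, because `size k` is at least k.
    Γ-small : ∀ R → Eventually (λ k → R * Γ k ≤ size k)
    Γ-small R with gcds-small (2 * R)
    ... | k₁ , small = k₁ + C , λ k k₁+C≤k →
      *-cancelˡ-≤ 2 (begin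
        2 * (R * Γ k)           ≡⟨ *-assoc 2 R (Γ k) ⟨
        2 * R * Γ k             ≡⟨ cong (λ k → 2 * R * Γ k) (m+[n∸m]≡n (m+n≤o⇒m≤o k₁ k₁+C≤k)) ⟨
        2 * R * Γ (k₁ + (k ∸ k₁))       ≤⟨ growth (k ∸ k₁) ⟩
        C + size (k₁ + (k ∸ k₁))       ≡⟨ cong (λ k → C + size k) (m+[n∸m]≡n (m+n≤o⇒m≤o k₁ k₁+C≤k)) ⟩
        C + size k             ≤⟨ +-monoˡ-≤ (size k) (≤-trans (m+n≤o⇒n≤o k₁ k₁+C≤k) (k≤size k)) ⟩
        size k + size k       ≡⟨ cong (size k +_) (+-identityʳ (size k)) ⟨
        2 * size k             ∎)
      where
      open ≤-Reasoning
      C = 2 * R * Γ k₁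
      growth : ∀ j → 2 * R * Γ (k₁ + j) ≤ C + size (k₁ + j)
      growth zero rewrite +-identityʳ k₁ = m≤m+n C _
      growth (suc j) rewrite +-suc k₁ j = begin
        2 * R * Γ (suc (k₁ + j))                        ≡⟨ cong (2 * R *_) (∑-suc (k₁ + j) G) ⟩
        2 * R * (Γ (k₁ + j) + G (k₁ + j))               ≡⟨ *-distribˡ-+ (2 * R) (Γ (k₁ + j)) _ ⟩
        2 * R * Γ (k₁ + j) + 2 * R * G (k₁ + j)         ≤⟨ +-mono-≤ (growth j) (small (k₁ + j) (m≤m+n k₁ j)) ⟩
        C + size (k₁ + j) + n (k₁ + j)                 ≡⟨ trans (+-assoc C _ _) (cong (C +_) (sym (size-suc (k₁ + j)))) ⟩
        C + size (suc (k₁ + j))                        ∎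

    squares-≤ : ∀ R k X → (∀ a → a < k → R * n a ≤ X) → R * squares k ≤ X * size k
    squares-≤ R k X small = begin
      R * squares k                          ≡⟨ ∑-* k R (λ a → n a * n a) ⟨
      ∑ k (λ a → R * (n a * n a))            ≤⟨ ∑-mono-≤ k (λ a a<k → ≤-trans (≤-reflexive (sym (*-assoc R (n a) (n a)))) (*-monoˡ-≤ (n a) (small a a<k))) ⟩
      ∑ k (λ a → X * n a)                    ≡⟨ ∑-* k X n ⟩
      X * size k                            ∎
      where open ≤-Reasoning

    module _ (P q : ℕ) .{{_ : NonZero q}} where
      private
        -- In the upper bound, rounding N up to full layers costs 6 P, the diagonal blocks 4 P and
        -- the gcds 4 q, in units of N² / R. This R makes the total exactly N².
        R = 10 * P + 4 * q

        instance
          R≢0 : NonZero R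
          R≢0 = >-nonZero (≤-trans (>-nonZero⁻¹ q) (≤-trans (m≤m+n q _) (m≤n+m (4 * q) (10 * P))))

        P≤R : P ≤ R
        P≤R = ≤-trans (m≤m+n P _) (m≤m+n (10 * P) (4 * q))

        square-≤ : ∀ N d → d ≤ N → R * d ≤ N → R * ((N + d) * (N + d)) ≤ (R + 3) * (N * N)
        square-≤ N d d≤N Rd≤N = begin
          R * ((N + d) * (N + d))                       ≡⟨ l R N d ⟩
          R * (N * N) + 2 * (N * (R * d)) + d * (R * d)
            ≤⟨ +-mono-≤ (+-monoʳ-≤ (R * (N * N)) (*-monoʳ-≤ 2 (*-monoʳ-≤ N Rd≤N))) (*-mono-≤ d≤N Rd≤N) ⟩
          R * (N * N) + 2 * (N * N) + N * N             ≡⟨ l′ R (N * N) ⟩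
          (R + 3) * (N * N)                             ∎
          where
          open ≤-Reasoning
          l : ∀ R N d → R * ((N + d) * (N + d)) ≡ R * (N * N) + 2 * (N * (R * d)) + d * (R * d)
          l = solve-∀
          l′ : ∀ R X → R * X + 2 * X + X ≡ (R + 3) * X
          l′ = solve-∀

      module _ (N : ℕ) .{{_ : NonZero N}} (2P≤N : 2 * P ≤ N)
               (layers≤ : ∀ a → a ≤ layer N → R * n a ≤ size (layer N))
               (Γ≤ : ∀ k → layer N ≤ k → R * Γ k ≤ size k) where
        private
          K = layer N
          d = n K
          N≤qN : N ≤ q * N
          N≤qN = m≤n*m N q

          2P≤Q : 2 * P ≤ q * N
          2P≤Q = ≤-trans 2P≤N N≤qN

          Pn≤Q : ∀ a → a < suc K → P * n a ≤ q * N
          Pn≤Q a (s≤s a≤K) = ≤-trans (*-monoˡ-≤ (n a) P≤R) (≤-trans (layers≤ a a≤K) (≤-trans (size[layer]≤ N) N≤qN))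

          Rd≤N : R * d ≤ N
          Rd≤N = ≤-trans (layers≤ K ≤-refl) (size[layer]≤ N)

          d≤N : d ≤ N
          d≤N = ≤-trans (m≤n*m d R) Rd≤N

          N₁≤N+d : size (suc K) ≤ N + d
          N₁≤N+d = subst (_≤ N + d) (sym (size-suc K)) (+-monoˡ-≤ d (size[layer]≤ N))

          N₁≤2N : size (suc K) ≤ 2 * N
          N₁≤2N = ≤-trans N₁≤N+d (≤-trans (+-monoʳ-≤ N d≤N) (≤-reflexive (cong (N +_) (sym (+-identityʳ N)))))

        -- An incomplete layer is never counted: completing it can only add pairs, and raises the
        -- number of points to at most N + d with R d ≤ N. The threshold P / (q N) keeps the
        -- original N.
        pairCount-upper : q * pairCount P (q * N) N ≤ (2 * P + 1) * N
        pairCount-upper = *-cancelˡ-≤ (R * N) {{m*n≢0 R N}} (begin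
          R * N * (q * pairCount P (q * N) N)
            ≤⟨ *-monoʳ-≤ (R * N) (*-monoʳ-≤ q (pairCount-mono-≤ P (q * N) (<⇒≤ (<size[1+layer] N)))) ⟩
          R * N * (q * pairCount P (q * N) N₁)
            ≡⟨ l₁ R N q (pairCount P (q * N) N₁) ⟩
          R * (q * N * pairCount P (q * N) N₁)
            ≤⟨ *-monoʳ-≤ R (pairCount-≤ P (q * N) (suc K) 2P≤Q Pn≤Q) ⟩
          R * (2 * P * (N₁ * N₁) + (2 * P * squares (suc K) + 2 * (q * N) * Γ (suc K)))
            ≡⟨ l₂ R P q N (N₁ * N₁) (squares (suc K)) (Γ (suc K)) ⟩
          2 * P * (R * (N₁ * N₁)) + (2 * P * (R * squares (suc K)) + 2 * (q * N) * (R * Γ (suc K)))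
            ≤⟨ +-mono-≤ (*-monoʳ-≤ (2 * P) (≤-trans (*-monoʳ-≤ R (*-mono-≤ N₁≤N+d N₁≤N+d)) (square-≤ N d d≤N Rd≤N)))
                 (+-mono-≤ (*-monoʳ-≤ (2 * P) (≤-trans (squares-≤ R (suc K) N (λ { a (s≤s a≤K) → ≤-trans (layers≤ a a≤K) (size[layer]≤ N) })) (*-monoʳ-≤ N N₁≤2N)))
                           (*-monoʳ-≤ (2 * (q * N)) (≤-trans (Γ≤ (suc K) (n≤1+n K)) N₁≤2N))) ⟩
          2 * P * ((R + 3) * (N * N)) + (2 * P * (N * (2 * N)) + 2 * (q * N) * (2 * N))
            ≡⟨ l₃ P q N ⟩
          R * N * ((2 * P + 1) * N)
            ∎)
          where
          open ≤-Reasoning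
          N₁ = size (suc K)
          l₁ : ∀ R N q c → R * N * (q * c) ≡ R * (q * N * c)
          l₁ = solve-∀
          l₂ : ∀ R P q N x y z → R * (2 * P * x + (2 * P * y + 2 * (q * N) * z)) ≡
            2 * P * (R * x) + (2 * P * (R * y) + 2 * (q * N) * (R * z))
          l₂ = solve-∀
          l₃ : ∀ P q N → 2 * P * ((10 * P + 4 * q + 3) * (N * N)) + (2 * P * (N * (2 * N)) + 2 * (q * N) * (2 * N)) ≡
            (10 * P + 4 * q) * N * ((2 * P + 1) * N)
          l₃ = solve-∀

        -- Here the incomplete layer is dropped, which loses at most d points.
        pairCount-lower : 2 * P * N ≤ q * pairCount P (q * N) N + N
        pairCount-lower = *-cancelˡ-≤ (R * N) {{m*n≢0 R N}} (begin
          R * N * (2 * P * N)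
            ≡⟨ l₁ R N P ⟩
          2 * P * (R * (N * N))
            ≤⟨ *-monoʳ-≤ (2 * P) RN²≤ ⟩
          2 * P * (R * (N₀ * N₀) + 3 * (N * N))
            ≡⟨ l₂ R P (N₀ * N₀) (N * N) ⟩
          R * (2 * P * (N₀ * N₀)) + 6 * P * (N * N)
            ≤⟨ +-monoˡ-≤ (6 * P * (N * N)) (*-monoʳ-≤ R (pairCount-≥ P (q * N) K 2P≤Q (λ a a<K → Pn≤Q a (m<n⇒m<1+n a<K)))) ⟩
          R * (q * N * pairCount P (q * N) N₀ + (2 * P * squares K + 2 * (q * N) * Γ K)) + 6 * P * (N * N)
            ≡⟨ l₃ R P q N (pairCount P (q * N) N₀) (squares K) (Γ K) ⟩
          R * N * (q * pairCount P (q * N) N₀) + (2 * P * (R * squares K) + 2 * (q * N) * (R * Γ K)) + 6 * P * (N * N)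
            ≤⟨ +-monoˡ-≤ (6 * P * (N * N)) (+-mono-≤
                 (*-monoʳ-≤ (R * N) (*-monoʳ-≤ q (pairCount-mono-≤ P (q * N) (size[layer]≤ N))))
                 (+-mono-≤ (*-monoʳ-≤ (2 * P) (≤-trans (squares-≤ R K N (λ a a<K → ≤-trans (layers≤ a (<⇒≤ a<K)) (size[layer]≤ N))) (*-monoʳ-≤ N (size[layer]≤ N))))
                           (*-monoʳ-≤ (2 * (q * N)) (≤-trans (Γ≤ K ≤-refl) (size[layer]≤ N))))) ⟩
          R * N * (q * pairCount P (q * N) N) + (2 * P * (N * N) + 2 * (q * N) * N) + 6 * P * (N * N)
            -- The errors amount to 8 P + 2 q only; this slack fills them up to R.
            ≤⟨ m≤m+n _ (2 * P * (N * N) + 2 * q * (N * N)) ⟩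
          R * N * (q * pairCount P (q * N) N) + (2 * P * (N * N) + 2 * (q * N) * N) + 6 * P * (N * N) + (2 * P * (N * N) + 2 * q * (N * N))
            ≡⟨ l₄ P q N (q * pairCount P (q * N) N) ⟩
          R * N * (q * pairCount P (q * N) N + N)
            ∎)
          where
          open ≤-Reasoning
          N₀ = size K
          N≤N₀+d : N ≤ N₀ + d
          N≤N₀+d = subst (N ≤_) (size-suc K) (<⇒≤ (<size[1+layer] N))
          RN²≤ : R * (N * N) ≤ R * (N₀ * N₀) + 3 * (N * N)
          RN²≤ = begin
            R * (N * N)                                            ≤⟨ *-monoʳ-≤ R (*-mono-≤ N≤N₀+d N≤N₀+d) ⟩
            R * ((N₀ + d) * (N₀ + d))                              ≡⟨ l R N₀ d ⟩
            R * (N₀ * N₀) + (2 * (N₀ * (R * d)) + d * (R * d))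
              ≤⟨ +-monoʳ-≤ (R * (N₀ * N₀)) (+-mono-≤ (*-monoʳ-≤ 2 (*-mono-≤ (size[layer]≤ N) Rd≤N)) (*-mono-≤ d≤N Rd≤N)) ⟩
            R * (N₀ * N₀) + (2 * (N * N) + N * N)                  ≡⟨ cong (R * (N₀ * N₀) +_) (l′ (N * N)) ⟩
            R * (N₀ * N₀) + 3 * (N * N)                            ∎
            where
            l : ∀ R N d → R * ((N + d) * (N + d)) ≡ R * (N * N) + (2 * (N * (R * d)) + d * (R * d))
            l = solve-∀
            l′ : ∀ X → 2 * X + X ≡ 3 * X
            l′ = solve-∀
          l₁ : ∀ R N P → R * N * (2 * P * N) ≡ 2 * P * (R * (N * N))
          l₁ = solve-∀
          l₂ : ∀ R P x y → 2 * P * (R * x + 3 * y) ≡ R * (2 * P * x) + 6 * P * y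
          l₂ = solve-∀
          l₃ : ∀ R P q N c y z → R * (q * N * c + (2 * P * y + 2 * (q * N) * z)) + 6 * P * (N * N) ≡
            R * N * (q * c) + (2 * P * (R * y) + 2 * (q * N) * (R * z)) + 6 * P * (N * N)
          l₃ = solve-∀
          l₄ : ∀ P q N c → (10 * P + 4 * q) * N * c + (2 * P * (N * N) + 2 * (q * N) * N) + 6 * P * (N * N) + (2 * P * (N * N) + 2 * q * (N * N)) ≡
            (10 * P + 4 * q) * N * (c + N)
          l₄ = solve-∀

      -- That is, F lies within 1 / q of 2 s at s = P / q. The denominator q is also the precision,
      -- and a rational s can be written with any larger multiple of its denominator.
      pairCount-asymptotics : Eventually (λ N → .{{_ : NonZero N}} →
        q * pairCount P (q * N) N ≤ (2 * P + 1) * N × 2 * P * N ≤ q * pairCount P (q * N) N + N)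
      pairCount-asymptotics with layers-small R | Γ-small R
      ... | k₁ , layers≤ | k₂ , Γ≤ = 2 * P + size (k₁ + k₂) , λ N N₀≤N →
        let 2P≤N  = m+n≤o⇒m≤o (2 * P) N₀≤N
            k₁+k₂≤layer = layer-≥ (m+n≤o⇒n≤o (2 * P) N₀≤N)
            layers≤′ = layers≤ (layer N) (m+n≤o⇒m≤o k₁ k₁+k₂≤layer)
            Γ≤′ = λ k layer≤k → Γ≤ k (≤-trans (m+n≤o⇒n≤o k₁ k₁+k₂≤layer) layer≤k)
        in pairCount-upper N 2P≤N layers≤′ Γ≤′ , pairCount-lower N 2P≤N layers≤′ Γ≤′

-- The schedule of layers

n<2^n : ∀ n → n < 2 ^ n
n<2^n zero    = z<s
n<2^n (suc n) = begin-strict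
  1 + n            <⟨ +-mono-≤-< (m^n>0 2 n) (n<2^n n) ⟩
  2 ^ n + 2 ^ n    ≡⟨ cong (2 ^ n +_) (+-identityʳ (2 ^ n)) ⟨
  2 ^ suc n        ∎
  where open ≤-Reasoning

2^[m∸n]*2^n : ∀ {m n} → n ≤ m → 2 ^ (m ∸ n) * 2 ^ n ≡ 2 ^ m
2^[m∸n]*2^n {m} {n} n≤m = trans (sym (^-distribˡ-+-* 2 (m ∸ n) n)) (cong (2 ^_) (m∸n+n≡m n≤m))

2^-∣ : ∀ {m n} → m ≤ n → 2 ^ m ∣ 2 ^ n
2^-∣ {m} {n} m≤n = divides (2 ^ (n ∸ m)) (sym (2^[m∸n]*2^n m≤n))

coprime-∣ : ∀ {d m n} → d ∣ m → Coprime m n → Coprime d n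
coprime-∣ d∣m c (e∣d , e∣n) = c (∣-trans e∣d d∣m , e∣n)

coprime-^ : ∀ {m n} → Coprime m n → ∀ k → Coprime m (n ^ k)
coprime-^ c zero    (d∣m , d∣1)   = ∣1⇒≡1 d∣1
coprime-^ c (suc k) (d∣m , d∣n^k) = coprime-^ c k (d∣m , coprime-divisor (coprime-∣ d∣m c) d∣n^k)

-- Fermat numbers and their coprimality

fermat : ℕ → ℕ
fermat i = 2 ^ (2 ^ i) + 1

fermat-nonZero : ∀ i → NonZero (fermat i)
fermat-nonZero i = >-nonZero (m≤n+m 1 (2 ^ (2 ^ i)))

fermatProduct : ℕ → ℕ
fermatProduct zero    = 1
fermatProduct (suc i) = fermat i * fermatProduct i

fermatProduct-nonZero : ∀ i → NonZero (fermatProduct i)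
fermatProduct-nonZero zero    = _
fermatProduct-nonZero (suc i) = m*n≢0 (fermat i) (fermatProduct i) {{fermat-nonZero i}} {{fermatProduct-nonZero i}}

-- From P (P + 2) + 1 = (P + 1)². Two Fermat numbers thus differ from a multiple of one another by
-- 2, and both are odd.
fermatProduct+2 : ∀ i → fermatProduct i + 2 ≡ fermat i
fermatProduct+2 zero    = refl
fermatProduct+2 (suc i) = begin
  fermat i * P + 2                    ≡⟨ cong (λ t → t * P + 2) (fermatProduct+2 i) ⟨
  (P + 2) * P + 2                     ≡⟨ l P ⟩
  (P + 1) * (P + 1) + 1               ≡⟨ cong (λ t → t * t + 1) P+1 ⟩
  2 ^ (2 ^ i) * 2 ^ (2 ^ i) + 1       ≡⟨ cong (_+ 1) (^-distribˡ-+-* 2 (2 ^ i) (2 ^ i)) ⟨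
  2 ^ (2 ^ i + 2 ^ i) + 1             ≡⟨ cong (λ t → 2 ^ (2 ^ i + t) + 1) (+-identityʳ (2 ^ i)) ⟨
  fermat (suc i)                      ∎
  where
  open ≡-Reasoning
  P = fermatProduct i
  l : ∀ P → (P + 2) * P + 2 ≡ (P + 1) * (P + 1) + 1
  l = solve-∀
  P+1 : P + 1 ≡ 2 ^ (2 ^ i)
  P+1 = +-cancelʳ-≡ 1 _ _ (trans (+-assoc P 1 1) (fermatProduct+2 i))

fermat-∣-product : ∀ {i j} → i < j → fermat i ∣ fermatProduct j
fermat-∣-product {i} {suc j} i<1+j with m≤n⇒m<n∨m≡n (s≤s⁻¹ i<1+j)
... | inj₁ i<j  = ∣n⇒∣m*n (fermat j) (fermat-∣-product i<j)
... | inj₂ refl = m∣m*n (fermatProduct j)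

fermat-coprime-2 : ∀ i → Coprime (fermat i) 2
fermat-coprime-2 i (d∣F , d∣2) = ∣1⇒≡1 (∣m+n∣m⇒∣n d∣F (∣-trans d∣2 (2^-∣ {1} {2 ^ i} (m^n>0 2 i))))

fermat-coprime : ∀ {i j} → i ≢ j → Coprime (fermat i) (fermat j)
fermat-coprime {i} {j} i≢j = [ below , (λ j<i (d∣i , d∣j) → below j<i (d∣j , d∣i)) ]′ (≢⇒<∨> i≢j)
  where
  ≢⇒<∨> : i ≢ j → i < j ⊎ j < i
  ≢⇒<∨> i≢j with <-cmp i j
  ... | tri< i<j _ _ = inj₁ i<j
  ... | tri≈ _ i≡j _ = contradiction i≡j i≢j
  ... | tri> _ _ j<i = inj₂ j<i
  below : ∀ {i j} → i < j → Coprime (fermat i) (fermat j)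
  below {i} {j} i<j {d} (d∣i , d∣j) = fermat-coprime-2 i (d∣i ,
    ∣m+n∣m⇒∣n (subst (d ∣_) (sym (fermatProduct+2 j)) d∣j) (∣-trans d∣i (fermat-∣-product i<j)))

-- A common divisor of g and F_i is odd, so it divides F_j as well and is 1. Being coprime to F_i, g
-- divides the power of 2.
gcd-2^*fermat-≤ : ∀ a b {i j} → i ≢ j → gcd (2 ^ a * fermat i) (2 ^ b * fermat j) ≤ 2 ^ a
gcd-2^*fermat-≤ a b {i} {j} i≢j = ∣⇒≤ {{m^n≢0 2 a}} (coprime-divisor g⊥Fᵢ
  (subst (g ∣_) (*-comm (2 ^ a) (fermat i)) (gcd[m,n]∣m (2 ^ a * fermat i) (2 ^ b * fermat j))))
  where
  g = gcd (2 ^ a * fermat i) (2 ^ b * fermat j)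
  g⊥Fᵢ : Coprime g (fermat i)
  g⊥Fᵢ (e∣g , e∣Fᵢ) = fermat-coprime i≢j (e∣Fᵢ ,
    coprime-divisor (coprime-∣ e∣Fᵢ (coprime-^ (fermat-coprime-2 i) b))
      (∣-trans e∣g (gcd[m,n]∣n (2 ^ a * fermat i) (2 ^ b * fermat j))))

-- An epoch of level t consists of breadth t layers, and the layer sizes grow
-- by the factor 2 ^ growth t from one epoch to the next.
growth breadth base : ℕ → ℕ
growth t = t + 4
breadth t = suc t * 2 ^ growth t
base t = suc t * breadth t

breadth-mono-≤ : ∀ {s t} → s ≤ t → breadth s ≤ breadth t
breadth-mono-≤ s≤t = *-mono-≤ (s≤s s≤t) (^-monoʳ-≤ 2 (+-monoˡ-≤ 4 s≤t))

-- Level t uses the Fermat indices from `base t` to `top t` - 1. By monotonicity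
-- `fermatProduct (top t)` contains all Fermat numbers used up to that level.
top : ℕ → ℕ
top t = base t + breadth t

top-mono-≤ : ∀ {s t} → s ≤ t → top s ≤ top t
top-mono-≤ s≤t = +-mono-≤ (*-mono-≤ (s≤s s≤t) (breadth-mono-≤ s≤t)) (breadth-mono-≤ s≤t)

-- The B of the argument: the power of 2 covers a rise of the exponent at the latest step, the
-- product all odd factors.
gapBound : ℕ → ℕ
gapBound t = 2 ^ growth t * fermatProduct (top t)

record State : Set where
  constructor ⟨_,_,_⟩
  field
    level exponent position : ℕ

  fermatIndex : ℕ
  fermatIndex = base level + position

  shift : ℕ
  shift = exponent ∸ 2 ^ fermatIndex

  layerSize : ℕ
  layerSize = 2 ^ shift * fermat fermatIndex

  -- The L of the argument: a common multiple of the sizes of this layer and all earlier ones.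
  grid : ℕ
  grid = 2 ^ exponent * fermatProduct (top level)

  -- The second condition makes the truncated subtraction in `shift` a true one.
  Valid : Set
  Valid = position < breadth level × 2 ^ top level ≤ exponent

  module _ (valid : Valid) where

    fermatIndex<top : fermatIndex < top level
    fermatIndex<top = +-monoʳ-< (base level) (proj₁ valid)

    2^shift*2^2^fermatIndex : 2 ^ shift * 2 ^ (2 ^ fermatIndex) ≡ 2 ^ exponent
    2^shift*2^2^fermatIndex = 2^[m∸n]*2^n (≤-trans (^-monoʳ-≤ 2 (<⇒≤ fermatIndex<top)) (proj₂ valid))

    layerSize≡ : layerSize ≡ 2 ^ exponent + 2 ^ shift
    layerSize≡ = trans (*-distribˡ-+ (2 ^ shift) (2 ^ (2 ^ fermatIndex)) 1) (cong₂ _+_ 2^shift*2^2^fermatIndex (*-identityʳ (2 ^ shift)))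

    2^exponent≤layerSize : 2 ^ exponent ≤ layerSize
    2^exponent≤layerSize = subst (2 ^ exponent ≤_) (sym layerSize≡) (m≤m+n _ _)

    layerSize≤2*2^exponent : layerSize ≤ 2 * 2 ^ exponent
    layerSize≤2*2^exponent = subst₂ _≤_ (sym layerSize≡) (cong (2 ^ exponent +_) (sym (+-identityʳ (2 ^ exponent))))
      (+-monoʳ-≤ (2 ^ exponent) (^-monoʳ-≤ 2 (m∸n≤m exponent (2 ^ fermatIndex))))

    2^shift≤ : 2 ^ shift ≤ 2 ^ (exponent ∸ 2 ^ base level)
    2^shift≤ = ^-monoʳ-≤ 2 (∸-monoʳ-≤ exponent (^-monoʳ-≤ 2 (m≤m+n (base level) position)))

    -- The left side bounds the gcds within an epoch: at most `breadth level` of them, each at most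
    -- 2^(d - 2^base). It is small since `base level`, which is the product of the first two
    -- factors, lies below 2^(2^base).
    epoch-≤ : suc level * (breadth level * 2 ^ (exponent ∸ 2 ^ base level)) ≤ 2 ^ exponent
    epoch-≤ = begin
      suc level * (breadth level * E)   ≡⟨ *-assoc (suc level) (breadth level) E ⟨
      base level * E                    ≤⟨ *-monoˡ-≤ E (≤-trans (<⇒≤ (n<2^n (base level))) (<⇒≤ (n<2^n (2 ^ base level)))) ⟩
      2 ^ (2 ^ base level) * E          ≡⟨ *-comm _ E ⟩
      E * 2 ^ (2 ^ base level)          ≡⟨ 2^[m∸n]*2^n (≤-trans (^-monoʳ-≤ 2 (m≤m+n (base level) (breadth level))) (proj₂ valid)) ⟩
      2 ^ exponent                      ∎
      where
      open ≤-Reasoning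
      E = 2 ^ (exponent ∸ 2 ^ base level)

open State

layerSize-nonZero : ∀ s → NonZero (layerSize s)
layerSize-nonZero s = m*n≢0 (2 ^ shift s) (fermat (fermatIndex s)) {{m^n≢0 2 (shift s)}} {{fermat-nonZero (fermatIndex s)}}

-- The layers in order: growth of sizes and sums of gcds

module Schedule (Φ : ℕ → ℕ) (2^top≤Φ : ∀ t → 2 ^ top t ≤ Φ t) where

  -- `Φ t` is the exponent that must be reached before level t > 0 is entered. It keeps the states
  -- valid, and it delays a level until `f` can afford its gap bound.
  nextLevel : ℕ → ℕ → ℕ
  nextLevel t d with Φ (suc t) ≤? d
  ... | yes _ = suc t
  ... | no  _ = t

  step : State → State
  step ⟨ t , d , i ⟩ with suc i <? breadth t
  ... | yes _ = ⟨ t , d , suc i ⟩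
  ... | no  _ = ⟨ nextLevel t d , d + growth t , 0 ⟩

  state : ℕ → State
  state zero    = ⟨ 0 , Φ 0 , 0 ⟩
  state (suc k) = step (state k)

  nextLevel-≤ : ∀ t d → nextLevel t d ≤ suc t
  nextLevel-≤ t d with Φ (suc t) ≤? d
  ... | yes _ = ≤-refl
  ... | no  _ = n≤1+n t

  nextLevel-≥ : ∀ t d → t ≤ nextLevel t d
  nextLevel-≥ t d with Φ (suc t) ≤? d
  ... | yes _ = n≤1+n t
  ... | no  _ = ≤-refl

  breadth>0 : ∀ t → 0 < breadth t
  breadth>0 t = ≤-trans (m^n>0 2 (growth t)) (m≤m+n _ (t * 2 ^ growth t))

  step-valid : ∀ s → Valid s → Valid (step s)
  step-valid ⟨ t , d , i ⟩ (i<r , 2^top≤d) with suc i <? breadth t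
  ... | yes i+1<r = i+1<r , 2^top≤d
  ... | no  _     = breadth>0 (nextLevel t d) , ≤-trans bound (m≤m+n d (growth t))
    where
    bound : 2 ^ top (nextLevel t d) ≤ d
    bound with Φ (suc t) ≤? d
    ... | yes Φ≤d = ≤-trans (2^top≤Φ (suc t)) Φ≤d
    ... | no  _   = 2^top≤d

  valid : ∀ k → Valid (state k)
  valid zero    = breadth>0 0 , 2^top≤Φ 0
  valid (suc k) = step-valid (state k) (valid k)

  step-level : ∀ s → level s ≤ level (step s)
  step-level ⟨ t , d , i ⟩ with suc i <? breadth t
  ... | yes _ = ≤-refl
  ... | no  _ = nextLevel-≥ t d

  step-exponent-≥ : ∀ s → exponent s ≤ exponent (step s)
  step-exponent-≥ ⟨ t , d , i ⟩ with suc i <? breadth t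
  ... | yes _ = ≤-refl
  ... | no  _ = m≤m+n d (growth t)

  step-exponent-≤ : ∀ s → exponent (step s) ≤ exponent s + growth (level s)
  step-exponent-≤ ⟨ t , d , i ⟩ with suc i <? breadth t
  ... | yes _ = m≤m+n d (growth t)
  ... | no  _ = ≤-refl

  monotone : (g : State → ℕ) → (∀ s → g s ≤ g (step s)) → ∀ {j k} → j ≤ k → g (state j) ≤ g (state k)
  monotone g step-≥ {j} {k} j≤k = subst (λ k → g (state j) ≤ g (state k)) (m+[n∸m]≡n j≤k) (go (k ∸ j))
    where
    go : ∀ i → g (state j) ≤ g (state (j + i))
    go zero    rewrite +-identityʳ j = ≤-refl
    go (suc i) rewrite +-suc j i = ≤-trans (go i) (step-≥ (state (j + i)))

  level-mono-≤ : ∀ {j k} → j ≤ k → level (state j) ≤ level (state k)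
  level-mono-≤ = monotone level step-level

  exponent-mono-≤ : ∀ {j k} → j ≤ k → exponent (state j) ≤ exponent (state k)
  exponent-mono-≤ = monotone exponent step-exponent-≥

  step-cases : ∀ s → let open State s renaming (level to t; exponent to d; position to i) in
    (suc i < breadth t × step s ≡ ⟨ t , d , suc i ⟩) ⊎
    (breadth t ≤ suc i × step s ≡ ⟨ nextLevel t d , d + growth t , 0 ⟩)
  step-cases ⟨ t , d , i ⟩ with suc i <? breadth t
  ... | yes i+1<r = inj₁ (i+1<r , refl)
  ... | no  i+1≮r = inj₂ (≮⇒≥ i+1≮r , refl)

  epoch-end : ∀ k → let open State (state k) renaming (level to t; exponent to d) in
    ∃ λ k′ → k ≤ k′ × state k′ ≡ ⟨ nextLevel t d , d + growth t , 0 ⟩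
  epoch-end k = go (breadth (level (state k))) k (m≤n+m _ (position (state k)))
    where
    -- The fuel bounds the number of layers left in the epoch.
    go : ∀ fuel k → let open State (state k) renaming (level to t; exponent to d; position to i) in
      breadth t ≤ i + fuel → ∃ λ k′ → k ≤ k′ × state k′ ≡ ⟨ nextLevel t d , d + growth t , 0 ⟩
    go fuel k r≤i+fuel with step-cases (state k)
    go fuel k r≤i+fuel | inj₂ (_ , eq) = suc k , n≤1+n k , eq
    go zero k r≤i+0 | inj₁ (i+1<r , _) =
      contradiction (≤-trans r≤i+0 (≤-reflexive (+-identityʳ _))) (<⇒≱ (<-trans (n<1+n _) i+1<r))
    go (suc fuel) k r≤i+fuel | inj₁ (_ , eq) with go fuel (suc k) r≤
      where
      r≤ : breadth (level (state (suc k))) ≤ position (state (suc k)) + fuel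
      r≤ rewrite eq = ≤-trans r≤i+fuel (≤-reflexive (+-suc (position (state k)) fuel))
    ... | k′ , k<k′ , eq′ rewrite eq = k′ , <⇒≤ k<k′ , eq′

  exponent-unbounded : ∀ X → ∃ λ k → X ≤ exponent (state k)
  exponent-unbounded zero = 0 , z≤n
  exponent-unbounded (suc X) with exponent-unbounded X
  ... | k , X≤d with epoch-end k
  ...   | k′ , _ , eq =
    k′ , subst (λ s → suc X ≤ exponent s) (sym eq)
      (subst (_≤ exponent (state k) + growth (level (state k))) (+-comm X 1)
        (+-mono-≤ X≤d (m≤n⇒m≤o+n (level (state k)) (s≤s z≤n))))

  -- Once the level is at least R and the exponent has passed `Φ (suc R)`, the next end of an epoch
  -- leaves level R behind, unless this has already happened.
  level-unbounded : ∀ R → Eventually (λ k → R ≤ level (state k))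
  level-unbounded zero = 0 , λ _ _ → z≤n
  level-unbounded (suc R) = k′ , λ k k′≤k → ≤-trans R<level (level-mono-≤ k′≤k)
    where
    k₁ = proj₁ (level-unbounded R)
    k₂ = proj₁ (exponent-unbounded (Φ (suc R)))
    t = level (state (k₁ + k₂))
    d = exponent (state (k₁ + k₂))
    k′ = proj₁ (epoch-end (k₁ + k₂))
    Φ≤d : Φ (suc R) ≤ d
    Φ≤d = ≤-trans (proj₂ (exponent-unbounded (Φ (suc R)))) (exponent-mono-≤ (m≤n+m k₂ k₁))
    R<nextLevel : suc R ≤ nextLevel t d
    R<nextLevel with m≤n⇒m<n∨m≡n (proj₂ (level-unbounded R) (k₁ + k₂) (m≤m+n k₁ k₂))
    ... | inj₁ R<t = ≤-trans R<t (nextLevel-≥ t d)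
    ... | inj₂ R≡t with Φ (suc t) ≤? d
    ...   | yes _ = s≤s (≤-reflexive R≡t)
    ...   | no Φ≰d = contradiction (subst (λ t → Φ (suc t) ≤ d) R≡t Φ≤d) Φ≰d
    R<level : suc R ≤ level (state k′)
    R<level = subst (λ s → suc R ≤ level s) (sym (proj₂ (proj₂ (epoch-end (k₁ + k₂))))) R<nextLevel

  n : ℕ → ℕ
  n k = layerSize (state k)

  open Layers n (λ k → layerSize-nonZero (state k)) public

  -- When a level is entered, Φ ≤ d < 2^d, and the layer just completed already has 2^d points.
  -- Level 0 is exempt because it starts without any point. This translates the condition on
  -- exponents into one on N.
  Φ[level]≤size : ∀ k → level (state k) ≡ 0 ⊎ Φ (level (state k)) ≤ size k
  Φ[level]≤size zero = inj₁ refl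
  Φ[level]≤size (suc k) with step-cases (state k)
  ... | inj₁ (_ , eq) rewrite eq = [ inj₁ , (λ h → inj₂ (≤-trans h (size-mono-≤ (n≤1+n k)))) ]′ (Φ[level]≤size k)
  ... | inj₂ (_ , eq) rewrite eq with Φ (suc (level (state k))) ≤? exponent (state k)
  ...   | no  _ = [ inj₁ , (λ h → inj₂ (≤-trans h (size-mono-≤ (n≤1+n k)))) ]′ (Φ[level]≤size k)
  ...   | yes Φ≤d = inj₂ (begin
    Φ (suc (level (state k)))  ≤⟨ Φ≤d ⟩
    exponent (state k)         ≤⟨ <⇒≤ (n<2^n _) ⟩
    2 ^ exponent (state k)     ≤⟨ 2^exponent≤layerSize (state k) (valid k) ⟩
    n k                        ≤⟨ m≤n+m (n k) (size k) ⟩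
    size k + n k               ≡⟨ size-suc k ⟨
    size (suc k)               ∎)
    where open ≤-Reasoning

  position*2^exponent≤size : ∀ k → position (state k) * 2 ^ exponent (state k) ≤ size k
  1+position*2^exponent≤size : ∀ k → suc (position (state k)) * 2 ^ exponent (state k) ≤ size (suc k)

  position*2^exponent≤size zero = z≤n
  position*2^exponent≤size (suc k) with step-cases (state k)
  ... | inj₁ (_ , eq) rewrite eq = 1+position*2^exponent≤size k
  ... | inj₂ (_ , eq) rewrite eq = z≤n

  1+position*2^exponent≤size k = begin
    2 ^ exponent (state k) + position (state k) * 2 ^ exponent (state k)
      ≤⟨ +-mono-≤ (2^exponent≤layerSize (state k) (valid k)) (position*2^exponent≤size k) ⟩
    n k + size k   ≡⟨ +-comm (n k) (size k) ⟩
    size k + n k   ≡⟨ size-suc k ⟨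
    size (suc k)   ∎
    where open ≤-Reasoning

  nextLevel-≤-2* : ∀ t d → suc (nextLevel t d) ≤ 2 * suc t
  nextLevel-≤-2* t d = ≤-trans (s≤s (nextLevel-≤ t d)) (≤-trans (s≤s (s≤s (m≤m+n t (t + 0)))) (≤-reflexive (l t)))
    where
    l : ∀ t → suc (suc (t + (t + 0))) ≡ 2 * suc t
    l = solve-∀

  -- The factor 1 + level expresses that a layer is a small proportion of all points so far.
  1+level*2^exponent≤2*size : ∀ k → level (state k) ≡ 0 ⊎
    suc (level (state k)) * 2 ^ exponent (state k) ≤ 2 * size k
  1+level*2^exponent≤2*size zero = inj₁ refl
  1+level*2^exponent≤2*size (suc k) with step-cases (state k)
  ... | inj₁ (_ , eq) rewrite eq =
    [ inj₁ , (λ h → inj₂ (≤-trans h (*-monoʳ-≤ 2 (size-mono-≤ (n≤1+n k))))) ]′ (1+level*2^exponent≤2*size k)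
  -- The finished epoch consists of (t + 1) 2^`growth t` layers with at least 2^d points each, which
  -- is t + 1 times the new power 2^(d + `growth t`). The factor 2 pays for a possible rise of the
  -- level.
  ... | inj₂ (r≤i+1 , eq) rewrite eq = inj₂ (begin
    suc (nextLevel t d) * 2 ^ (d + growth t)     ≤⟨ *-monoˡ-≤ (2 ^ (d + growth t)) (nextLevel-≤-2* t d) ⟩
    2 * suc t * 2 ^ (d + growth t)               ≡⟨ cong (2 * suc t *_) (^-distribˡ-+-* 2 d (growth t)) ⟩
    2 * suc t * (2 ^ d * 2 ^ growth t)           ≡⟨ l (suc t) (2 ^ d) (2 ^ growth t) ⟩
    2 * (breadth t * 2 ^ d)                      ≤⟨ *-monoʳ-≤ 2 (*-monoˡ-≤ (2 ^ d) r≤i+1) ⟩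
    2 * (suc (position (state k)) * 2 ^ d)       ≤⟨ *-monoʳ-≤ 2 (1+position*2^exponent≤size k) ⟩
    2 * size (suc k)                             ∎)
    where
    open ≤-Reasoning
    t = level (state k)
    d = exponent (state k)
    l : ∀ T D H → 2 * T * (D * H) ≡ 2 * (T * H * D)
    l = solve-∀

  n-small : ∀ R → Eventually (λ k → ∀ a → a ≤ k → R * n a ≤ size k)
  -- One factor 2 since a layer can have up to 2 · 2^d points, another from `2 * size`; the `suc`
  -- keeps the level positive and so excludes the exceptional case.
  n-small R with k₀ , R≤level ← level-unbounded (suc (4 * R)) = k₀ , λ k k₀≤k a a≤k →
    let t = level (state k)
        d = exponent (state k)
    in *-cancelˡ-≤ 2 (begin
      2 * (R * n a)          ≤⟨ *-monoʳ-≤ 2 (*-monoʳ-≤ R (≤-trans (layerSize≤2*2^exponent (state a) (valid a))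
                                  (*-monoʳ-≤ 2 (^-monoʳ-≤ 2 (exponent-mono-≤ a≤k))))) ⟩
      2 * (R * (2 * 2 ^ d))  ≡⟨ l R (2 ^ d) ⟩
      4 * R * 2 ^ d          ≤⟨ *-monoˡ-≤ (2 ^ d) (<⇒≤ (<-trans (R≤level k k₀≤k) (n<1+n t))) ⟩
      suc t * 2 ^ d          ≤⟨ [ (λ t≡0 → contradiction (subst (4 * R <_) t≡0 (R≤level k k₀≤k)) n≮0) , (λ h → h) ]′
                                  (1+level*2^exponent≤2*size k) ⟩
      2 * size k             ∎)
    where
    open ≤-Reasoning
    l : ∀ R X → 2 * (R * (2 * X)) ≡ 4 * R * X
    l = solve-∀

  -- Bounds the gcd of layer j with any layer of Fermat index J.
  weight : ℕ → ℕ → ℕ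
  weight J j with fermatIndex (state j) ≟ J
  ... | yes _ = n j
  ... | no  _ = 2 ^ shift (state j)

  gcd≤weight : ∀ j k → gcd (n j) (n k) ≤ weight (fermatIndex (state k)) j
  gcd≤weight j k with fermatIndex (state j) ≟ fermatIndex (state k)
  ... | yes _ = ∣⇒≤ {{layerSize-nonZero (state j)}} (gcd[m,n]∣m (n j) (n k))
  ... | no  I≢J = gcd-2^*fermat-≤ (shift (state j)) (shift (state k)) I≢J

  -- An invariant with three budgets: 2^d for all earlier epochs, one small gcd for each of the i
  -- earlier layers of the current epoch, and one full layer as soon as index J lies behind the
  -- current position. Within an epoch J occurs at most once.
  weightBound : ℕ → ℕ → ℕ → ℕ → ℕ
  weightBound J t d i = 2 ^ d + suc t * (i * 2 ^ (d ∸ 2 ^ base t)) + 𝟙 (J <? base t + i) * (2 * suc t * 2 ^ d)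

  ∑weight-≤ : ∀ J k → let open State (state k) renaming (level to t; exponent to d; position to i) in
    suc t * ∑ k (weight J) ≤ weightBound J t d i
  ∑weight-suc-≤ : ∀ J k → let open State (state k) renaming (level to t; exponent to d; position to i) in
    suc t * ∑ (suc k) (weight J) ≤ weightBound J t d (suc i)

  ∑weight-suc-≤ J k = begin
    T * ∑ (suc k) (weight J)                ≡⟨ trans (cong (T *_) (∑-suc k (weight J))) (*-distribˡ-+ T (∑ k (weight J)) (weight J k)) ⟩
    T * ∑ k (weight J) + T * weight J k     ≤⟨ +-monoˡ-≤ (T * weight J k) (∑weight-≤ J k) ⟩
    weightBound J t d i + T * weight J k          ≤⟨ increment ⟩
    weightBound J t d (suc i)                     ∎
    where
    open ≤-Reasoning
    open State (state k) using () renaming (level to t; exponent to d; position to i)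
    T = suc t
    E = 2 ^ (d ∸ 2 ^ base t)
    C = 2 * T * 2 ^ d
    increment : weightBound J t d i + T * weight J k ≤ weightBound J t d (suc i)
    increment with fermatIndex (state k) ≟ J
    -- At index J the indicator switches from 0 to 1, and C pays for the full layer.
    ... | yes refl = begin
      2 ^ d + T * (i * E) + 𝟙 (base t + i <? base t + i) * C + T * n k
        ≡⟨ cong (λ x → 2 ^ d + T * (i * E) + x * C + T * n k) (𝟙-no (base t + i <? base t + i) (n≮n _)) ⟩
      2 ^ d + T * (i * E) + 0 + T * n k
        ≤⟨ +-mono-≤ (≤-trans (≤-reflexive (+-identityʳ _)) (+-monoʳ-≤ (2 ^ d) (*-monoʳ-≤ T (m≤n+m (i * E) E))))
             (≤-trans (*-monoʳ-≤ T (layerSize≤2*2^exponent (state k) (valid k))) (≤-reflexive (l T (2 ^ d)))) ⟩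
      2 ^ d + T * (E + i * E) + 1 * C
        ≡⟨ cong (λ x → 2 ^ d + T * (E + i * E) + x * C) (𝟙-yes (base t + i <? base t + suc i) (+-monoʳ-< (base t) (n<1+n i))) ⟨
      2 ^ d + T * (E + i * E) + 𝟙 (base t + i <? base t + suc i) * C
        ∎
      where
      l : ∀ T D → T * (2 * D) ≡ 1 * (2 * T * D)
      l = solve-∀
    ... | no _ = begin
      2 ^ d + T * (i * E) + 𝟙 (J <? base t + i) * C + T * 2 ^ shift (state k)
        ≤⟨ +-mono-≤ (+-monoʳ-≤ (2 ^ d + T * (i * E)) (*-monoˡ-≤ C (𝟙-mono (J <? base t + i) (J <? base t + suc i)
             (λ h → <-trans h (+-monoʳ-< (base t) (n<1+n i)))))) (*-monoʳ-≤ T (2^shift≤ (state k) (valid k))) ⟩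
      2 ^ d + T * (i * E) + 𝟙 (J <? base t + suc i) * C + T * E
        ≡⟨ l (2 ^ d) T (i * E) (𝟙 (J <? base t + suc i) * C) E ⟩
      2 ^ d + T * (E + i * E) + 𝟙 (J <? base t + suc i) * C
        ∎
      where
      l : ∀ D T x y E → D + T * x + y + T * E ≡ D + T * (E + x) + y
      l = solve-∀

  ∑weight-≤ J zero rewrite *-zeroʳ (suc 0) = z≤n
  ∑weight-≤ J (suc k) with step-cases (state k)
  ... | inj₁ (_ , eq) rewrite eq = ∑weight-suc-≤ J k
  ... | inj₂ (r≤i+1 , eq) rewrite eq = begin
    suc (nextLevel t d) * Z            ≤⟨ *-monoˡ-≤ Z (nextLevel-≤-2* t d) ⟩
    2 * T * Z                          ≡⟨ *-assoc 2 T Z ⟩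
    2 * (T * Z)                        ≤⟨ *-monoʳ-≤ 2 (∑weight-suc-≤ J k) ⟩
    2 * weightBound J t d (suc i)
      ≤⟨ *-monoʳ-≤ 2 (+-mono-≤ (+-monoʳ-≤ (2 ^ d) (≤-trans (*-monoʳ-≤ T (*-monoˡ-≤ E (proj₁ (valid k)))) (epoch-≤ (state k) (valid k))))
           (*-monoˡ-≤ C (𝟙≤1 (J <? base t + suc i)))) ⟩
    -- Everything spent in the finished epoch fits into the first budget 2^(d + `growth t`) of the
    -- new one, since 4 (t + 2) ≤ 2^(t + 4).
    2 * (2 ^ d + 2 ^ d + 1 * C)        ≡⟨ l (2 ^ d) t ⟩
    2 ^ d * (4 * (1 + suc t))          ≤⟨ *-monoʳ-≤ (2 ^ d) 4*[2+t]≤ ⟩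
    2 ^ d * 2 ^ growth t               ≡⟨ ^-distribˡ-+-* 2 d (growth t) ⟨
    2 ^ (d + growth t)                 ≤⟨ ≤-trans (m≤m+n _ _) (m≤m+n _ _) ⟩
    weightBound J (nextLevel t d) (d + growth t) 0   ∎
    where
    open ≤-Reasoning
    open State (state k) using () renaming (level to t; exponent to d; position to i)
    T = suc t
    E = 2 ^ (d ∸ 2 ^ base t)
    C = 2 * T * 2 ^ d
    Z = ∑ (suc k) (weight J)
    l : ∀ D t → 2 * (D + D + 1 * (2 * suc t * D)) ≡ D * (4 * (1 + suc t))
    l = solve-∀
    4*[2+t]≤ : 4 * (1 + suc t) ≤ 2 ^ growth t
    4*[2+t]≤ = begin
      4 * (1 + suc t)            ≤⟨ *-monoʳ-≤ 4 (+-mono-≤ (m^n>0 2 t) (n<2^n t)) ⟩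
      4 * (2 ^ t + 2 ^ t)        ≤⟨ m≤m+n _ (8 * 2 ^ t) ⟩
      4 * (2 ^ t + 2 ^ t) + 8 * 2 ^ t  ≡⟨ l′ (2 ^ t) ⟩
      2 ^ t * 2 ^ 4              ≡⟨ ^-distribˡ-+-* 2 t 4 ⟨
      2 ^ growth t               ∎
      where
      l′ : ∀ x → 4 * (x + x) + 8 * x ≡ x * 16
      l′ = solve-∀

  -- For J the index of layer k itself the indicator vanishes: earlier layers of the same epoch have
  -- smaller indices, so only earlier epochs can share the Fermat number.
  1+level*G≤2*n : ∀ k → suc (level (state k)) * G k ≤ 2 * n k
  1+level*G≤2*n k = begin
    T * G k                            ≤⟨ *-monoʳ-≤ T (∑-mono-≤ k (λ j _ → gcd≤weight j k)) ⟩
    T * ∑ k (weight (fermatIndex (state k))) ≤⟨ ∑weight-≤ (fermatIndex (state k)) k ⟩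
    2 ^ d + T * (i * E) + 𝟙 (base t + i <? base t + i) * C
      ≡⟨ cong (λ x → 2 ^ d + T * (i * E) + x * C) (𝟙-no (base t + i <? base t + i) (n≮n _)) ⟩
    2 ^ d + T * (i * E) + 0            ≤⟨ +-monoˡ-≤ 0 (+-monoʳ-≤ (2 ^ d) (≤-trans (*-monoʳ-≤ T (*-monoˡ-≤ E (<⇒≤ (proj₁ (valid k))))) (epoch-≤ (state k) (valid k)))) ⟩
    2 ^ d + 2 ^ d + 0                  ≡⟨ +-assoc (2 ^ d) (2 ^ d) 0 ⟩
    2 * 2 ^ d                          ≤⟨ *-monoʳ-≤ 2 (2^exponent≤layerSize (state k) (valid k)) ⟩
    2 * n k                            ∎
    where
    open ≤-Reasoning
    open State (state k) using () renaming (level to t; exponent to d; position to i)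
    T = suc t
    E = 2 ^ (d ∸ 2 ^ base t)
    C = 2 * T * 2 ^ d

  G-small : ∀ R → Eventually (λ k → R * G k ≤ n k)
  G-small R with k₀ , R≤level ← level-unbounded (2 * R) = k₀ , λ k k₀≤k → *-cancelˡ-≤ 2 (begin
    2 * (R * G k)                  ≡⟨ *-assoc 2 R (G k) ⟨
    2 * R * G k                    ≤⟨ *-monoˡ-≤ (G k) (m≤n⇒m≤1+n (R≤level k k₀≤k)) ⟩
    suc (level (state k)) * G k    ≤⟨ 1+level*G≤2*n k ⟩
    2 * n k                        ∎)
    where open ≤-Reasoning

  open Asymptotics n-small G-small public using (pairCount-asymptotics)

  n∣grid : ∀ {j k} → j ≤ k → n j ∣ grid (state k)
  n∣grid {j} {k} j≤k = *-pres-∣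
    (2^-∣ (≤-trans (m∸n≤m (exponent (state j)) (2 ^ fermatIndex (state j))) (exponent-mono-≤ j≤k)))
    (fermat-∣-product (<-≤-trans (fermatIndex<top (state j) (valid j)) (top-mono-≤ (level-mono-≤ j≤k))))

  -- The current layer `suc k` may be incomplete, so its grid is compared with layer k, which has at
  -- least 2^d points; one step raises d by at most `growth`.
  grid≤gapBound*n : ∀ k → grid (state (suc k)) ≤ gapBound (level (state (suc k))) * n k
  grid≤gapBound*n k = begin
    2 ^ exponent (state (suc k)) * F
      ≤⟨ *-monoˡ-≤ F (^-monoʳ-≤ 2 (≤-trans (step-exponent-≤ (state k)) (+-monoʳ-≤ d (+-monoˡ-≤ 4 (step-level (state k)))))) ⟩
    2 ^ (d + growth t′) * F             ≡⟨ cong (_* F) (^-distribˡ-+-* 2 d (growth t′)) ⟩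
    2 ^ d * 2 ^ growth t′ * F           ≤⟨ *-monoˡ-≤ F (*-monoˡ-≤ (2 ^ growth t′) (2^exponent≤layerSize (state k) (valid k))) ⟩
    n k * 2 ^ growth t′ * F             ≡⟨ l (n k) (2 ^ growth t′) F ⟩
    2 ^ growth t′ * F * n k             ∎
    where
    open ≤-Reasoning
    d = exponent (state k)
    t′ = level (state (suc k))
    F = fermatProduct (top t′)
    l : ∀ x y z → x * y * z ≡ y * z * x
    l = solve-∀

-- Lists, sorting, gaps and fractions

open import Data.Integer using (+_; -[1+_])
import Data.Integer as ℤ
import Data.Integer.Properties as ℤₚ

Unique-lookup-injective : ∀ {A : Set} {xs : List A} → Unique xs → ∀ {i j} → lookup xs i ≡ lookup xs j → i ≡ j
Unique-lookup-injective (_ ∷ _)    {zero}  {zero}  eq = refl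
Unique-lookup-injective (x∉xs ∷ _) {zero}  {suc j} eq = contradiction eq (All.lookup x∉xs (∈-lookup j))
Unique-lookup-injective (x∉xs ∷ _) {suc i} {zero}  eq = contradiction (sym eq) (All.lookup x∉xs (∈-lookup i))
Unique-lookup-injective (_ ∷ xs!)  {suc i} {suc j} eq = cong suc (Unique-lookup-injective xs! eq)

-- Positions in xs inject into positions in ys. This compares the unknown list inside a `HasCard`
-- with an explicit one.
Unique-⊆-length : ∀ {A : Set} {xs ys : List A} → Unique xs → (∀ {x} → x ∈ xs → x ∈ ys) → length xs ≤ length ys
Unique-⊆-length {xs = xs} {ys} xs! xs⊆ys = injective⇒≤ {f = λ i → Any.index (xs⊆ys (∈-lookup i))} λ {i} {j} eq →
  Unique-lookup-injective xs! (begin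
    lookup xs i                              ≡⟨ Anyₚ.lookup-index (xs⊆ys (∈-lookup i)) ⟩
    lookup ys (Any.index (xs⊆ys (∈-lookup i)))   ≡⟨ cong (lookup ys) eq ⟩
    lookup ys (Any.index (xs⊆ys (∈-lookup j)))   ≡⟨ Anyₚ.lookup-index (xs⊆ys (∈-lookup j)) ⟨
    lookup xs j                              ∎)
  where open ≡-Reasoning

length-filter-∷ : ∀ {A : Set} {P : A → Set} (P? : Decidable P) x xs →
  length (filter P? (x ∷ xs)) ≡ 𝟙 (P? x) + length (filter P? xs)
length-filter-∷ P? x xs with P? x
... | yes _ = refl
... | no  _ = refl

length-filter-tabulate : ∀ {A : Set} {P : A → Set} (P? : Decidable P) {n} (f : Fin n → A) (g : ℕ → ℕ) →
  (∀ i → 𝟙 (P? (f i)) ≡ g (toℕ i)) → length (filter P? (tabulate f)) ≡ ∑ n g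
length-filter-tabulate P? {zero}  f g eq = refl
length-filter-tabulate P? {suc n} f g eq = trans (length-filter-∷ P? (f zero) (tabulate (λ i → f (suc i))))
  (cong₂ _+_ (eq zero) (length-filter-tabulate P? (λ i → f (suc i)) (λ i → g (suc i)) (λ i → eq (suc i))))

length-filter-cartesianProduct : ∀ {A B : Set} {P : A × B → Set} (P? : Decidable P) {m n} (f : Fin m → A) (f′ : Fin n → B) (g : ℕ → ℕ → ℕ) →
  (∀ i j → 𝟙 (P? (f i , f′ j)) ≡ g (toℕ i) (toℕ j)) →
  length (filter P? (cartesianProduct (tabulate f) (tabulate f′))) ≡ ∑ m (λ i → ∑ n (g i))
length-filter-cartesianProduct P? {zero}  f f′ g eq = refl
length-filter-cartesianProduct P? {suc m} {n} f f′ g eq = begin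
  length (filter P? (row ++ rest))                   ≡⟨ cong length (filter-++ P? row rest) ⟩
  length (filter P? row ++ filter P? rest)           ≡⟨ length-++ (filter P? row) ⟩
  length (filter P? row) + length (filter P? rest)   ≡⟨ cong₂ _+_
    (trans (cong (λ xs → length (filter P? xs)) (map-tabulate f′ (f zero ,_)))
      (length-filter-tabulate P? (λ j → f zero , f′ j) (g 0) (eq zero)))
    (length-filter-cartesianProduct P? (λ i → f (suc i)) f′ (λ i → g (suc i)) (λ i → eq (suc i))) ⟩
  ∑ n (g 0) + ∑ m (λ i → ∑ n (g (suc i)))            ∎
  where
  open ≡-Reasoning
  row = map (f zero ,_) (tabulate f′)
  rest = cartesianProduct (tabulate (λ i → f (suc i))) (tabulate f′)

argmin : ∀ {n} (y : Fin (suc n) → ℕ) → ∃ λ i → ∀ j → y i ≤ y j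
argmin {zero}  y = zero , λ { zero → ≤-refl }
argmin {suc n} y with argmin (λ i → y (suc i))
... | i , min with y zero ≤? y (suc i)
...   | yes y₀≤yᵢ = zero , λ { zero → ≤-refl ; (suc j) → ≤-trans y₀≤yᵢ (min j) }
...   | no  y₀≰yᵢ = suc i , λ { zero → <⇒≤ (≰⇒> y₀≰yᵢ) ; (suc j) → min j }

-- Selection sort: a minimum goes to position 0, and `punchIn m` enumerates the remaining indices.
sorting : ∀ {n} (y : Fin n → ℕ) → ∃ λ (σ : Permutation′ n) → ∀ i j → toℕ i ≤ toℕ j → y (σ ⟨$⟩ʳ i) ≤ y (σ ⟨$⟩ʳ j)
sorting {zero}  y = Permutation.id , λ ()
sorting {suc n} y with argmin y
... | m , min with sorting (λ i → y (punchIn m i))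
...   | π , sorted = σ , sorted′
  where
  σ = Permutation.insert zero m π
  tail : ∀ i → y (punchIn m (π ⟨$⟩ʳ i)) ≡ y (σ ⟨$⟩ʳ suc i)
  tail i = cong y (sym (Permutation.insert-punchIn zero m π i))
  sorted′ : ∀ i j → toℕ i ≤ toℕ j → y (σ ⟨$⟩ʳ i) ≤ y (σ ⟨$⟩ʳ j)
  sorted′ zero    j       _         = min (σ ⟨$⟩ʳ j)
  sorted′ (suc i) (suc j) (s≤s i≤j) = subst₂ _≤_ (tail i) (tail j) (sorted i j i≤j)

toℕ-next : ∀ {N} .{{_ : NonZero N}} (k : Fin N) → toℕ (next k) ≡ suc (toℕ k) % N
toℕ-next {N} k = toℕ-mod N (suc (toℕ k))

-- Among points on the grid of mesh 1 / L that include all multiples of w / L, no gap exceeds w / L.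
gap-≤ : ∀ {N L w c} .{{_ : NonZero N}} .{{_ : NonZero w}} (y : Fin N → ℕ) → (∀ i → y i < L) → c * w ≡ L →
  (∀ u → u < c → ∃ λ i → y i ≡ u * w) →
  (σ : Permutation′ N) → (∀ i j → toℕ i ≤ toℕ j → y (σ ⟨$⟩ʳ i) ≤ y (σ ⟨$⟩ʳ j)) →
  ∀ k → circ L ∣ y (σ ⟨$⟩ʳ next k) - y (σ ⟨$⟩ʳ k) ∣ ≤ w
gap-≤ {N} {L} {w} {c} y y<L cw≡L multiple σ sorted k = cases (m≤n⇒m<n∨m≡n (toℕ<n k))
  where
  open ≤-Reasoning
  A = y (σ ⟨$⟩ʳ k)
  B = y (σ ⟨$⟩ʳ next k)
  preimage : ∀ {i} → y (σ ⟨$⟩ʳ (σ ⟨$⟩ˡ i)) ≡ y i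
  preimage = cong y (inverseʳ σ)
  interior : suc (toℕ k) < N → B ∸ A ≤ w
  interior k+1<N = ≮⇒≥ λ w<B∸A →
    -- The first multiple of w beyond A. If the gap exceeded w, it would lie strictly between A and
    -- B; but it is the value of a point, whose place in the order is at most k or at least k + 1.
    let u = suc (A / w)
        w+A<B = subst (w + A <_) (m∸n+n≡m (A≤B w<B∸A)) (+-monoˡ-< A w<B∸A)
        uw<B = ≤-<-trans (+-monoʳ-≤ w (m/n*n≤m A w)) w+A<B
        A<uw = subst (_< u * w) (sym (m≡m%n+[m/n]*n A w)) (+-monoˡ-< (A / w * w) (m%n<n A w))
        i , yᵢ≡uw = multiple u (*-cancelʳ-< w u c (subst (u * w <_) (sym cw≡L) (<-trans uw<B (y<L _))))
        l = σ ⟨$⟩ˡ i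
        y[σl]≡uw = trans preimage yᵢ≡uw
    in [ (λ l≤k → <⇒≱ A<uw (subst (_≤ A) y[σl]≡uw (sorted l k l≤k)))
       , (λ k<l → <⇒≱ uw<B (subst (B ≤_) y[σl]≡uw (sorted (next k) l (subst (_≤ toℕ l) (sym next≡) k<l))))
       ]′ (≤-<-connex (toℕ l) (toℕ k))
    where
    next≡ : toℕ (next k) ≡ suc (toℕ k)
    next≡ = trans (toℕ-next k) (m<n⇒m%n≡m k+1<N)
    A≤B : w < B ∸ A → A ≤ B
    A≤B w<B∸A = <⇒≤ (m∸n≢0⇒n<m (λ eq → n≮0 (subst (w <_) eq w<B∸A)))
  cases : suc (toℕ k) < N ⊎ suc (toℕ k) ≡ N → circ L ∣ B - A ∣ ≤ w
  cases (inj₁ k+1<N) = begin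
    circ L ∣ B - A ∣    ≤⟨ m⊓n≤m ∣ B - A ∣ (L ∸ ∣ B - A ∣) ⟩
    ∣ B - A ∣           ≡⟨ trans (∣-∣-comm B A) (m≤n⇒∣m-n∣≡n∸m (sorted k (next k) k≤next)) ⟩
    B ∸ A               ≤⟨ interior k+1<N ⟩
    w                   ∎
    where
    k≤next : toℕ k ≤ toℕ (next k)
    k≤next = subst (toℕ k ≤_) (sym (trans (toℕ-next k) (m<n⇒m%n≡m k+1<N))) (n≤1+n (toℕ k))
  -- The gap across 0: the smallest value B is 0, and the largest value A is at least the last
  -- multiple (c - 1) w.
  cases (inj₂ k+1≡N) = begin
    circ L ∣ B - A ∣    ≤⟨ m⊓n≤n ∣ B - A ∣ (L ∸ ∣ B - A ∣) ⟩
    L ∸ ∣ B - A ∣       ≡⟨ cong (λ b → L ∸ ∣ b - A ∣) B≡0 ⟩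
    L ∸ A               ≤⟨ m≤n+o⇒m∸n≤o L A (begin
      L                 ≡⟨ cw≡L ⟨
      c * w             ≡⟨ cong (_* w) (suc-pred c) ⟨
      w + pred c * w    ≤⟨ +-monoʳ-≤ w last≤A ⟩
      w + A             ≡⟨ +-comm w A ⟩
      A + w             ∎) ⟩
    w                   ∎
    where
    instance
      c≢0 : NonZero c
      c≢0 = ≢-nonZero (λ c≡0 → n≮0 (subst (A <_) (trans (sym cw≡L) (cong (_* w) c≡0)) (y<L _)))
    next≡0 : toℕ (next k) ≡ 0
    next≡0 = trans (toℕ-next k) (trans (cong (_% N) k+1≡N) (n%n≡0 N))
    B≡0 : B ≡ 0
    B≡0 with multiple 0 (>-nonZero⁻¹ c)
    ... | i , yᵢ≡0 = n≤0⇒n≡0 (subst (B ≤_) (trans preimage yᵢ≡0)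
      (sorted (next k) (σ ⟨$⟩ˡ i) (subst (_≤ _) (sym next≡0) z≤n)))
    last≤A : pred c * w ≤ A
    last≤A with multiple (pred c) (≤-reflexive (suc-pred c))
    ... | i , yᵢ≡ = subst (_≤ A) (trans preimage yᵢ≡)
      (sorted (σ ⟨$⟩ˡ i) k (s≤s⁻¹ (subst (toℕ (σ ⟨$⟩ˡ i) <_) (sym k+1≡N) (toℕ<n (σ ⟨$⟩ˡ i)))))

toℚᵘ-frac : ∀ a d → toℚᵘ (+ a ℚ./ suc d) ℚᵘ.≃ mkℚᵘ (+ a) d
toℚᵘ-frac a d = ℚₚ.toℚᵘ-fromℚᵘ (mkℚᵘ (+ a) d)

frac-mono-< : ∀ a b c d .{{_ : NonZero c}} .{{_ : NonZero d}} → a * d < b * c → + a ℚ./ c ℚ.< + b ℚ./ d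
frac-mono-< a b (suc c) (suc d) ad<bc = ℚₚ.toℚᵘ-cancel-<
  (ℚᵘₚ.<-respˡ-≃ (ℚᵘₚ.≃-sym (toℚᵘ-frac a c)) (ℚᵘₚ.<-respʳ-≃ (ℚᵘₚ.≃-sym (toℚᵘ-frac b d))
    (*<* (subst₂ ℤ._<_ (ℤₚ.pos-* a (suc d)) (ℤₚ.pos-* b (suc c)) (ℤ.+<+ ad<bc)))))

frac-cancel-< : ∀ a b c d .{{_ : NonZero c}} .{{_ : NonZero d}} → + a ℚ./ c ℚ.< + b ℚ./ d → a * d < b * c
frac-cancel-< a b (suc c) (suc d) a/c<b/d
  with *<* h ← ℚᵘₚ.<-respˡ-≃ (toℚᵘ-frac a c) (ℚᵘₚ.<-respʳ-≃ (toℚᵘ-frac b d) (ℚₚ.toℚᵘ-mono-< a/c<b/d)) =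
  ℤₚ.drop‿+<+ (subst₂ ℤ._<_ (sym (ℤₚ.pos-* a (suc d))) (sym (ℤₚ.pos-* b (suc c))) h)

frac-mono-≤ : ∀ a b c d .{{_ : NonZero c}} .{{_ : NonZero d}} → a * d ≤ b * c → + a ℚ./ c ℚ.≤ + b ℚ./ d
frac-mono-≤ a b (suc c) (suc d) ad≤bc = ℚₚ.toℚᵘ-cancel-≤
  (ℚᵘₚ.≤-respˡ-≃ (ℚᵘₚ.≃-sym (toℚᵘ-frac a c)) (ℚᵘₚ.≤-respʳ-≃ (ℚᵘₚ.≃-sym (toℚᵘ-frac b d))
    (*≤* (subst₂ ℤ._≤_ (ℤₚ.pos-* a (suc d)) (ℤₚ.pos-* b (suc c)) (ℤ.+≤+ ad≤bc)))))

frac-≡ : ∀ a b c d .{{_ : NonZero c}} .{{_ : NonZero d}} → a * d ≡ b * c → + a ℚ./ c ≡ + b ℚ./ d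
frac-≡ a b c d ad≡bc = ℚₚ.≤-antisym (frac-mono-≤ a b c d (≤-reflexive ad≡bc)) (frac-mono-≤ b a d c (≤-reflexive (sym ad≡bc)))

frac-+ : ∀ a b d .{{_ : NonZero d}} → + a ℚ./ d ℚ.+ + b ℚ./ d ≡ + (a + b) ℚ./ d
frac-+ a b (suc d) = ℚₚ.toℚᵘ-injective (begin
  toℚᵘ (+ a ℚ./ suc d ℚ.+ + b ℚ./ suc d)             ≈⟨ ℚₚ.toℚᵘ-homo-+ (+ a ℚ./ suc d) (+ b ℚ./ suc d) ⟩
  toℚᵘ (+ a ℚ./ suc d) ℚᵘ.+ toℚᵘ (+ b ℚ./ suc d)     ≈⟨ ℚᵘₚ.+-cong (toℚᵘ-frac a d) (toℚᵘ-frac b d) ⟩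
  mkℚᵘ (+ a) d ℚᵘ.+ mkℚᵘ (+ b) d                 ≈⟨ *≡* eq ⟩
  mkℚᵘ (+ (a + b)) d                             ≈⟨ toℚᵘ-frac (a + b) d ⟨
  toℚᵘ (+ (a + b) ℚ./ suc d)                       ∎)
  where
  open ℚᵘₚ.≃-Reasoning
  eq : (+ a ℤ.* + suc d ℤ.+ + b ℤ.* + suc d) ℤ.* + suc d ≡ + (a + b) ℤ.* + (suc d * suc d)
  eq rewrite sym (ℤₚ.pos-* a (suc d)) | sym (ℤₚ.pos-* b (suc d))
           | sym (ℤₚ.pos-* (a * suc d + b * suc d) (suc d)) | sym (ℤₚ.pos-* (a + b) (suc d * suc d)) =
    cong +_ (l a b (suc d))
    where
    l : ∀ a b d → (a * d + b * d) * d ≡ (a + b) * (d * d)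
    l = solve-∀

frac-* : ∀ a c d .{{_ : NonZero c}} .{{_ : NonZero d}} →
  + a ℚ./ c ℚ.* (+ 1 ℚ./ d) ≡ ℚ._/_ (+ a) (c * d) {{m*n≢0 c d}}
frac-* a (suc c) (suc d) = ℚₚ.toℚᵘ-injective (begin
  toℚᵘ (+ a ℚ./ suc c ℚ.* (+ 1 ℚ./ suc d))             ≈⟨ ℚₚ.toℚᵘ-homo-* (+ a ℚ./ suc c) (+ 1 ℚ./ suc d) ⟩
  toℚᵘ (+ a ℚ./ suc c) ℚᵘ.* toℚᵘ (+ 1 ℚ./ suc d)     ≈⟨ ℚᵘₚ.*-cong (toℚᵘ-frac a c) (toℚᵘ-frac 1 d) ⟩
  mkℚᵘ (+ a) c ℚᵘ.* mkℚᵘ (+ 1) d                 ≈⟨ *≡* (cong (ℤ._* + (suc c * suc d)) (ℤₚ.*-identityʳ (+ a))) ⟩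
  mkℚᵘ (+ a) (d + c * suc d)                     ≈⟨ toℚᵘ-frac a (d + c * suc d) ⟨
  toℚᵘ (+ a ℚ./ (suc c * suc d))                   ∎)
  where open ℚᵘₚ.≃-Reasoning

frac-∸ : ∀ {a b} d .{{_ : NonZero d}} → a ≤ b → + b ℚ./ d ℚ.- + a ℚ./ d ≡ + (b ∸ a) ℚ./ d
frac-∸ {a} {b} d a≤b = begin
  + b ℚ./ d ℚ.- + a ℚ./ d                       ≡⟨ cong (λ t → + t ℚ./ d ℚ.- + a ℚ./ d) (m∸n+n≡m a≤b) ⟨
  + (b ∸ a + a) ℚ./ d ℚ.- + a ℚ./ d             ≡⟨ cong (ℚ._- + a ℚ./ d) (frac-+ (b ∸ a) a d) ⟨
  + (b ∸ a) ℚ./ d ℚ.+ + a ℚ./ d ℚ.- + a ℚ./ d     ≡⟨ ℚₚ.+-assoc (+ (b ∸ a) ℚ./ d) (+ a ℚ./ d) (ℚ.- (+ a ℚ./ d)) ⟩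
  + (b ∸ a) ℚ./ d ℚ.+ (+ a ℚ./ d ℚ.- + a ℚ./ d)   ≡⟨ cong (+ (b ∸ a) ℚ./ d ℚ.+_) (ℚₚ.+-inverseʳ (+ a ℚ./ d)) ⟩
  + (b ∸ a) ℚ./ d ℚ.+ 0ℚ                      ≡⟨ ℚₚ.+-identityʳ (+ (b ∸ a) ℚ./ d) ⟩
  + (b ∸ a) ℚ./ d                             ∎
  where open ≡-Reasoning

0≤frac : ∀ a d .{{_ : NonZero d}} → 0ℚ ℚ.≤ + a ℚ./ d
0≤frac a d = frac-mono-≤ 0 a 1 d z≤n

-- Every term of `dist` between two constant reals computes to this.
distℚ : ℚ → ℚ → ℚ
distℚ p q = ℚ.∣ p ℚ.- q ∣ ℚ.⊓ (1ℚ ℚ.- ℚ.∣ p ℚ.- q ∣)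

frac-∣-∣ : ∀ a b d .{{_ : NonZero d}} → ℚ.∣ + a ℚ./ d ℚ.- + b ℚ./ d ∣ ≡ + ∣ a - b ∣ ℚ./ d
frac-∣-∣ a b d with ≤-total b a
... | inj₁ b≤a = trans (cong ℚ.∣_∣ (frac-∸ d b≤a)) (trans (ℚₚ.0≤p⇒∣p∣≡p (0≤frac (a ∸ b) d))
  (cong (λ t → + t ℚ./ d) (trans (sym (m≤n⇒∣m-n∣≡n∸m b≤a)) (∣-∣-comm b a))))
... | inj₂ a≤b = trans (ℚ-Estimates.∣p-q∣≡∣q-p∣ (+ a ℚ./ d) (+ b ℚ./ d)) (trans (cong ℚ.∣_∣ (frac-∸ d a≤b)) (trans (ℚₚ.0≤p⇒∣p∣≡p (0≤frac (b ∸ a) d))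
  (cong (λ t → + t ℚ./ d) (sym (m≤n⇒∣m-n∣≡n∸m a≤b)))))

frac-⊓ : ∀ a b d .{{_ : NonZero d}} → (+ a ℚ./ d) ℚ.⊓ (+ b ℚ./ d) ≡ + (a ⊓ b) ℚ./ d
frac-⊓ a b d with ≤-total a b
... | inj₁ a≤b = trans (ℚₚ.p≤q⇒p⊓q≡p (frac-mono-≤ a b d d (*-monoˡ-≤ d a≤b))) (cong (λ t → + t ℚ./ d) (sym (m≤n⇒m⊓n≡m a≤b)))
... | inj₂ b≤a = trans (ℚₚ.p≥q⇒p⊓q≡q (frac-mono-≤ b a d d (*-monoˡ-≤ d b≤a))) (cong (λ t → + t ℚ./ d) (sym (m≥n⇒m⊓n≡n b≤a)))

distℚ-frac : ∀ {a b} d .{{_ : NonZero d}} → a ≤ d → b ≤ d → distℚ (+ a ℚ./ d) (+ b ℚ./ d) ≡ + circ d ∣ a - b ∣ ℚ./ d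
distℚ-frac {a} {b} d a≤d b≤d = begin
  distℚ (+ a ℚ./ d) (+ b ℚ./ d)                              ≡⟨ cong (λ z → z ℚ.⊓ (1ℚ ℚ.- z)) (frac-∣-∣ a b d) ⟩
  (+ z ℚ./ d) ℚ.⊓ (1ℚ ℚ.- + z ℚ./ d)                           ≡⟨ cong (λ t → (+ z ℚ./ d) ℚ.⊓ (t ℚ.- + z ℚ./ d)) (frac-≡ d 1 d 1 (*-comm d 1)) ⟨
  (+ z ℚ./ d) ℚ.⊓ (+ d ℚ./ d ℚ.- + z ℚ./ d)                      ≡⟨ cong ((+ z ℚ./ d) ℚ.⊓_) (frac-∸ d (≤-trans (∣m-n∣≤m⊔n a b) (⊔-lub a≤d b≤d))) ⟩
  (+ z ℚ./ d) ℚ.⊓ (+ (d ∸ z) ℚ./ d)                              ≡⟨ frac-⊓ z (d ∸ z) d ⟩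
  + circ d z ℚ./ d                                         ∎
  where
  open ≡-Reasoning
  z = ∣ a - b ∣

-- Real sequences

open ℚ-Estimates

0<frac : ∀ a d .{{_ : NonZero a}} .{{_ : NonZero d}} → 0ℚ ℚ.< + a ℚ./ d
0<frac (suc a) d = frac-mono-< 0 (suc a) 1 d z<s

archimedean : ∀ c {η} → 0ℚ ℚ.< η → ∃ λ q → + suc c ℚ./ suc q ℚ.≤ η
archimedean c {mkℚ (+ zero) d _}     0<η with () ← ℤ.Positive.pos (ℚ.positive 0<η)
archimedean c {mkℚ -[1+ _ ] d _}     0<η with () ← ℤ.Positive.pos (ℚ.positive 0<η)
-- The denominator `suc q` is (c + 1)(d + 1), and η = (m + 1) / (d + 1) is at least 1 / (d + 1).
archimedean c {mkℚ (+ suc m) d cop}  0<η = d + c * suc d ,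
  subst (+ suc c ℚ./ suc (d + c * suc d) ℚ.≤_) (ℚₚ.↥p/↧p≡p (mkℚ (+ suc m) d cop))
    (frac-mono-≤ (suc c) (suc m) (suc (d + c * suc d)) (suc d) (m≤n*m (suc c * suc d) (suc m)))

floor : ∀ q .{{_ : NonZero q}} σ → 0ℚ ℚ.≤ σ → ∃ λ a → + a ℚ./ q ℚ.≤ σ × σ ℚ.< + suc a ℚ./ q
floor q σ@(mkℚ (+ m) d cop) _ = a ,
  subst (+ a ℚ./ q ℚ.≤_) σ≡ (frac-mono-≤ a m q D (m/n*n≤m (m * q) D)) ,
  subst (ℚ._< + suc a ℚ./ q) σ≡ (frac-mono-< m (suc a) D q
    (subst (_< D + a * D) (sym (m≡m%n+[m/n]*n (m * q) D)) (+-monoˡ-< (a * D) (m%n<n (m * q) D))))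
  where
  D = suc d
  a = m * q / D
  σ≡ : + m ℚ./ D ≡ σ
  σ≡ = ℚₚ.↥p/↧p≡p σ
floor q σ@(mkℚ -[1+ m ] d cop) 0≤σ with () ← ℤ.NonNegative.nonNeg (ℚ.nonNegative 0≤σ)

fromℚ-mono-≤ : ∀ {p q} → p ℚ.≤ q → fromℚ p ≤ℝ fromℚ q
fromℚ-mono-≤ {p} {q} p≤q (δ , 0<δ , K , q+δ≤p) = ℚₚ.<-irrefl refl (begin-strict
  q          ≡⟨ ℚₚ.+-identityʳ q ⟨
  q ℚ.+ 0ℚ   <⟨ ℚₚ.+-monoʳ-< q 0<δ ⟩
  q ℚ.+ δ    ≤⟨ q+δ≤p K ≤-refl ⟩
  p          ≤⟨ p≤q ⟩
  q          ∎)
  where open ℚₚ.≤-Reasoning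

fromℚ-injective : ∀ {p q} → fromℚ p ≈ℝ fromℚ q → p ≡ q
fromℚ-injective {p} {q} p≈q = ℚₚ.≤-antisym (below p q p≈q) (below q p (Setoid.sym ≈ℝ-setoid {fromℚ p} {fromℚ q} p≈q))
  where
  below : ∀ p q → fromℚ p ≈ℝ fromℚ q → p ℚ.≤ q
  below p q p≈q = ℚₚ.≮⇒≥ λ q<p →
    let 0<p-q = subst (ℚ._< p ℚ.- q) (ℚₚ.+-inverseʳ q) (ℚₚ.+-monoˡ-< (ℚ.- q) q<p)
        K , close = p≈q 0<p-q
    in ℚₚ.<-irrefl refl (ℚₚ.<-≤-trans (close K ≤-refl) (p≤∣p∣ (p ℚ.- q)))

-- The fraction stays at least 1 / L below 1. Half of this is spent on the approximation of r, the
-- other half is the margin that a strict inequality of reals demands.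
≈frac⇒∈[0,1⟩ : ∀ {r c L} .{{_ : NonZero L}} → r ≈ℝ fromℚ (+ c ℚ./ L) → c < L → r ∈[0,1⟩
≈frac⇒∈[0,1⟩ {r} {c} {L} r≈c/L c<L = nonneg , half , 0<half , below-1
  where
  open ℚₚ.≤-Reasoning
  half = (+ 1 ℚ./ L) ℚ.* ½
  0<half : 0ℚ ℚ.< half
  0<half = half-pos (0<frac 1 L)
  nonneg : 0ℝ ≤ℝ r
  nonneg (δ , 0<δ , K , r+δ≤0) with r≈c/L 0<δ
  ... | K′ , close = ℚₚ.<-irrefl refl (begin-strict
    0ℚ              ≤⟨ 0≤frac c L ⟩
    + c ℚ./ L       <⟨ ∣p-q∣<ε⇒p<q+ε (+ c ℚ./ L) (seq r m) (swap-close (seq r m) (+ c ℚ./ L) (close m (m≤n⊔m K K′))) ⟩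
    seq r m ℚ.+ δ   ≤⟨ r+δ≤0 m (m≤m⊔n K K′) ⟩
    0ℚ              ∎)
    where m = K ⊔ K′
  below-1 : ∃ λ K → ∀ m → K ≤ m → seq r m ℚ.+ half ℚ.≤ 1ℚ
  below-1 with r≈c/L 0<half
  ... | K , close = K , λ m K≤m → begin
    seq r m ℚ.+ half                   ≤⟨ ℚₚ.+-monoˡ-≤ half (ℚₚ.<⇒≤ (∣p-q∣<ε⇒p<q+ε (seq r m) (+ c ℚ./ L) (close m K≤m))) ⟩
    + c ℚ./ L ℚ.+ half ℚ.+ half        ≡⟨ ℚₚ.+-assoc (+ c ℚ./ L) half half ⟩
    + c ℚ./ L ℚ.+ (half ℚ.+ half)      ≡⟨ cong (+ c ℚ./ L ℚ.+_) (half+half (+ 1 ℚ./ L)) ⟩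
    + c ℚ./ L ℚ.+ + 1 ℚ./ L            ≡⟨ frac-+ c 1 L ⟩
    + (c + 1) ℚ./ L                    ≤⟨ frac-mono-≤ (c + 1) 1 L 1 (≤-trans (≤-reflexive (trans (*-identityʳ (c + 1)) (+-comm c 1))) (≤-trans c<L (≤-reflexive (sym (+-identityʳ L))))) ⟩
    1ℚ                                 ∎

module _ {N L w : ℕ} .{{_ : NonZero N}} .{{_ : NonZero L}} (x : ℕ⁺ → ℝ) (y : Fin N → ℕ)
         (x≡y/L : ∀ i → x (index i) ≡ fromℚ (+ y i ℚ./ L)) (y<L : ∀ i → y i < L)
         (σ : Permutation′ N) (sorted : ∀ i j → toℕ i ≤ toℕ j → y (σ ⟨$⟩ʳ i) ≤ y (σ ⟨$⟩ʳ j))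
         (gap≤w : ∀ k → circ L ∣ y (σ ⟨$⟩ʳ next k) - y (σ ⟨$⟩ʳ k) ∣ ≤ w) where
  private
    gap : Fin N → ℕ
    gap k = circ L ∣ y (σ ⟨$⟩ʳ next k) - y (σ ⟨$⟩ʳ k) ∣

    gap<L : ∀ k → gap k < L
    gap<L k = ≤-<-trans (m⊓n≤m _ _) (≤-<-trans (∣m-n∣≤m⊔n (y (σ ⟨$⟩ʳ next k)) (y (σ ⟨$⟩ʳ k))) (⊔-lub (y<L _) (y<L _)))

    gaps : List ℕ
    gaps = deduplicate _≟_ (map gap (allFin N))

    gap∈gaps : ∀ k → gap k ∈ gaps
    gap∈gaps k = ∈-deduplicate⁺ _≟_ (∈-map⁺ gap (∈-allFin k))

    gaps⊆ : ∀ {c} → c ∈ gaps → ∃ λ k → c ≡ gap k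
    gaps⊆ c∈gaps with ∈-map⁻ gap (∈-deduplicate⁻ _≟_ (map gap (allFin N)) c∈gaps)
    ... | k , _ , eq = k , eq

    gapℝ : ℕ → ℝ
    gapℝ c = fromℚ (+ c ℚ./ L)

    gapℝ-injective : ∀ {c d} → gapℝ c ≈ℝ gapℝ d → c ≡ d
    gapℝ-injective {c} {d} eq = ≤-antisym (below c d (ℚₚ.≤-reflexive c/L≡d/L)) (below d c (ℚₚ.≤-reflexive (sym c/L≡d/L)))
      where
      c/L≡d/L : + c ℚ./ L ≡ + d ℚ./ L
      c/L≡d/L = fromℚ-injective {+ c ℚ./ L} {+ d ℚ./ L} eq
      below : ∀ c d → + c ℚ./ L ℚ.≤ + d ℚ./ L → c ≤ d
      below c d c/L≤d/L = ≮⇒≥ λ d<c → ℚₚ.<-irrefl refl (ℚₚ.<-≤-trans (frac-mono-< d c L L (*-monoˡ-< L d<c)) c/L≤d/L)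

    dist-gap : ∀ k {ε} m → seq (dist (x (index (σ ⟨$⟩ʳ next k))) (x (index (σ ⟨$⟩ʳ k)))) m ≡ ε → ε ≡ + gap k ℚ./ L
    dist-gap k m refl = trans (cong₂ (λ a b → seq (dist a b) m) (x≡y/L (σ ⟨$⟩ʳ next k)) (x≡y/L (σ ⟨$⟩ʳ k)))
      (distℚ-frac L (<⇒≤ (y<L _)) (<⇒≤ (y<L _)))

    dist≈gap : ∀ k → gapℝ (gap k) ≈ℝ dist (x (index (σ ⟨$⟩ʳ next k))) (x (index (σ ⟨$⟩ʳ k)))
    dist≈gap k {ε} 0<ε = 0 , λ m _ → subst (λ t → ℚ.∣ + gap k ℚ./ L ℚ.- t ∣ ℚ.< ε) (sym (dist-gap k m refl))
      (subst (λ t → ℚ.∣ t ∣ ℚ.< ε) (sym (ℚₚ.+-inverseʳ (+ gap k ℚ./ L))) 0<ε)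

    sorts : Sorts x σ
    sorts i j i≤j = subst₂ _≤ℝ_ (sym (x≡y/L (σ ⟨$⟩ʳ i))) (sym (x≡y/L (σ ⟨$⟩ʳ j)))
      (fromℚ-mono-≤ (frac-mono-≤ (y (σ ⟨$⟩ʳ i)) (y (σ ⟨$⟩ʳ j)) L L (*-monoˡ-≤ L (sorted i j i≤j))))

    ∈⇒isGap : ∀ r → Any.Any (r ≈ℝ_) (map gapℝ gaps) → IsGap x σ r
    ∈⇒isGap r r∈ with find (Anyₚ.map⁻ r∈)
    ... | c , c∈gaps , r≈c with gaps⊆ c∈gaps
    ...   | k , refl = ≈frac⇒∈[0,1⟩ {r} r≈c (gap<L k) , k ,
      Setoid.trans ≈ℝ-setoid {r} {gapℝ (gap k)} {dist (x (index (σ ⟨$⟩ʳ next k))) (x (index (σ ⟨$⟩ʳ k)))} r≈c (dist≈gap k)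

    isGap⇒∈ : ∀ r → IsGap x σ r → Any.Any (r ≈ℝ_) (map gapℝ gaps)
    isGap⇒∈ r (_ , k , r≈dist) = Anyₚ.map⁺ (lose {P = λ c → r ≈ℝ gapℝ c} (gap∈gaps k) r≈gap)
      where
      d = dist (x (index (σ ⟨$⟩ʳ next k))) (x (index (σ ⟨$⟩ʳ k)))
      r≈gap : r ≈ℝ gapℝ (gap k)
      r≈gap = Setoid.trans ≈ℝ-setoid {r} {d} {gapℝ (gap k)} r≈dist (Setoid.sym ≈ℝ-setoid {gapℝ (gap k)} {d} (dist≈gap k))

  -- The gaps are c / L with integers 0 ≤ c ≤ w. Duplicates are removed among the integers c, where
  -- equality is decidable, and injectivity of `gapℝ` carries uniqueness to ℝ.
  gapCount-grid : ∃ λ m → GapCount x N m × m ≤ suc w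
  gapCount-grid = length gaps , (σ , sorts , map gapℝ gaps , length-map gapℝ gaps ,
      UniqueSetoid.map⁺ (setoid ℕ) ≈ℝ-setoid gapℝ-injective (deduplicate-! (map gap (allFin N))) ,
      λ r → mk⇔ (∈⇒isGap r) (isGap⇒∈ r)) ,
    subst (length gaps ≤_) (length-upTo (suc w)) (Unique-⊆-length (deduplicate-! (map gap (allFin N)))
      (λ c∈gaps → let k , c≡gap = gaps⊆ c∈gaps in ∈-upTo⁺ (s≤s (subst (_≤ w) (sym c≡gap) (gap≤w k)))))

-- The layered sequence in ℝ: passage to real s, and its gaps

module LayeredSequence (n : ℕ → ℕ) (n≢0 : ∀ k → NonZero (n k)) where

  open Layers n n≢0

  private instance
    n-nonZero : ∀ {k} → NonZero (n k)
    n-nonZero {k} = n≢0 k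

  point : ℕ → ℚ
  point i = + offset i ℚ./ n (layer i)

  x : ℕ⁺ → ℝ
  x p = fromℚ (point (pred (value p)))

  point≡ : ∀ i L .{{_ : NonZero L}} → n (layer i) ∣ L → point i ≡ + (offset i * (L / n (layer i))) ℚ./ L
  point≡ i L n∣L = frac-≡ (offset i) (offset i * (L / n (layer i))) (n (layer i)) L
    (trans (cong (offset i *_) (sym (m/n*n≡m n∣L))) (sym (*-assoc (offset i) (L / n (layer i)) (n (layer i)))))

  grid-< : ∀ i L .{{_ : NonZero L}} → n (layer i) ∣ L → offset i * (L / n (layer i)) < L
  grid-< i L n∣L = subst (offset i * (L / n (layer i)) <_) (m*[n/m]≡n n∣L)
    (*-monoˡ-< (L / n (layer i)) {{L/n≢0}} (proj₂ (decode-correct i)))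
    where
    L/n≢0 : NonZero (L / n (layer i))
    L/n≢0 = ≢-nonZero (λ eq → ≢-nonZero⁻¹ L (trans (sym (m/n*n≡m n∣L)) (cong (_* n (layer i)) eq)))

  x∈[0,1⟩ : ∀ p → x p ∈[0,1⟩
  x∈[0,1⟩ p = ≈frac⇒∈[0,1⟩ {x p} (Setoid.refl ≈ℝ-setoid {x p}) (proj₂ (decode-correct (pred (value p))))

  module _ (i j : ℕ) where
    private
      a = n (layer i)
      b = n (layer j)
      u = offset i
      v = offset j
      instance
        ab≢0 : NonZero (a * b)
        ab≢0 = m*n≢0 a b

    distℚ-points : distℚ (point i) (point j) ≡ + circ (a * b) ∣ u * b - v * a ∣ ℚ./ (a * b)
    distℚ-points = begin
      distℚ (point i) (point j)
        ≡⟨ cong₂ distℚ (frac-≡ u (u * b) a (a * b) (l u a b)) (frac-≡ v (v * a) b (a * b) (l′ v a b)) ⟩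
      distℚ (+ (u * b) ℚ./ (a * b)) (+ (v * a) ℚ./ (a * b))
        ≡⟨ distℚ-frac (a * b) (*-monoˡ-≤ b (<⇒≤ (proj₂ (decode-correct i))))
             (subst (v * a ≤_) (*-comm b a) (*-monoˡ-≤ a (<⇒≤ (proj₂ (decode-correct j))))) ⟩
      + circ (a * b) ∣ u * b - v * a ∣ ℚ./ (a * b) ∎
      where
      open ≡-Reasoning
      l : ∀ u a b → u * (a * b) ≡ u * b * a
      l = solve-∀
      l′ : ∀ u a b → u * (a * b) ≡ u * a * b
      l′ = solve-∀

    module _ (P Q : ℕ) .{{_ : NonZero Q}} where

      close⇒distℚ< : Close P Q i j → distℚ (point i) (point j) ℚ.< + P ℚ./ Q
      close⇒distℚ< (_ , near) = subst (ℚ._< + P ℚ./ Q) (sym distℚ-points)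
        (frac-mono-< (circ (a * b) ∣ u * b - v * a ∣) P (a * b) Q near)

      distℚ<⇒close : i ≢ j → distℚ (point i) (point j) ℚ.< + P ℚ./ Q → Close P Q i j
      distℚ<⇒close i≢j dist< = i≢j , frac-cancel-< (circ (a * b) ∣ u * b - v * a ∣) P (a * b) Q
        (subst (ℚ._< + P ℚ./ Q) distℚ-points dist<)

  module _ (P Q N : ℕ) where
    private
      pairs : List (Fin N × Fin N)
      pairs = cartesianProduct (allFin N) (allFin N)

      closePair? : (p : Fin N × Fin N) → Dec (Close P Q (toℕ (proj₁ p)) (toℕ (proj₂ p)))
      closePair? (i , j) = close? P Q (toℕ i) (toℕ j)

      closePairs : List (Fin N × Fin N)
      closePairs = filter closePair? pairs

      length-closePairs : length closePairs ≡ pairCount P Q N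
      length-closePairs = length-filter-cartesianProduct closePair? (λ i → i) (λ j → j) (λ i j → 𝟙 (close? P Q i j)) (λ i j → refl)

      ∈-pairs : ∀ p → p ∈ pairs
      ∈-pairs (i , j) = ∈-cartesianProduct⁺ (∈-allFin i) (∈-allFin j)

    -- Closeness for a real s is not decidable, so its pairs are enclosed between the decidable
    -- counts at two rational thresholds. Each comparison needs one inclusion only.
    length-≤-pairCount : ∀ {as : List (Fin N × Fin N)} → Unique as →
      (∀ i j → (i , j) ∈ as → Close P Q (toℕ i) (toℕ j)) → length as ≤ pairCount P Q N
    length-≤-pairCount {as} as! close = subst (length as ≤_) length-closePairs
      (Unique-⊆-length as! (λ {p} p∈as → ∈-filter⁺ closePair? (∈-pairs p) (close (proj₁ p) (proj₂ p) p∈as)))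

    pairCount-≤-length : ∀ {as : List (Fin N × Fin N)} →
      (∀ i j → Close P Q (toℕ i) (toℕ j) → (i , j) ∈ as) → pairCount P Q N ≤ length as
    pairCount-≤-length {as} close = subst (_≤ length as) length-closePairs
      (Unique-⊆-length (filter⁺ closePair? (cartesianProduct⁺ (allFin⁺ N) (allFin⁺ N)))
        (λ {p} p∈ → close (proj₁ p) (proj₂ p) (proj₂ (∈-filter⁻ closePair? {xs = pairs} p∈))))

  module _ (N : ℕ) .{{_ : NonZero N}} (s : ℝ) (q : ℕ) .{{_ : NonZero q}} where
    private
      instance
        qN≢0 : NonZero (q * N)
        qN≢0 = m*n≢0 q N
        1/N≥0 : ℚ.NonNegative (+ 1 ℚ./ N)
        1/N≥0 = ℚ.nonNegative (0≤frac 1 N)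

    closePair⇒close : ∀ P n₀ → (∀ m → n₀ ≤ m → seq s m ℚ.≤ + P ℚ./ q) →
      ∀ i j → ClosePair x N s (i , j) → Close P (q * N) (toℕ i) (toℕ j)
    closePair⇒close P n₀ s≤P/q i j (i≢j , δ , 0<δ , K , dist+δ≤) =
      distℚ<⇒close (toℕ i) (toℕ j) P (q * N) (λ eq → i≢j (toℕ-injective eq)) (begin-strict
        D                              ≡⟨ ℚₚ.+-identityʳ D ⟨
        D ℚ.+ 0ℚ                       <⟨ ℚₚ.+-monoʳ-< D 0<δ ⟩
        D ℚ.+ δ                        ≤⟨ dist+δ≤ m (m≤m⊔n K n₀) ⟩
        seq s m ℚ.* (+ 1 ℚ./ N)        ≤⟨ ℚₚ.*-monoʳ-≤-nonNeg (+ 1 ℚ./ N) (s≤P/q m (m≤n⊔m K n₀)) ⟩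
        + P ℚ./ q ℚ.* (+ 1 ℚ./ N)      ≡⟨ frac-* P q N ⟩
        + P ℚ./ (q * N)                ∎)
      where
      open ℚₚ.≤-Reasoning
      D = distℚ (point (toℕ i)) (point (toℕ j))
      m = K ⊔ n₀

    close⇒closePair : ∀ P n₀ → (∀ m → n₀ ≤ m → + P ℚ./ q ℚ.≤ seq s m) →
      ∀ i j → Close P (q * N) (toℕ i) (toℕ j) → ClosePair x N s (i , j)
    close⇒closePair P n₀ P/q≤s i j close = (λ i≡j → proj₁ close (cong toℕ i≡j)) , P/qN ℚ.- D ,
      subst (ℚ._< P/qN ℚ.- D) (ℚₚ.+-inverseʳ D) (ℚₚ.+-monoˡ-< (ℚ.- D) (close⇒distℚ< (toℕ i) (toℕ j) P (q * N) close)) ,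
      n₀ , λ m n₀≤m → begin
        D ℚ.+ (P/qN ℚ.- D)             ≡⟨ q+[p-q]≡p P/qN D ⟩
        P/qN                           ≡⟨ frac-* P q N ⟨
        + P ℚ./ q ℚ.* (+ 1 ℚ./ N)      ≤⟨ ℚₚ.*-monoʳ-≤-nonNeg (+ 1 ℚ./ N) (P/q≤s m n₀≤m) ⟩
        seq s m ℚ.* (+ 1 ℚ./ N)        ∎
      where
      open ℚₚ.≤-Reasoning
      D = distℚ (point (toℕ i)) (point (toℕ j))
      P/qN = + P ℚ./ (q * N)

  module Estimate (s : ℝ) (q : ℕ) .{{_ : NonZero q}} (a n₀ : ℕ)
    (0≤s : ∀ m → n₀ ≤ m → 0ℚ ℚ.≤ seq s m)
    (a/q<s+e : ∀ m → n₀ ≤ m → + a ℚ./ q ℚ.< seq s m ℚ.+ + 1 ℚ./ q)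
    (s<[a+2]/q : ∀ m → n₀ ≤ m → seq s m ℚ.< + (a + 2) ℚ./ q)
    (N : ℕ) .{{_ : NonZero N}}
    (upper : q * pairCount (a + 2) (q * N) N ≤ (2 * (a + 2) + 1) * N)
    (lower : 2 * pred a * N ≤ q * pairCount (pred a) (q * N) N + N)
    (as : List (Fin N × Fin N)) (as! : Unique as) (as⇔ : ∀ p → (p ∈ as) ⇔ ClosePair x N s p)
    where
    open ℚₚ.≤-Reasoning
    w = + length as ℚ./ N
    e = + 1 ℚ./ q

    -- For a = 0 the truncated predecessor is 0 again, and the bound comes from p being nonnegative.
    [a-1]/q≤ : ∀ a {p} → 0ℚ ℚ.≤ p → + a ℚ./ q ℚ.< p ℚ.+ e → + pred a ℚ./ q ℚ.≤ p
    [a-1]/q≤ zero    {p} 0≤p _ = subst (ℚ._≤ p) (frac-≡ 0 0 1 q refl) 0≤p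
    [a-1]/q≤ (suc a) {p} _ a/q<p+e = subst (ℚ._≤ p) (frac-∸ {1} {suc a} q (s≤s z≤n))
      (ℚₚ.<⇒≤ (p<q+ε⇒p-q<ε (+ suc a ℚ./ q) e (subst (+ suc a ℚ./ q ℚ.<_) (ℚₚ.+-comm p e) a/q<p+e)))

    k≤upper : length as ≤ pairCount (a + 2) (q * N) N
    k≤upper = length-≤-pairCount (a + 2) (q * N) N as! λ i j ij∈as →
      closePair⇒close N s q (a + 2) n₀ (λ m n₀≤m → ℚₚ.<⇒≤ (s<[a+2]/q m n₀≤m)) i j (Equivalence.to (as⇔ (i , j)) ij∈as)

    lower≤k : pairCount (pred a) (q * N) N ≤ length as
    lower≤k = pairCount-≤-length (pred a) (q * N) N λ i j close →
      Equivalence.from (as⇔ (i , j)) (close⇒closePair N s q (pred a) n₀ (λ m n₀≤m → [a-1]/q≤ a (0≤s m n₀≤m) (a/q<s+e m n₀≤m)) i j close)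

    w≤ : w ℚ.≤ + (a + a + 5) ℚ./ q
    w≤ = frac-mono-≤ (length as) (a + a + 5) N q (subst₂ _≤_ (*-comm q (length as)) (cong (_* N) (l a))
      (≤-trans (*-monoʳ-≤ q k≤upper) upper))
      where
      l : ∀ a → 2 * (a + 2) + 1 ≡ a + a + 5
      l = solve-∀

    -- The lower bound for q F: twice the numerator a - 1 of the smaller threshold, less the error
    -- 1.
    b = 2 * pred a ∸ 1

    b/q≤w : + b ℚ./ q ℚ.≤ w
    b/q≤w = frac-mono-≤ b (length as) q N (rearrange (≤-trans lower
      (+-monoˡ-≤ N (*-monoʳ-≤ q lower≤k))))
      where
      rearrange : 2 * pred a * N ≤ q * length as + N → b * N ≤ length as * q
      rearrange h = subst₂ _≤_ (sym (trans (*-distribʳ-∸ N (2 * pred a) 1) (cong (2 * pred a * N ∸_) (*-identityˡ N))))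
        (*-comm q (length as)) (m≤n+o⇒m∸n≤o (2 * pred a * N) N (subst (2 * pred a * N ≤_) (+-comm (q * length as) N) h))

    -- Equality holds for a ≥ 2, where b = 2 a - 3; for a ≤ 1 truncation only makes b larger. This
    -- is one source of the 7; the other is (2 a + 5) / q < 2 s + 7 / q.
    2a+4≤b+7 : ∀ a → (a + 2) + (a + 2) ≤ (2 * pred a ∸ 1) + 7
    2a+4≤b+7 zero     = m≤n+m 4 3
    2a+4≤b+7 (suc a′) = subst₂ _≤_ (l a′) (l′ (2 * a′ ∸ 1)) (+-monoʳ-≤ 6 (m≤n+m∸n (2 * a′) 1))
      where
      l : ∀ a → 6 + 2 * a ≡ suc a + 2 + (suc a + 2)
      l = solve-∀
      l′ : ∀ b → 6 + (1 + b) ≡ b + 7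
      l′ = solve-∀

    w<2s+7/q : ∀ m → n₀ ≤ m → w ℚ.< (seq s m ℚ.+ seq s m) ℚ.+ + 7 ℚ./ q
    w<2s+7/q m n₀≤m = begin-strict
      w                                                          ≤⟨ w≤ ⟩
      + (a + a + 5) ℚ./ q                                        ≡⟨ frac-+ (a + a) 5 q ⟨
      + (a + a) ℚ./ q ℚ.+ + 5 ℚ./ q                              ≡⟨ cong (ℚ._+ + 5 ℚ./ q) (frac-+ a a q) ⟨
      + a ℚ./ q ℚ.+ + a ℚ./ q ℚ.+ + 5 ℚ./ q                      <⟨ ℚₚ.+-monoˡ-< (+ 5 ℚ./ q) (ℚₚ.+-mono-< (a/q<s+e m n₀≤m) (a/q<s+e m n₀≤m)) ⟩
      (u ℚ.+ e) ℚ.+ (u ℚ.+ e) ℚ.+ + 5 ℚ./ q                      ≡⟨ l u e (+ 5 ℚ./ q) ⟩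
      (u ℚ.+ u) ℚ.+ (e ℚ.+ e ℚ.+ + 5 ℚ./ q)                      ≡⟨ cong ((u ℚ.+ u) ℚ.+_) (trans (cong (ℚ._+ + 5 ℚ./ q) (frac-+ 1 1 q)) (frac-+ 2 5 q)) ⟩
      (u ℚ.+ u) ℚ.+ + 7 ℚ./ q                                    ∎
      where
      u = seq s m
      l : ∀ u e f → (u ℚ.+ e) ℚ.+ (u ℚ.+ e) ℚ.+ f ≡ (u ℚ.+ u) ℚ.+ (e ℚ.+ e ℚ.+ f)
      l = solve 3 (λ u e f → (u :+ e) :+ (u :+ e) :+ f := (u :+ u) :+ (e :+ e :+ f)) refl
        where open +-*-Solver

    2s<w+7/q : ∀ m → n₀ ≤ m → seq s m ℚ.+ seq s m ℚ.< w ℚ.+ + 7 ℚ./ q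
    2s<w+7/q m n₀≤m = begin-strict
      seq s m ℚ.+ seq s m                      <⟨ ℚₚ.+-mono-< (s<[a+2]/q m n₀≤m) (s<[a+2]/q m n₀≤m) ⟩
      + (a + 2) ℚ./ q ℚ.+ + (a + 2) ℚ./ q      ≡⟨ frac-+ (a + 2) (a + 2) q ⟩
      + (a + 2 + (a + 2)) ℚ./ q                ≤⟨ frac-mono-≤ (a + 2 + (a + 2)) (b + 7) q q (*-monoˡ-≤ q (2a+4≤b+7 a)) ⟩
      + (b + 7) ℚ./ q                          ≡⟨ frac-+ b 7 q ⟨
      + b ℚ./ q ℚ.+ + 7 ℚ./ q                  ≤⟨ ℚₚ.+-monoˡ-≤ (+ 7 ℚ./ q) b/q≤w ⟩
      w ℚ.+ + 7 ℚ./ q                          ∎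

    estimate : ∀ m → n₀ ≤ m → ℚ.∣ w ℚ.- (seq s m ℚ.+ seq s m) ∣ ℚ.< + 7 ℚ./ q
    estimate m n₀≤m = ∣p∣<ε (p<q+ε⇒p-q<ε w (seq s m ℚ.+ seq s m) (w<2s+7/q m n₀≤m))
      (subst (ℚ._< + 7 ℚ./ q) (sym (neg-sub w (seq s m ℚ.+ seq s m)))
        (p<q+ε⇒p-q<ε (seq s m ℚ.+ seq s m) w (2s<w+7/q m n₀≤m)))

  module _ (pairCount-asymptotics : ∀ P q .{{_ : NonZero q}} → Eventually (λ N → .{{_ : NonZero N}} →
              q * pairCount P (q * N) N ≤ (2 * P + 1) * N × 2 * P * N ≤ q * pairCount P (q * N) N + N)) where

    poissonian : PoissonianPairCorrelations x
    poissonian s (δ , 0<δ , K₀ , δ≤s) ε (η , 0<η , Kε , η≤ε) = N₀ , estimate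
      where
      -- This makes 8 / q ≤ η: 7 / q for the estimate and 1 / q for the margin in the strict
      -- inequality.
      q = suc (proj₁ (archimedean 7 0<η))
      e = + 1 ℚ./ q
      8/q≤η : + 8 ℚ./ q ℚ.≤ η
      8/q≤η = proj₂ (archimedean 7 0<η)
      s-cauchy = cauchy s (0<frac 1 q)
      n₀ = K₀ ⊔ proj₁ s-cauchy
      0≤s : ∀ m → n₀ ≤ m → 0ℚ ℚ.≤ seq s m
      0≤s m n₀≤m = begin
        0ℚ          ≤⟨ ℚₚ.<⇒≤ 0<δ ⟩
        δ           ≡⟨ ℚₚ.+-identityˡ δ ⟨
        0ℚ ℚ.+ δ    ≤⟨ δ≤s m (m⊔n≤o⇒m≤o K₀ _ n₀≤m) ⟩
        seq s m     ∎
        where open ℚₚ.≤-Reasoning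
      -- A single term of s is rounded down to a / q. The later terms are within 1 / q of it, so
      -- they all lie between (a - 1) / q and (a + 2) / q.
      σ = seq s n₀
      a = proj₁ (floor q σ (0≤s n₀ ≤-refl))
      a/q≤σ : + a ℚ./ q ℚ.≤ σ
      a/q≤σ = proj₁ (proj₂ (floor q σ (0≤s n₀ ≤-refl)))
      σ<1+a/q : σ ℚ.< + suc a ℚ./ q
      σ<1+a/q = proj₂ (proj₂ (floor q σ (0≤s n₀ ≤-refl)))
      s-close : ∀ m → n₀ ≤ m → ℚ.∣ seq s m ℚ.- σ ∣ ℚ.< e
      s-close m n₀≤m = proj₂ s-cauchy m n₀ (m⊔n≤o⇒n≤o K₀ _ n₀≤m) (m≤n⊔m K₀ _)
      s<[a+2]/q : ∀ m → n₀ ≤ m → seq s m ℚ.< + (a + 2) ℚ./ q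
      s<[a+2]/q m n₀≤m = begin-strict
        seq s m                  <⟨ ∣p-q∣<ε⇒p<q+ε (seq s m) σ (s-close m n₀≤m) ⟩
        σ ℚ.+ e                  <⟨ ℚₚ.+-monoˡ-< e σ<1+a/q ⟩
        + suc a ℚ./ q ℚ.+ e      ≡⟨ frac-+ (suc a) 1 q ⟩
        + (suc a + 1) ℚ./ q      ≡⟨ cong (λ t → + t ℚ./ q) (sym (+-suc a 1)) ⟩
        + (a + 2) ℚ./ q          ∎
        where open ℚₚ.≤-Reasoning
      a/q<s+e : ∀ m → n₀ ≤ m → + a ℚ./ q ℚ.< seq s m ℚ.+ e
      a/q<s+e m n₀≤m = ℚₚ.≤-<-trans a/q≤σ (∣p-q∣<ε⇒p<q+ε σ (seq s m) (swap-close (seq s m) σ (s-close m n₀≤m)))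
      upper = pairCount-asymptotics (a + 2) q
      lower = pairCount-asymptotics (pred a) q
      N₀ = proj₁ upper + proj₁ lower

      estimate : (N : ℕ) .{{_ : NonZero N}} → N₀ ≤ N → (k : ℕ) → PairCount x N s k →
                 ∣ fromℚ (+ k ℚ./ N) -ℝ (s +ℝ s) ∣ℝ <ℝ ε
      estimate N N₀≤N k (as , refl , as! , as⇔) = e , 0<frac 1 q , n₀ ⊔ Kε , λ m n₀⊔Kε≤m → begin
        ℚ.∣ w ℚ.- (seq s m ℚ.+ seq s m) ∣ ℚ.+ e   ≤⟨ ℚₚ.+-monoˡ-≤ e (ℚₚ.<⇒≤ (Estimate.estimate s q a n₀ 0≤s a/q<s+e s<[a+2]/q N
          (proj₁ (proj₂ upper N (m+n≤o⇒m≤o (proj₁ upper) N₀≤N))) (proj₂ (proj₂ lower N (m+n≤o⇒n≤o (proj₁ upper) N₀≤N)))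
          as as! as⇔ m (m⊔n≤o⇒m≤o n₀ Kε n₀⊔Kε≤m))) ⟩
        + 7 ℚ./ q ℚ.+ e                           ≡⟨ frac-+ 7 1 q ⟩
        + 8 ℚ./ q                                 ≤⟨ 8/q≤η ⟩
        η                                         ≡⟨ ℚₚ.+-identityˡ η ⟨
        0ℚ ℚ.+ η                                  ≤⟨ η≤ε m (m⊔n≤o⇒n≤o n₀ Kε n₀⊔Kε≤m) ⟩
        seq ε m                                   ∎
        where
        open ℚₚ.≤-Reasoning
        w = + length as ℚ./ N

  module _ {N L : ℕ} .{{_ : NonZero N}} .{{_ : NonZero L}} (n∣L : ∀ i → i < N → n (layer i) ∣ L)
           {k : ℕ} (size≤N : size (suc k) ≤ N) (n[k]∣L : n k ∣ L) where
    private
      w = L / n k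

      w≢0 : NonZero w
      w≢0 = ≢-nonZero (λ eq → ≢-nonZero⁻¹ L (trans (sym (m/n*n≡m n[k]∣L)) (cong (_* n k) eq)))

      y : Fin N → ℕ
      y i = offset (toℕ i) * (L / n (layer (toℕ i)))

      y<L : ∀ i → y i < L
      y<L i = grid-< (toℕ i) L (n∣L (toℕ i) (toℕ<n i))

      multiple : ∀ u → u < n k → ∃ λ i → y i ≡ u * w
      multiple u u<n = fromℕ< i<N , cong (λ (a , u) → u * (L / n a))
        (trans (cong decode (toℕ-fromℕ< i<N)) (decode-position u<n))
        where
        i<N : size k + u < N
        i<N = <-≤-trans (+-monoʳ-< (size k) u<n) (subst (_≤ N) (size-suc k) size≤N)

      σ : Permutation′ N
      σ = proj₁ (sorting y)

    -- Layer k is complete among the first N points, and its points are precisely the multiples of w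
    -- / L, as `gap-≤` requires.
    gapCount-≤ : ∃ λ m → GapCount x N m × m ≤ suc w
    gapCount-≤ = gapCount-grid x y (λ i → cong fromℚ (point≡ (toℕ i) L (n∣L (toℕ i) (toℕ<n i)))) y<L
      σ (proj₂ (sorting y)) (gap-≤ {c = n k} {{_}} {{w≢0}} y y<L (m*[n/m]≡n n[k]∣L) multiple σ (proj₂ (sorting y)))

-- The number of gaps against f

module FewGaps (f : ℕ⁺ → ℕ⁺) (Φ : ℕ → ℕ) (2^top≤Φ : ∀ t → 2 ^ top t ≤ Φ t)
               (gapBound<f : ∀ t p → Φ t ≤ value p → gapBound t < value (f p)) where

  open Schedule Φ 2^top≤Φ
  open LayeredSequence n (λ k → layerSize-nonZero (state k)) public

  k₀ : ℕ
  k₀ = proj₁ (level-unbounded 1)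

  module _ (p : ℕ⁺) (k : ℕ) (k₀≤1+k : k₀ ≤ suc k) (layer≡ : layer (value p) ≡ suc k) where
    N = value p
    t = level (state (suc k))
    L = grid (state (suc k))

    instance
      N≢0 : NonZero N
      N≢0 = nonZero⁺ p
      n[k]≢0 : NonZero (n k)
      n[k]≢0 = layerSize-nonZero (state k)
      L≢0 : NonZero L
      L≢0 = m*n≢0 (2 ^ exponent (state (suc k))) (fermatProduct (top t)) {{m^n≢0 2 (exponent (state (suc k)))}} {{fermatProduct-nonZero (top t)}}

    size≤N : size (suc k) ≤ N
    size≤N = subst (λ a → size a ≤ N) layer≡ (size[layer]≤ N)

    -- The exceptional level 0 is over, since the level is at least 1 from k₀ on.
    Φ≤N : Φ t ≤ N
    Φ≤N with Φ[level]≤size (suc k)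
    ... | inj₁ t≡0 = contradiction t≡0 (n>0⇒n≢0 (proj₂ (level-unbounded 1) (suc k) k₀≤1+k))
    ... | inj₂ Φ≤size = ≤-trans Φ≤size size≤N

    -- Indices start at 0, so `layer N` belongs to the first point not yet present; the points i < N
    -- lie in layers up to `suc k`.
    n∣L : ∀ i → i < N → n (layer i) ∣ L
    n∣L i i<N = n∣grid (subst (layer i ≤_) layer≡ (s≤s⁻¹ (layer-< (<-trans i<N (<size[1+layer] N)))))

    L/n≤gapBound : L / n k ≤ gapBound t
    L/n≤gapBound = *-cancelʳ-≤ (L / n k) (gapBound t) (n k) (≤-trans (m/n*n≤m L (n k)) (grid≤gapBound*n k))

    -- There are at most L / n_k + 1 gap lengths; the strict inequality in `gapBound<f` accounts for
    -- the 1.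
    conclusion : ∃ λ m → GapCount x N m × m ≤ value (f p)
    conclusion = let m , gapCount , m≤ = gapCount-≤ n∣L {k} size≤N (n∣grid (n≤1+n k)) in
      m , gapCount , ≤-trans m≤ (≤-trans (s≤s L/n≤gapBound) (gapBound<f t p Φ≤N))

  size-bound : ℕ
  size-bound = size (suc k₀)

  few-gaps : (p : ℕ⁺) → size-bound ≤ value p → ∃ λ (m : ℕ) → GapCount x (value p) {{nonZero⁺ p}} m × m ≤ value (f p)
  few-gaps p size≤p = cases (layer (value p)) refl (layer-≥ size≤p)
    where
    cases : ∀ K → layer (value p) ≡ K → suc k₀ ≤ K →
      ∃ λ (m : ℕ) → GapCount x (value p) {{nonZero⁺ p}} m × m ≤ value (f p)
    cases (suc k) layer≡ (s≤s k₀≤k) = conclusion p k (m≤n⇒m≤1+n k₀≤k) layer≡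

  poissonian-x : PoissonianPairCorrelations x
  poissonian-x = poissonian pairCount-asymptotics

theorem1p4 : (f : ℕ⁺ → ℕ⁺) → TendsToInfinity f →
    ∃ λ (x : ℕ⁺ → ℝ) →
    ((n : ℕ⁺) → x n ∈[0,1⟩) ×
    PoissonianPairCorrelations x ×
    (∃ λ (n₀ : ℕ) → (n : ℕ⁺) → n₀ ≤ value n →
    ∃ λ (m : ℕ) → GapCount x (value n) {{nonZero⁺ n}} m × m ≤ value (f n))
theorem1p4 f f→∞ = x , x∈[0,1⟩ , poissonian-x , size-bound , few-gaps
  where
  -- From here on f exceeds the gap bound of level t. One threshold per level suffices because this
  -- bound depends on t only.
  threshold : ℕ → ℕ
  threshold t = proj₁ (f→∞ (suc (gapBound t)))
  open FewGaps f (λ t → 2 ^ top t ⊔ threshold t) (λ t → m≤m⊔n (2 ^ top t) (threshold t))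
    (λ t p Φ≤p → proj₂ (f→∞ (suc (gapBound t))) p (≤-trans (m≤n⊔m (2 ^ top t) (threshold t)) Φ≤p))
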